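{- A regular dessin is primitive and faithful if and only if it is (isomorphic to) a generalised Paley dessin.
   Context: Regular dessins are described combinatorially: a regular dessin $\mathcal D$ is determined up to isomorphism by a triple $(G;x,y)$ where $G$ is a finite group generated by $x$ and $y$; two triples $(G;x,y)$ and $(G';x',y')$ determine isomorphic dessins if and only if some group isomorphism $G\to G'$ sends $x\mapsto x'$, $y\mapsto y'$. Put $z=(xy)^{ -1}$. The black vertices, white vertices and face-centres of $\mathcal D$ are the left cosets of $\langle x\rangle$, $\langle y\rangle$, $\langle z\rangle$ in $G$, the edges are the elements of $G$, and the automorphism group ${\rm Aut}\,\mathcal D\cong G$ acts on all of these by left multiplication (regularly on the edges). A regular dessin is primitive (resp. faithful) if ${\rm Aut}\,\mathcal D$ acts primitively (resp. faithfully) on the set of black vertices. Generalised Paley dessins: let $p$ be a prime, $d\ge1$, $q=p^d$, and ${\mathbb F}_q$ the field of order $q$. Let ${\rm AGL}_1(q)$ be the group of maps $t\mapsto at+b$ ($a\in{\mathbb F}_q^*$, $b\in{\mathbb F}_q$) and $T=\{t\mapsto t+b\}$ its translation subgroup. For a subgroup $S\le{\mathbb F}_q^*$ of order $n$, identified with $\{t\mapsto at: a\in S\}$, let $G_S=\{t\mapsto at+b: a\in S, b\in{\mathbb F}_q\}=T\rtimes S$. Suppose either $n=d=1$, or $n>1$ and $p$ has multiplicative order $d$ modulo $n$. Let $x$ be a generator of $S$ and $y$ any element of $G_S\setminus S$ (then $G_S=\langle x,y\rangle$). The regular dessin given by $(G_S;x,y)$ is a generalised Paley dessin (of valency $n$,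 field characteristic $p$, dimension $d$). -}

module Defs where

open import Level using (Level; _⊔_; 0ℓ) renaming (suc to lsuc)
open import Algebra.Bundles using (Group; CommutativeRing)
open import Data.Nat using (ℕ; zero; suc; _<_; _≤_; _^_; _∸_)
open import Data.Nat.Divisibility using (_∣_)
open import Data.Nat.Primality using (Prime)
open import Data.Integer using (ℤ; +_; -[1+_])
open import Data.Fin using (Fin)
open import Data.Product using (Σ; ∃; ∃₂; _×_; _,_; proj₁; proj₂)
open import Data.Sum using (_⊎_)
open import Relation.Nullary using (¬_)
open import Relation.Binary using (Rel; Decidable; IsEquivalence)
open import Relation.Binary.PropositionalEquality using (_≡_)

module GroupDefs {c ℓ} (G : Group c ℓ) where
  open Group G

  pow : Carrier → ℕ → Carrier
  pow g zero    = ε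
  pow g (suc n) = g ∙ pow g n

  zpow : Carrier → ℤ → Carrier
  zpow g (+ n)    = pow g n
  zpow g -[1+ n ] = (pow g (suc n)) ⁻¹

  _∈⟨_⟩ : Carrier → Carrier → Set ℓ
  h ∈⟨ g ⟩ = ∃ λ (k : ℤ) → zpow g k ≈ h

  data Word : Set where
    wx wy we : Word
    wmul     : Word → Word → Word
    winv     : Word → Word

  evalW : Carrier → Carrier → Word → Carrier
  evalW x y wx         = x
  evalW x y wy         = y
  evalW x y we         = ε
  evalW x y (wmul u v) = evalW x y u ∙ evalW x y v
  evalW x y (winv u)   = (evalW x y u) ⁻¹

  Generates : Carrier → Carrier → Set (c ⊔ ℓ)
  Generates x y = ∀ g → ∃ λ (w : Word) → evalW x y w ≈ g

  -- g and h lie in the same left coset of ⟨ x ⟩ (i.e. the same black vertex)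
  SameCoset : Carrier → Carrier → Carrier → Set ℓ
  SameCoset x g h = (g ⁻¹ ∙ h) ∈⟨ x ⟩

  Faithful : Carrier → Set (c ⊔ ℓ)
  Faithful x = ∀ g → (∀ h → SameCoset x (g ∙ h) h) → g ≈ ε

  -- A G-invariant equivalence relation on the set of left cosets of ⟨ x ⟩
  -- (a system of blocks), presented as a relation on G coarser than SameCoset.
  record BlockSystem (x : Carrier) (R : Rel Carrier (c ⊔ ℓ)) : Set (c ⊔ ℓ) where
    field
      isEquivalence : IsEquivalence R
      coarser       : ∀ {g h} → SameCoset x g h → R g h
      invariant     : ∀ k {g h} → R g h → R (k ∙ g) (k ∙ h)

  -- G acts primitively on the left cosets of ⟨ x ⟩: there are at least two
  -- cosets and every block system that identifies two distinct cosets is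
  -- the universal one.  (The action on cosets is always transitive.)
  Primitive : Carrier → Set (lsuc (c ⊔ ℓ))
  Primitive x =
    (∃ λ g → ¬ SameCoset x ε g) ×
    (∀ (R : Rel Carrier (c ⊔ ℓ)) → BlockSystem x R →
       (∃₂ λ g h → R g h × ¬ SameCoset x g h) → ∀ g h → R g h)

record IsFiniteGroup {c ℓ} (G : Group c ℓ) : Set (c ⊔ ℓ) where
  open Group G
  field
    _≟_        : Decidable _≈_
    size       : ℕ
    enum       : Fin size → Carrier
    enum-surj  : ∀ g → ∃ λ i → enum i ≈ g

record RegularDessin (c ℓ : Level) : Set (lsuc (c ⊔ ℓ)) where
  field
    group     : Group c ℓ
    finite    : IsFiniteGroup group
  open Group group
  field
    x y       : Carrier
    generates : GroupDefs.Generates group x y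

record Field : Set₁ where
  field
    commRing : CommutativeRing 0ℓ 0ℓ
  open CommutativeRing commRing public
  field
    0≉1     : ¬ (0# ≈ 1#)
    inverse : ∀ a → ¬ (a ≈ 0#) → ∃ λ b → a * b ≈ 1#

record HasOrder (F : Field) (q : ℕ) : Set where
  open Field F
  field
    _≟_       : Decidable _≈_
    enum      : Fin q → Carrier
    enum-inj  : ∀ i j → enum i ≈ enum j → i ≡ j
    enum-surj : ∀ a → ∃ λ i → enum i ≈ a

module FieldDefs (F : Field) where
  open Field F

  fpow : Carrier → ℕ → Carrier
  fpow a zero    = 1#
  fpow a (suc n) = a * fpow a n

  HasMulOrder : Carrier → ℕ → Set
  HasMulOrder a n = 1 ≤ n × fpow a n ≈ 1# × (∀ k → 1 ≤ k → k < n → ¬ (fpow a k ≈ 1#))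

  -- the affine map t ↦ a t + b is encoded as the pair (a , b)
  Aff : Set
  Aff = Carrier × Carrier

  _≈A_ : Aff → Aff → Set
  (a , b) ≈A (a' , b') = a ≈ a' × b ≈ b'

  -- composition (a,b) ∘ (a',b') : t ↦ a (a' t + b') + b
  _∘A_ : Aff → Aff → Aff
  (a , b) ∘A (a' , b') = (a * a' , a * b' + b)

MulOrderMod : ℕ → ℕ → ℕ → Set
MulOrderMod p d n =
  1 ≤ d × n ∣ (p ^ d ∸ 1) × (∀ k → 1 ≤ k → k < d → ¬ (n ∣ (p ^ k ∸ 1)))

-- The regular dessin D is isomorphic to the generalised Paley dessin
-- (G_S ; t ↦ α t , y') where S = ⟨α⟩ ≤ F_q^* has order n, q = p^d.
module _ {c ℓ} (D : RegularDessin c ℓ) where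
  open RegularDessin D
  open Group group renaming (Carrier to GC; _≈_ to _≈G_)

  IsoToGenPaley : Set (lsuc 0ℓ ⊔ c ⊔ ℓ)
  IsoToGenPaley =
    Σ ℕ λ p → Σ ℕ λ d → Σ ℕ λ n → Σ Field λ F →
    let open Field F renaming (Carrier to FC)
        open FieldDefs F
    in Prime p × 1 ≤ d × HasOrder F (p ^ d) ×
       ((n ≡ 1 × d ≡ 1) ⊎ (1 < n × MulOrderMod p d n)) ×
       Σ FC λ α → HasMulOrder α n ×
       -- φ : G → G_S = { t ↦ a t + b : a ∈ ⟨α⟩ } is a group isomorphism
       Σ (GC → Aff) λ φ →
         (∀ g h → g ≈G h → φ g ≈A φ h) ×
         (∀ g h → φ (g ∙ h) ≈A (φ g ∘A φ h)) ×
         (∀ g h → φ g ≈A φ h → g ≈G h) ×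
         (∀ g → ∃ λ k → fpow α k ≈ proj₁ (φ g)) ×
         (∀ k b → ∃ λ g → φ g ≈A (fpow α k , b)) ×
         -- sending x to the generator t ↦ α t of S ...
         φ x ≈A (α , 0#) ×
         -- ... and y to an element of G_S ∖ S
         ¬ (proj₂ (φ y) ≈ 0#)

{-# OPTIONS --safe #-}
-- Let H = ⟨x⟩ be the point stabiliser, a maximal cyclic subgroup with trivial core. If
-- H ≠ 1, then H ∩ gHg⁻¹ = 1 for g ∉ H: an element of it has centraliser containing both H
-- and gHg⁻¹, hence everything. So G is a Frobenius group, and since H is abelian the
-- transfer G → H, computed on a transversal adapted to the double cosets HgH, restricts to
-- the identity on H; its kernel N is a normal complement (if H = 1, then N = G is cyclic).
-- By maximality N has no proper nontrivial subgroup normalised by x. Sylow conjugacy and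
-- the fact that every element of Nx is N-conjugate to x (n ↦ n⁻¹ xnx⁻¹ is injective) give
-- an x-invariant Sylow subgroup, so N is a p-group; then N equals its centre, and has
-- exponent p. By Schur's lemma N becomes a field generated over 𝔽ₚ by α, the operator of
-- conjugation by x. If the order n of α divides pᵏ − 1, then t ↦ t^(pᵏ) fixes α, hence is
-- the identity on N, and counting roots gives |N| ≤ pᵏ: so p has order d modulo n.
--
-- Conversely the block of the base point of a generalised Paley dessin is an additive
-- subgroup of 𝔽_q stable under α, and 𝔽ₚ[α] = 𝔽_q because ⟨α⟩ acts freely on 𝔽ₚ[α] ∖ 0,
-- so that n divides |𝔽ₚ[α]| − 1.
module Submission where

open import Defs
open import Level using (Level; _⊔_; 0ℓ; Lift; lift; lower)
open import Algebra.Bundles using (Group; AbelianGroup; CommutativeMonoid; CommutativeRing)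
open import Algebra.Structures using (IsGroup)
open import Data.Empty using (⊥; ⊥-elim)
open import Data.Fin as Fin using (Fin; zero; suc; toℕ; fromℕ<)
open import Data.Nat as ℕ using (ℕ; zero; suc; _≤_; _<_; z≤n; s≤s)
open import Data.Nat.Divisibility using (_∣_; divides)
open import Data.Nat.Primality using (Prime)
open import Data.Product using (Σ; ∃; ∃₂; _×_; _,_; proj₁; proj₂)
open import Data.Sum using (_⊎_; inj₁; inj₂)
open import Function.Bundles using (_⇔_; mk⇔)
open import Relation.Binary using (Rel; Setoid; Decidable; IsEquivalence; tri<; tri≈; tri>)
open import Relation.Nullary using (¬_; Dec; yes; no; ¬?; _×-dec_; _→-dec_)
open import Relation.Binary.PropositionalEquality as ≡ using (_≡_; _≢_)

-- For a general Frobenius group, the complement to H comes from character theory and the nilpotency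
-- of the kernel from Thompson's theorem. Here H is cyclic and maximal, which opens shorter routes:
-- commutativity of H makes the transfer available, and maximality turns one nontrivial x-invariant
-- p-subgroup of N into all of N. The transfer is the identity on H because malnormality makes H × H
-- act freely on every double coset HgH other than H, so off H the transversal can be chosen stable
-- under left multiplication by x. The Sylow subgroup is a p-subgroup grown until no element
-- normalising it can be adjoined. It carries a subnormal series with factors of order p, along
-- which fixed points are counted modulo p. The field is commutative from the outset, as it consists
-- of polynomials in one operator. Its unit is an element of N of order p, which gives
-- characteristic p, and with it exponent p of N, at once. All group theory takes place on `Fin m`,
-- where equality is decidable and subsets can be counted.

-- Identities in groups and commutative rings.

module Solvers where
  import Algebra.Properties.AbelianGroup as AbelianGroupProperties
  import Algebra.Properties.Group as GroupProperties
  import Algebra.Properties.Ring as RingProperties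
  import Algebra.Properties.Semiring.Mult as Multiples
  import Algebra.Solver.Ring as RingSolver
  open import Algebra.Solver.Ring.AlmostCommutativeRing using (_-Raw-AlmostCommutative⟶_; fromCommutativeRing)
  open import Data.Bool using (Bool; true; false; not)
  import Data.Bool.Properties as Bool
  import Data.Fin.Properties as Fin
  open import Data.Integer as ℤ using (ℤ; +_; -[1+_]; _⊖_; _◃_)
  import Data.Integer.Properties as ℤ
  open import Data.List using (List; []; _∷_)
  open import Data.Maybe using (Maybe; just; nothing)
  import Data.Nat.Properties as ℕ
  open import Data.Sign using (Sign)
  open import Data.Vec using (Vec; lookup)
  import Relation.Binary.Reflection as Reflection

  module GroupSolver {c ℓ} (G : Group c ℓ) where
    open Group G
    open GroupProperties G

    infixl 7 _⊕_
    infix  8 ⊝_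

    data Expr (n : ℕ) : Set where
      var : Fin n → Expr n
      one : Expr n
      _⊕_ : Expr n → Expr n → Expr n
      ⊝_  : Expr n → Expr n

    Letter : ℕ → Set
    Letter n = Fin n × Bool

    signed : Bool → Carrier → Carrier
    signed true  a = a
    signed false a = a ⁻¹

    ⟦_⟧ : ∀ {n} → Expr n → Vec Carrier n → Carrier
    ⟦ var i ⟧ ρ = lookup ρ i
    ⟦ one ⟧ ρ   = ε
    ⟦ e ⊕ f ⟧ ρ = ⟦ e ⟧ ρ ∙ ⟦ f ⟧ ρ
    ⟦ ⊝ e ⟧ ρ   = ⟦ e ⟧ ρ ⁻¹

    ⟦_⟧* : ∀ {n} → List (Letter n) → Vec Carrier n → Carrier
    ⟦ [] ⟧* ρ          = ε
    ⟦ (i , b) ∷ w ⟧* ρ = signed b (lookup ρ i) ∙ ⟦ w ⟧* ρ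

    cons : ∀ {n} → Letter n → List (Letter n) → List (Letter n)
    cons a [] = a ∷ []
    cons (i , b) ((j , c) ∷ w) with i Fin.≟ j | b Bool.≟ not c
    ... | yes _ | yes _ = w
    ... | _     | _     = (i , b) ∷ (j , c) ∷ w

    -- The flag says whether the inverse of the expression is meant, and the list is the already
    -- reduced rest of the word; since letters enter only through `cons`, one pass yields a freely
    -- reduced word.
    normalise : ∀ {n} → Bool → Expr n → List (Letter n) → List (Letter n)
    normalise b     (var i) w = cons (i , b) w
    normalise b     one     w = w
    normalise true  (e ⊕ f) w = normalise true e (normalise true f w)
    normalise false (e ⊕ f) w = normalise false f (normalise false e w)
    normalise b     (⊝ e)   w = normalise (not b) e w

    signed-cancel : ∀ c a b → b ≈ signed (not c) a ∙ (signed c a ∙ b)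
    signed-cancel true  a b = sym (\\-leftDividesʳ a b)
    signed-cancel false a b = sym (\\-leftDividesˡ a b)

    cons-correct : ∀ {n} (a : Letter n) w ρ → ⟦ cons a w ⟧* ρ ≈ ⟦ a ∷ w ⟧* ρ
    cons-correct a [] ρ = refl
    cons-correct (i , b) ((j , c) ∷ w) ρ with i Fin.≟ j | b Bool.≟ not c
    ... | yes ≡.refl | yes ≡.refl = signed-cancel c (lookup ρ i) (⟦ w ⟧* ρ)
    ... | yes _    | no _     = refl
    ... | no _     | _        = refl

    signed-not : ∀ b a → signed (not b) a ≈ signed b (a ⁻¹)
    signed-not true  a = refl
    signed-not false a = sym (⁻¹-involutive a)

    normalise-correct : ∀ {n} b (e : Expr n) w ρ →
                        ⟦ normalise b e w ⟧* ρ ≈ signed b (⟦ e ⟧ ρ) ∙ ⟦ w ⟧* ρ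
    normalise-correct b (var i) w ρ = cons-correct (i , b) w ρ
    normalise-correct true one w ρ = sym (identityˡ _)
    normalise-correct false one w ρ = sym (trans (∙-congʳ ε⁻¹≈ε) (identityˡ _))
    normalise-correct true (e ⊕ f) w ρ =
      trans (normalise-correct true e _ ρ)
            (trans (∙-congˡ (normalise-correct true f w ρ)) (sym (assoc _ _ _)))
    normalise-correct false (e ⊕ f) w ρ =
      trans (normalise-correct false f _ ρ)
            (trans (∙-congˡ (normalise-correct false e w ρ))
                   (trans (sym (assoc _ _ _)) (∙-congʳ (sym (⁻¹-anti-homo-∙ _ _)))))
    normalise-correct b (⊝ e) w ρ =
      trans (normalise-correct (not b) e w ρ) (∙-congʳ (signed-not b (⟦ e ⟧ ρ)))

    ⟦_⇓⟧ : ∀ {n} → Expr n → Vec Carrier n → Carrier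
    ⟦ e ⇓⟧ = ⟦ normalise true e [] ⟧*

    correct : ∀ {n} (e : Expr n) ρ → ⟦ e ⇓⟧ ρ ≈ ⟦ e ⟧ ρ
    correct e ρ = trans (normalise-correct true e [] ρ) (identityʳ _)

    open Reflection setoid var ⟦_⟧ ⟦_⇓⟧ correct public using (solve; _⊜_)


  -- Cancelling a against its negative means recognising that the coefficient 1 - 1 vanishes. With
  -- coefficients in ℤ, where equality is decidable, this works over every commutative ring.
  module IntegerCoefficients {c ℓ} (R : CommutativeRing c ℓ) where
    open CommutativeRing R hiding (zero)
    open RingProperties ring
    open Multiples semiring using (×-homo-+; ×1-homo-*) renaming (_×_ to _·_)
    open AbelianGroupProperties +-abelianGroup using (⁻¹-∙-comm)
    open GroupSolver +-group using () renaming (solve to solve₊; _⊕_ to _:∙_; ⊝_ to :⁻¹_; _⊜_ to _:≈_)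

    ⟦_⟧ᶻ : ℤ → Carrier
    ⟦ + n ⟧ᶻ      = n · 1#
    ⟦ -[1+ n ] ⟧ᶻ = - (suc n · 1#)

    ⊖-homo : ∀ m n → ⟦ m ⊖ n ⟧ᶻ ≈ m · 1# - n · 1#
    ⊖-homo m       zero    = sym (trans (+-congˡ -0#≈0#) (+-identityʳ _))
    ⊖-homo zero    (suc n) = sym (+-identityˡ _)
    ⊖-homo (suc m) (suc n) = trans (reflexive (≡.cong ⟦_⟧ᶻ (ℤ.[1+m]⊖[1+n]≡m⊖n m n))) (trans (⊖-homo m n)
      (trans (solve₊ 3 (λ a b u → a :∙ :⁻¹ b :≈ (a :∙ u) :∙ :⁻¹ (b :∙ u)) refl (m · 1#) (n · 1#) 1#)
             (+-cong (+-comm _ _) (-‿cong (+-comm _ _)))))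

    +-homo : ∀ i j → ⟦ i ℤ.+ j ⟧ᶻ ≈ ⟦ i ⟧ᶻ + ⟦ j ⟧ᶻ
    +-homo (+ m)    (+ n)    = ×-homo-+ 1# m n
    +-homo (+ m)    -[1+ n ] = ⊖-homo m (suc n)
    +-homo -[1+ m ] (+ n)    = trans (⊖-homo n (suc m)) (+-comm _ _)
    +-homo -[1+ m ] -[1+ n ] = trans
      (-‿cong (trans (reflexive (≡.cong (λ t → suc t · 1#) (≡.sym (ℕ.+-suc m n)))) (×-homo-+ 1# (suc m) (suc n))))
      (sym (⁻¹-∙-comm _ _))

    ◃-homo : ∀ n → ⟦ Sign.- ◃ n ⟧ᶻ ≈ - (n · 1#)
    ◃-homo zero    = sym -0#≈0#
    ◃-homo (suc n) = refl

    ◃-homo⁺ : ∀ n → ⟦ Sign.+ ◃ n ⟧ᶻ ≈ n · 1#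
    ◃-homo⁺ zero    = refl
    ◃-homo⁺ (suc n) = refl

    *-homo : ∀ i j → ⟦ i ℤ.* j ⟧ᶻ ≈ ⟦ i ⟧ᶻ * ⟦ j ⟧ᶻ
    *-homo (+ m)    (+ n)    = trans (◃-homo⁺ (m ℕ.* n)) (×1-homo-* m n)
    *-homo (+ m)    -[1+ n ] = trans (◃-homo (m ℕ.* suc n)) (trans (-‿cong (×1-homo-* m (suc n))) (-‿distribʳ-* _ _))
    *-homo -[1+ m ] (+ n)    = trans (◃-homo (suc m ℕ.* n)) (trans (-‿cong (×1-homo-* (suc m) n)) (-‿distribˡ-* _ _))
    *-homo -[1+ m ] -[1+ n ] = trans (◃-homo⁺ (suc m ℕ.* suc n)) (trans (×1-homo-* (suc m) (suc n))
      (sym (-x*-y≈x*y _ _)))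
      where
      -x*-y≈x*y : ∀ x y → - x * - y ≈ x * y
      -x*-y≈x*y x y = trans (sym (-‿distribˡ-* x (- y)))
        (trans (-‿cong (sym (-‿distribʳ-* x y))) (-‿involutive (x * y)))

    -‿homo : ∀ i → ⟦ ℤ.- i ⟧ᶻ ≈ - ⟦ i ⟧ᶻ
    -‿homo (+ zero)  = sym -0#≈0#
    -‿homo (+ suc n) = refl
    -‿homo -[1+ n ]  = sym (-‿involutive _)

    homomorphism : ℤ.+-*-rawRing -Raw-AlmostCommutative⟶ fromCommutativeRing R
    homomorphism = record
      { ⟦_⟧ = ⟦_⟧ᶻ ; +-homo = +-homo ; *-homo = *-homo ; -‿homo = -‿homo
      ; 0-homo = refl ; 1-homo = +-identityʳ 1# }

    equal? : ∀ i j → Maybe (⟦ i ⟧ᶻ ≈ ⟦ j ⟧ᶻ)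
    equal? i j with i ℤ.≟ j
    ... | yes eq = just (reflexive (≡.cong ⟦_⟧ᶻ eq))
    ... | no _   = nothing

    open RingSolver ℤ.+-*-rawRing (fromCommutativeRing R) homomorphism equal? public
      using (solve) renaming (_:+_ to _⊕_; _:*_ to _⊗_; :-_ to ⊝_; _:=_ to _⊜_)

-- Counting subsets of finite sets and orbits of cyclic actions.

module FiniteCounting where
  open import Data.Bool using (if_then_else_)
  open import Data.Fin using (_≟_)
  open import Data.Fin.Properties using (suc-injective; toℕ<n; toℕ-fromℕ<; toℕ-injective; any?)
  open import Data.Nat using (_+_; _*_; _∸_)
  open import Data.Nat.Coprimality using (prime⇒coprime; coprime-Bézout)
  open import Data.Nat.Divisibility using (_∣0; ∣-refl; ∣m∣n⇒∣m+n)
  open import Data.Nat.GCD using (module Bézout)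
  open import Data.Nat.Properties using (+-comm; +-assoc; ≤-trans; ≤-refl; m∸n+n≡m; <⇒≤; <-cmp; m∸n≤m; m<n⇒0<n∸m; ≤-<-trans; ≤-reflexive; n<1+n; <-irrefl; m<n+m; ≤-pred; m≤n+m; module ≤-Reasoning)
  open import Function using (_∘_)
  open ≡ using (refl; sym; trans; cong; cong₂; subst; module ≡-Reasoning)
  open import Relation.Nullary using (does)

  module Counting where
    indicator : ∀ {A : Set} → Dec A → ℕ
    indicator A? = if does A? then 1 else 0

    # : ∀ {m} {P : Fin m → Set} → (∀ i → Dec (P i)) → ℕ
    # {zero}  P? = 0
    # {suc m} P? = indicator (P? zero) + # (λ i → P? (suc i))

    indicator-cong : ∀ {A B : Set} (A? : Dec A) (B? : Dec B) → (A → B) → (B → A) →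
                     indicator A? ≡ indicator B?
    indicator-cong (yes _) (yes _) f g = refl
    indicator-cong (yes a) (no ¬b) f g = ⊥-elim (¬b (f a))
    indicator-cong (no ¬a) (yes b) f g = ⊥-elim (¬a (g b))
    indicator-cong (no _)  (no _)  f g = refl

    #-cong : ∀ {m} {P Q : Fin m → Set} (P? : ∀ i → Dec (P i)) (Q? : ∀ i → Dec (Q i)) →
             (∀ i → P i → Q i) → (∀ i → Q i → P i) → # P? ≡ # Q?
    #-cong {zero}  P? Q? f g = refl
    #-cong {suc m} P? Q? f g =
      cong₂ _+_ (indicator-cong (P? zero) (Q? zero) (f zero) (g zero))
                (#-cong (P? ∘ suc) (Q? ∘ suc) (f ∘ suc) (g ∘ suc))

    indicator-split : ∀ {A B : Set} (A? : Dec A) (B? : Dec B) →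
                      indicator A? ≡ indicator (A? ×-dec B?) + indicator (A? ×-dec ¬? B?)
    indicator-split (yes _) (yes _) = refl
    indicator-split (yes _) (no _)  = refl
    indicator-split (no _)  (yes _) = refl
    indicator-split (no _)  (no _)  = refl

    +-interchange : ∀ a b c d → (a + b) + (c + d) ≡ (a + c) + (b + d)
    +-interchange a b c d = begin
      (a + b) + (c + d) ≡⟨ +-assoc a b (c + d) ⟩
      a + (b + (c + d)) ≡⟨ cong (a +_) (sym (+-assoc b c d)) ⟩
      a + ((b + c) + d) ≡⟨ cong (λ t → a + (t + d)) (+-comm b c) ⟩
      a + ((c + b) + d) ≡⟨ cong (a +_) (+-assoc c b d) ⟩
      a + (c + (b + d)) ≡⟨ sym (+-assoc a c (b + d)) ⟩
      (a + c) + (b + d) ∎ where open ≡-Reasoning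

    #-split : ∀ {m} {P Q : Fin m → Set} (P? : ∀ i → Dec (P i)) (Q? : ∀ i → Dec (Q i)) →
              # P? ≡ # (λ i → P? i ×-dec Q? i) + # (λ i → P? i ×-dec ¬? (Q? i))
    #-split {zero}  P? Q? = refl
    #-split {suc m} P? Q? =
      trans (cong₂ _+_ (indicator-split (P? zero) (Q? zero)) (#-split (P? ∘ suc) (Q? ∘ suc)))
            (+-interchange (indicator (P? zero ×-dec Q? zero)) (indicator (P? zero ×-dec ¬? (Q? zero))) _ _)

    #-none : ∀ {m} {P : Fin m → Set} (P? : ∀ i → Dec (P i)) → (∀ i → ¬ P i) → # P? ≡ 0
    #-none {zero}  P? none = refl
    #-none {suc m} P? none with P? zero
    ... | yes p = ⊥-elim (none zero p)
    ... | no _  = #-none (P? ∘ suc) (none ∘ suc)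

    #≡0⇒none : ∀ {m} {P : Fin m → Set} (P? : ∀ i → Dec (P i)) → # P? ≡ 0 → ∀ i → ¬ P i
    #≡0⇒none {suc m} P? eq i p with P? zero
    #≡0⇒none {suc m} P? () i p | yes _
    #≡0⇒none {suc m} P? eq zero p | no ¬p = ¬p p
    #≡0⇒none {suc m} P? eq (suc i) p | no ¬p = #≡0⇒none (P? ∘ suc) eq i p

    #-single : ∀ {m} (c : Fin m) → # (λ i → i ≟ c) ≡ 1
    #-single {suc m} zero    = cong suc (#-none {m} (λ i → suc i ≟ zero {n = m}) (λ i ()))
    #-single {suc m} (suc c) =
      trans (#-cong (λ i → suc i ≟ suc c) (λ i → i ≟ c) (λ i → suc-injective) (λ i → cong suc))
            (#-single c)

    #-image : ∀ {m n} {P : Fin m → Set} (P? : ∀ i → Dec (P i)) (f : Fin n → Fin m) →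
              (∀ i j → f i ≡ f j → i ≡ j) → (∀ j → P (f j)) → (∀ i → P i → ∃ λ j → f j ≡ i) →
              # P? ≡ n
    #-image {n = zero} P? f inj into onto = #-none P? λ i p → case (onto i p)
      where case : ∀ {i} → (∃ λ (j : Fin 0) → f j ≡ i) → ⊥
            case ()
    #-image {n = suc n} {P} P? f inj into onto = begin
      # P?                                              ≡⟨ #-split P? (λ i → i ≟ f zero) ⟩
      # (λ i → P? i ×-dec (i ≟ f zero)) + # P'?         ≡⟨ cong₂ _+_ single rest ⟩
      suc n                                             ∎
      where
      open ≡-Reasoning
      P'? : ∀ i → Dec (P i × ¬ (i ≡ f zero))
      P'? i = P? i ×-dec ¬? (i ≟ f zero)
      single : # (λ i → P? i ×-dec (i ≟ f zero)) ≡ 1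
      single = trans (#-cong _ (λ i → i ≟ f zero) (λ i → proj₂)
                       (λ i eq → subst P (sym eq) (into zero) , eq)) (#-single (f zero))
      onto' : ∀ i → P i × ¬ (i ≡ f zero) → ∃ λ j → f (suc j) ≡ i
      onto' i (p , i≢) with onto i p
      ... | zero  , eq = ⊥-elim (i≢ (sym eq))
      ... | suc j , eq = j , eq
      rest : # P'? ≡ n
      rest = #-image P'? (f ∘ suc) (λ i j eq → suc-injective (inj _ _ eq))
               (λ j → into (suc j) , λ eq → case (inj _ _ eq)) onto'
        where case : ∀ {j : Fin n} → ¬ (Fin.suc j ≡ zero)
              case ()

    #-all : ∀ {m} {P : Fin m → Set} (P? : ∀ i → Dec (P i)) → (∀ i → P i) → # P? ≡ m
    #-all P? all = #-image P? (λ i → i) (λ _ _ eq → eq) all (λ i _ → i , refl)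

    #≤ : ∀ {m} {P : Fin m → Set} (P? : ∀ i → Dec (P i)) → # P? ≤ m
    #≤ {zero}  P? = z≤n
    #≤ {suc m} P? with P? zero
    ... | yes _ = s≤s (#≤ (P? ∘ suc))
    ... | no _  = ≤-trans (#≤ (P? ∘ suc)) (<⇒≤ (n<1+n m))

    #-pos : ∀ {m} {P : Fin m → Set} (P? : ∀ i → Dec (P i)) i → P i → 1 ≤ # P?
    #-pos P? i p with # P? in eq
    ... | zero  = ⊥-elim (#≡0⇒none P? eq i p)
    ... | suc _ = s≤s z≤n

    #-strict : ∀ {m} {P Q : Fin m → Set} (P? : ∀ i → Dec (P i)) (Q? : ∀ i → Dec (Q i)) →
               (∀ i → P i → Q i) → ∀ i → Q i → ¬ P i → # P? < # Q?
    #-strict P? Q? f i q ¬p = begin-strict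
      # P?                       ≡⟨ #-cong P? QP? (λ i p → f i p , p) (λ i → proj₂) ⟩
      # QP?                      <⟨ m<n+m (# QP?) (#-pos Q¬P? i (q , ¬p)) ⟩
      # Q¬P? + # QP?             ≡⟨ +-comm (# Q¬P?) _ ⟩
      # QP? + # Q¬P?             ≡⟨ sym (#-split Q? P?) ⟩
      # Q?                       ∎
      where
      open ≤-Reasoning
      QP? = λ i → Q? i ×-dec P? i
      Q¬P? = λ i → Q? i ×-dec ¬? (P? i)

    -- A missed value c would make the image, which has m elements, a proper subset of `Fin m`.
    injective⇒surjective : ∀ {m} (f : Fin m → Fin m) → (∀ i j → f i ≡ f j → i ≡ j) →
                           ∀ c → ∃ λ i → f i ≡ c
    injective⇒surjective {m} f inj c with any? (λ i → f i ≟ c)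
    ... | yes found = found
    ... | no c∉ = ⊥-elim (<-irrefl refl (begin-strict
      m                          ≡⟨ sym (#-image image? f inj (λ j → j , refl) (λ _ q → q)) ⟩
      # image?                   <⟨ #-strict image? (λ i → i ≟ i) (λ _ _ → refl) c refl c∉ ⟩
      # (λ (i : Fin m) → i ≟ i)  ≤⟨ #≤ _ ⟩
      m                          ∎))
      where
      open ≤-Reasoning
      image? : ∀ j → Dec (∃ λ i → f i ≡ j)
      image? j = any? λ i → f i ≟ j

  module Iteration {A : Set} where
    iterate : (A → A) → ℕ → A → A
    iterate a zero    i = i
    iterate a (suc n) i = a (iterate a n i)

    iterate-+ : ∀ a m n i → iterate a (m + n) i ≡ iterate a m (iterate a n i)
    iterate-+ a zero    n i = refl
    iterate-+ a (suc m) n i = cong a (iterate-+ a m n i)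

    iterate-fixed : ∀ a m n i → iterate a n i ≡ i → iterate a (m * n) i ≡ i
    iterate-fixed a zero    n i eq = refl
    iterate-fixed a (suc m) n i eq =
      trans (iterate-+ a n (m * n) i) (trans (cong (iterate a n) (iterate-fixed a m n i eq)) eq)

  module CyclicActions {m : ℕ} (a : Fin m → Fin m) where
    open Counting
    open Iteration

    iterate-preserves : ∀ {P : Fin m → Set} → (∀ i → P i → P (a i)) →
                        ∀ n i → P i → P (iterate a n i)
    iterate-preserves pres zero    i p = p
    iterate-preserves pres (suc n) i p = pres _ (iterate-preserves pres n i p)

    module _ (n : ℕ) where
      ∣#-free : ∀ fuel {P : Fin m → Set} (P? : ∀ i → Dec (P i)) → # P? ≤ fuel →
                (∀ i → P i → P (a i)) → (∀ i → P i → iterate a (suc n) i ≡ i) →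
                (∀ i → P i → ∀ k → 1 ≤ k → k < suc n → iterate a k i ≢ i) →
                suc n ∣ # P?
      ∣#-free fuel {P} P? bound pres period free with any? P?
      ... | no none = subst (suc n ∣_) (sym (#-none P? λ i p → none (i , p))) (suc n ∣0)
      ... | yes (i , p) = subst (suc n ∣_) (sym split) (∣m∣n⇒∣m+n ∣-refl (recurse fuel bound))
        where
        -- One orbit, of exactly n + 1 points, is removed and the rest is counted recursively; the
        -- fuel bounds the number of points left.
        orbit : Fin (suc n) → Fin m
        orbit t = iterate a (toℕ t) i
        Q? : ∀ j → Dec (∃ λ t → orbit t ≡ j)
        Q? j = any? λ t → orbit t ≟ j
        P∖Q? = λ j → P? j ×-dec ¬? (Q? j)
        distinct : ∀ s t → s < t → t < suc n → iterate a s i ≢ iterate a t i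
        distinct s t s<t t<n eq =
          free (iterate a s i) (iterate-preserves pres s i p) (t ∸ s) (m<n⇒0<n∸m s<t)
               (≤-<-trans (m∸n≤m t s) t<n)
               (trans (sym (iterate-+ a (t ∸ s) s i))
                      (trans (cong (λ u → iterate a u i) (m∸n+n≡m (<⇒≤ s<t))) (sym eq)))
        orbit-injective : ∀ s t → orbit s ≡ orbit t → s ≡ t
        orbit-injective s t eq with <-cmp (toℕ s) (toℕ t)
        ... | tri< s<t _ _ = ⊥-elim (distinct _ _ s<t (toℕ<n t) eq)
        ... | tri≈ _ s≡t _ = toℕ-injective s≡t
        ... | tri> _ _ t<s = ⊥-elim (distinct _ _ t<s (toℕ<n s) (sym eq))
        split : # P? ≡ suc n + # P∖Q?
        split = trans (#-split P? Q?)
          (cong (_+ # P∖Q?) (#-image (λ j → P? j ×-dec Q? j) orbit orbit-injective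
            (λ t → iterate-preserves pres (toℕ t) i p , t , refl) (λ j → proj₂)))
        retract : ∀ j → P j → iterate a n (a j) ≡ j
        retract j pj = trans (trans (sym (iterate-+ a n 1 j)) (cong (λ u → iterate a u j) (+-comm n 1)))
                             (period j pj)
        -- If a j lay on the removed orbit, so would j, because the n-th iterate of a undoes a. The
        -- starting point wraps around: its predecessor is the last point, of index n.
        pres' : ∀ j → P j × ¬ (∃ λ t → orbit t ≡ j) → P (a j) × ¬ (∃ λ t → orbit t ≡ a j)
        pres' j (pj , j∉) = pres j pj , λ
          { (zero , eq)  → j∉ (fromℕ< (n<1+n n) ,
              trans (cong (λ u → iterate a u i) (toℕ-fromℕ< (n<1+n n)))
                    (trans (cong (iterate a n) eq) (retract j pj)))
          ; (suc t , eq) → j∉ (fromℕ< (<⇒≤ (s≤s (toℕ<n t))) ,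
              trans (cong (λ u → iterate a u i) (toℕ-fromℕ< (<⇒≤ (s≤s (toℕ<n t)))))
                    (trans (sym (retract _ (iterate-preserves pres (toℕ t) i p)))
                           (trans (cong (iterate a n) eq) (retract j pj)))) }
        recurse : ∀ fuel → # P? ≤ fuel → suc n ∣ # P∖Q?
        recurse zero b = ⊥-elim (case (≤-trans (#-pos P? i p) b))
          where case : ¬ (1 ≤ 0)
                case ()
        recurse (suc fuel) b = ∣#-free fuel P∖Q?
          (≤-pred (≤-trans (s≤s (m≤n+m (# P∖Q?) n)) (≤-trans (≤-reflexive (sym split)) b)))
          pres' (λ j q → period j (proj₁ q)) (λ j q → free j (proj₁ q))

    #-fixed : ∀ {p} → Prime p → ∀ {P : Fin m → Set} (P? : ∀ i → Dec (P i)) →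
              (∀ i → P i → P (a i)) → (∀ i → P i → iterate a p i ≡ i) →
              ∃ λ c → p ∣ c × # P? ≡ # (λ i → P? i ×-dec (a i ≟ i)) + c
    #-fixed {zero} () P? pres period
    #-fixed {suc p} pr {P} P? pres period =
      _ , ∣#-free p (# moved?) moved? ≤-refl moved-pres (λ i q → period i (proj₁ q)) free
        , #-split P? (λ i → a i ≟ i)
      where
      -- Since p is prime, a moved point has an orbit of exactly p points, so the moved points
      -- contribute the multiple c of p.
      moved? = λ i → P? i ×-dec ¬? (a i ≟ i)
      retract : ∀ j → P j → iterate a p (a j) ≡ j
      retract j pj = trans (trans (sym (iterate-+ a p 1 j)) (cong (λ u → iterate a u j) (+-comm p 1)))
                           (period j pj)
      moved-pres : ∀ i → P i × a i ≢ i → P (a i) × a (a i) ≢ a i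
      moved-pres i (q , ai≢i) = pres i q , λ eq →
        ai≢i (trans (sym (retract _ (pres i q))) (trans (cong (iterate a p) eq) (retract i q)))
      -- A power k prime to the period generates the whole cyclic action.
      free : ∀ i → P i × a i ≢ i → ∀ k → 1 ≤ k → k < suc p → iterate a k i ≢ i
      free i (q , ai≢i) k@(suc _) _ k<p eq with coprime-Bézout (prime⇒coprime pr k<p)
      ... | Bézout.+- u v e = ai≢i (trans (sym (trans (iterate-+ a 1 (v * k) i)
              (cong a (iterate-fixed a v k i eq))))
              (trans (cong (λ t → iterate a t i) e) (iterate-fixed a u (suc p) i (period i q))))
      ... | Bézout.-+ u v e = ai≢i (trans (sym (trans (iterate-+ a 1 (u * suc p) i)
              (cong a (iterate-fixed a u (suc p) i (period i q)))))
              (trans (cong (λ t → iterate a t i) e) (iterate-fixed a v k i eq)))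

-- Finite groups on `Fin m`: powers, cyclic subgroups, conjugation.

module FiniteGroups where
  open Solvers
  open FiniteCounting
  import Algebra.Properties.Group as GroupProperties
  import Algebra.Properties.Monoid.Mult as Multiples
  open import Data.Fin using (_≟_)
  open import Data.Fin.Properties using (toℕ-fromℕ<; any?; pigeonhole)
  open import Data.Nat using (_+_; _*_; _∸_)
  open import Data.Nat.DivMod using (_%_; m%n<n; m≡m%n+[m/n]*n; _/_)
  open import Data.Nat.Properties as ℕ using (n<1+n; m∸n+n≡m)
  open ≡ using (refl; sym; trans; cong; subst; module ≡-Reasoning)
  open import Relation.Nullary.Decidable using (map′)

  least : ∀ {P : ℕ → Set} → (∀ k → Dec (P k)) → ∀ n → P n → ∃ λ k → P k × (∀ j → j < k → ¬ P j)
  least P? zero p = 0 , p , λ j ()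
  least P? (suc n) p with P? 0
  ... | yes q = 0 , q , λ j ()
  ... | no ¬q with least (λ k → P? (suc k)) n p
  ... | k , r , min = suc k , r , λ { zero _ → ¬q ; (suc j) (s≤s j<k) → min j j<k }

  module FiniteGroup {m : ℕ} {_∙_ : Fin m → Fin m → Fin m} {ε : Fin m} {_⁻¹ : Fin m → Fin m}
                     (isGroup : IsGroup _≡_ _∙_ ε _⁻¹) where

    group : Group 0ℓ 0ℓ
    group = record { isGroup = isGroup }

    open Group group public using (assoc; identityˡ; identityʳ; inverseˡ; inverseʳ; monoid)
    open GroupProperties group public using (∙-cancelˡ; ∙-cancelʳ; inverseʳ-unique; inverseˡ-unique; ε⁻¹≈ε)
    open GroupSolver group public using (solve; _⊜_; _⊕_; ⊝_; one)
    open Multiples monoid using (×-homo-+; ×-assocˡ) renaming (_×_ to _⋆_)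

    infixr 9 _^_
    _^_ : Fin m → ℕ → Fin m
    g ^ n = n ⋆ g

    ^-+ : ∀ g a b → g ^ (a + b) ≡ (g ^ a) ∙ (g ^ b)
    ^-+ = ×-homo-+

    ^-* : ∀ g a b → (g ^ b) ^ a ≡ g ^ (a * b)
    ^-* = ×-assocˡ

    ε^ : ∀ n → ε ^ n ≡ ε
    ε^ zero    = refl
    ε^ (suc n) = trans (identityˡ _) (ε^ n)

    ^-1 : ∀ g → g ^ 1 ≡ g
    ^-1 = identityʳ

    ^-comm : ∀ g a b → (g ^ a) ∙ (g ^ b) ≡ (g ^ b) ∙ (g ^ a)
    ^-comm g a b = trans (sym (^-+ g a b)) (trans (cong (g ^_) (ℕ.+-comm a b)) (^-+ g b a))

    abstract
      torsion : ∀ g → ∃ λ k → g ^ suc k ≡ ε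
      torsion g with pigeonhole (n<1+n m) (λ i → g ^ toℕ i)
      ... | i , j , i<j , eq = toℕ j ∸ suc (toℕ i) , ∙-cancelʳ (g ^ toℕ i) _ _ (begin
        (g ^ suc (toℕ j ∸ suc (toℕ i))) ∙ (g ^ toℕ i)  ≡⟨ sym (^-+ g (suc (toℕ j ∸ suc (toℕ i))) (toℕ i)) ⟩
        g ^ (suc (toℕ j ∸ suc (toℕ i)) + toℕ i)       ≡⟨ cong (g ^_) (sym (ℕ.+-suc (toℕ j ∸ suc (toℕ i)) (toℕ i))) ⟩
        g ^ (toℕ j ∸ suc (toℕ i) + suc (toℕ i))       ≡⟨ cong (g ^_) (m∸n+n≡m i<j) ⟩
        g ^ toℕ j                                     ≡⟨ sym eq ⟩
        g ^ toℕ i                                     ≡⟨ sym (identityˡ _) ⟩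
        ε ∙ (g ^ toℕ i)                               ∎)
        where open ≡-Reasoning

    Order : Fin m → ℕ → Set
    Order g n = 1 ≤ n × g ^ n ≡ ε × (∀ k → 1 ≤ k → k < n → g ^ k ≢ ε)

    abstract
      order : ∀ g → ∃ (Order g)
      order g with torsion g
      ... | k , eq with least (λ k → g ^ suc k ≟ ε) k eq
      ... | n , gⁿ , min = suc n , s≤s z≤n , gⁿ , λ { (suc j) _ (s≤s j<n) → min j j<n }

    -- Every element has finite order, so natural exponents also reach the inverses, and finitely
    -- many of them decide membership.
    ⟨_⟩ : Fin m → Fin m → Set
    ⟨ g ⟩ h = ∃ λ k → g ^ k ≡ h

    ^-mod : ∀ g n k → g ^ suc n ≡ ε → g ^ k ≡ g ^ (k % suc n)
    ^-mod g n k eq = begin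
      g ^ k                                          ≡⟨ cong (g ^_) (m≡m%n+[m/n]*n k (suc n)) ⟩
      g ^ (k % suc n + k / suc n * suc n)            ≡⟨ ^-+ g (k % suc n) _ ⟩
      (g ^ (k % suc n)) ∙ (g ^ (k / suc n * suc n))  ≡⟨ cong ((g ^ (k % suc n)) ∙_) (sym (^-* g (k / suc n) (suc n))) ⟩
      (g ^ (k % suc n)) ∙ ((g ^ suc n) ^ (k / suc n)) ≡⟨ cong (λ t → (g ^ (k % suc n)) ∙ (t ^ (k / suc n))) eq ⟩
      (g ^ (k % suc n)) ∙ (ε ^ (k / suc n))          ≡⟨ cong ((g ^ (k % suc n)) ∙_) (ε^ (k / suc n)) ⟩
      (g ^ (k % suc n)) ∙ ε                          ≡⟨ identityʳ _ ⟩
      g ^ (k % suc n)                                ∎ where open ≡-Reasoning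

    abstract
      ⟨_⟩? : ∀ g h → Dec (⟨ g ⟩ h)
      ⟨ g ⟩? h with torsion g
      ... | n , eq = map′ (λ { (i , e) → toℕ i , e })
        (λ { (k , e) → fromℕ< (m%n<n k (suc n)) ,
             trans (cong (g ^_) (toℕ-fromℕ< (m%n<n k (suc n)))) (trans (sym (^-mod g n k eq)) e) })
        (any? {n = suc n} λ i → g ^ toℕ i ≟ h)

    -- In a finite group these are the subgroups: the inverse is a power, whence `⁻¹∈`.
    record Submonoid (K : Fin m → Set) : Set where
      constructor submonoid
      field
        ε∈  : K ε
        ∙∈  : ∀ {g h} → K g → K h → K (g ∙ h)
      ^∈ : ∀ n {g} → K g → K (g ^ n)
      ^∈ zero    k = ε∈
      ^∈ (suc n) k = ∙∈ k (^∈ n k)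
      ⁻¹∈ : ∀ {g} → K g → K (g ⁻¹)
      ⁻¹∈ {g} k with torsion g
      ... | n , eq = subst K (inverseʳ-unique g (g ^ n) eq) (^∈ n k)
    open Submonoid public

    cyclic : ∀ g → Submonoid ⟨ g ⟩
    cyclic g = submonoid (0 , refl) λ { (a , refl) (b , refl) → a + b , ^-+ g a b }

    generator∈ : ∀ g → ⟨ g ⟩ g
    generator∈ g = 1 , ^-1 g

    ⟨⟩-minimal : ∀ {K g} → Submonoid K → K g → ∀ {h} → ⟨ g ⟩ h → K h
    ⟨⟩-minimal S k (n , refl) = ^∈ S n k

    ⟨⟩-comm : ∀ {x g h} → ⟨ x ⟩ g → ⟨ x ⟩ h → g ∙ h ≡ h ∙ g
    ⟨⟩-comm {x} (a , refl) (b , refl) = ^-comm x a b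

    conj : Fin m → Fin m → Fin m
    conj g h = (g ∙ h) ∙ (g ⁻¹)

    conj-∙ : ∀ g a b → conj g (a ∙ b) ≡ conj g a ∙ conj g b
    conj-∙ = solve 3 (λ g a b → (g ⊕ (a ⊕ b)) ⊕ ⊝ g ⊜ ((g ⊕ a) ⊕ ⊝ g) ⊕ ((g ⊕ b) ⊕ ⊝ g)) refl

    conj-conj : ∀ g h a → conj g (conj h a) ≡ conj (g ∙ h) a
    conj-conj = solve 3 (λ g h a → (g ⊕ ((h ⊕ a) ⊕ ⊝ h)) ⊕ ⊝ g ⊜ ((g ⊕ h) ⊕ a) ⊕ ⊝ (g ⊕ h)) refl

    conj-ε : ∀ g → conj g ε ≡ ε
    conj-ε = solve 1 (λ g → (g ⊕ one) ⊕ ⊝ g ⊜ one) refl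

    ε-conj : ∀ a → conj ε a ≡ a
    ε-conj = solve 1 (λ a → (one ⊕ a) ⊕ ⊝ one ⊜ a) refl

    conj-^ : ∀ g a n → conj g (a ^ n) ≡ conj g a ^ n
    conj-^ g a zero    = conj-ε g
    conj-^ g a (suc n) = trans (conj-∙ g a (a ^ n)) (cong (conj g a ∙_) (conj-^ g a n))

    conj-inverseˡ : ∀ g a → conj (g ⁻¹) (conj g a) ≡ a
    conj-inverseˡ = solve 2 (λ g a → (⊝ g ⊕ ((g ⊕ a) ⊕ ⊝ g)) ⊕ ⊝ ⊝ g ⊜ a) refl

    conj-fixed⇒comm : ∀ g a → conj g a ≡ a → g ∙ a ≡ a ∙ g
    conj-fixed⇒comm g a eq = trans (solve 2 (λ g a → g ⊕ a ⊜ ((g ⊕ a) ⊕ ⊝ g) ⊕ g) refl g a) (cong (_∙ g) eq)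

    comm⇒conj-fixed : ∀ g a → g ∙ a ≡ a ∙ g → conj g a ≡ a
    comm⇒conj-fixed g a eq = trans (cong (_∙ (g ⁻¹)) eq) (solve 2 (λ g a → (a ⊕ g) ⊕ ⊝ g ⊜ a) refl g a)

    conj-injective : ∀ g {a b} → conj g a ≡ conj g b → a ≡ b
    conj-injective g {a} {b} eq =
      trans (sym (conj-inverseˡ g a)) (trans (cong (conj (g ⁻¹)) eq) (conj-inverseˡ g b))

    centralizer : ∀ a → Submonoid (λ g → conj g a ≡ a)
    centralizer a = submonoid (ε-conj a) λ {g} {h} p q →
      trans (sym (conj-conj g h a)) (trans (cong (conj g) q) p)

    normalizer : ∀ (K : Fin m → Set) → Submonoid (λ g → ∀ h → K h → K (conj g h))
    normalizer K = submonoid (λ h → subst K (sym (ε-conj h)))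
      λ {g} {h} p q a k → subst K (conj-conj g h a) (p _ (q a k))

    -- The group-theoretic form of primitivity and faithfulness: blocks through the base point
    -- correspond to subgroups above ⟨x⟩, and the kernel of the action is the core of ⟨x⟩. K ranges
    -- over arbitrary predicates, decidable or not.
    record CoreFreeMaximal (x : Fin m) : Set₁ where
      field
        maximal   : ∀ {K : Fin m → Set} → Submonoid K → K x → ∀ {k} → K k → ¬ ⟨ x ⟩ k → ∀ g → K g
        core-free : ∀ g → (∀ h → ⟨ x ⟩ (conj h g)) → g ≡ ε

-- The point stabiliser H, its malnormality, and the transfer onto it.

module FrobeniusComplements where
  open Solvers
  open FiniteCounting
  open FiniteGroups
  import Algebra.Properties.CommutativeMonoid.Sum as Sums
  open import Data.Fin using (_≟_)
  open import Data.Fin.Permutation using (Permutation′; permutation)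
  import Data.Fin.Properties as Finₚ
  open ≡ using (refl; sym; trans; cong; cong₂; subst; module ≡-Reasoning)

  open Finₚ using (any?)

  first : ∀ {m} {P : Fin m → Set} → (∀ i → Dec (P i)) → ∃ P →
          ∃ λ i → P i × (∀ j → j Fin.< i → ¬ P j)
  first {suc m} P? (i , p) with P? zero
  ... | yes q = zero , q , λ j ()
  first {suc m} P? (zero , p)  | no ¬q = ⊥-elim (¬q p)
  first {suc m} P? (suc i , p) | no ¬q with first (λ j → P? (suc j)) (i , p)
  ... | k , r , min = suc k , r , λ { zero _ → ¬q ; (suc j) (ℕ.s≤s j<k) → min j j<k }

  module Representatives {m : ℕ} {_~_ : Fin m → Fin m → Set} (_~?_ : ∀ i j → Dec (i ~ j))
    (~-refl : ∀ i → i ~ i) (~-sym : ∀ {i j} → i ~ j → j ~ i)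
    (~-trans : ∀ {i j k} → i ~ j → j ~ k → i ~ k) where

    abstract
      -- Taking the least index of a class makes related elements have equal representatives, which
      -- replaces the quotient set.
      rep : Fin m → Fin m
      rep i = proj₁ (first (i ~?_) (i , ~-refl i))

      ~-rep : ∀ i → i ~ rep i
      ~-rep i = proj₁ (proj₂ (first (i ~?_) (i , ~-refl i)))

      rep-cong : ∀ {i j} → i ~ j → rep i ≡ rep j
      rep-cong {i} {j} i~j with first (i ~?_) (i , ~-refl i) | first (j ~?_) (j , ~-refl j)
      ... | a , i~a , a-min | b , j~b , b-min with Finₚ.<-cmp a b
      ... | tri< a<b _ _ = ⊥-elim (b-min a a<b (~-trans (~-sym i~j) i~a))
      ... | tri≈ _ a≡b _ = a≡b
      ... | tri> _ _ b<a = ⊥-elim (a-min b b<a (~-trans i~j j~b))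

  module PrimitiveGroup {m : ℕ} {_∙_ : Fin m → Fin m → Fin m} {ε : Fin m} {_⁻¹ : Fin m → Fin m}
    (isGroup : IsGroup _≡_ _∙_ ε _⁻¹)
    {x : Fin m} (x-maximal : FiniteGroup.CoreFreeMaximal isGroup x) where

    open FiniteGroup isGroup
    open CoreFreeMaximal x-maximal

    H : Fin m → Set
    H = ⟨ x ⟩

    HS : Submonoid H
    HS = cyclic x

    malnormal : x ≢ ε → ∀ {g u} → ¬ H g → H u → H (conj g u) → u ≡ ε
    malnormal x≢ε {g} {u} g∉H u∈H w∈H with ⟨ x ⟩? (conj g x)
    ... | no gx∉H = conj-injective g (trans w≡ε (sym (conj-ε g)))
      where
      commute : ∀ {a b} → H a → H b → conj a b ≡ b
      commute a∈ b∈ = comm⇒conj-fixed _ _ (⟨⟩-comm a∈ b∈)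
      w = conj g u
      central : ∀ k → conj k w ≡ w
      central = maximal (centralizer w) (commute (generator∈ x) w∈H)
        (trans (solve 3 (λ g x u → (((g ⊕ x) ⊕ ⊝ g) ⊕ ((g ⊕ u) ⊕ ⊝ g)) ⊕ ⊝ ((g ⊕ x) ⊕ ⊝ g)
                                 ⊜ (g ⊕ ((x ⊕ u) ⊕ ⊝ x)) ⊕ ⊝ g) refl g x u)
               (cong (conj g) (commute (generator∈ x) u∈H))) gx∉H
      w≡ε : w ≡ ε
      w≡ε = core-free w λ h → subst H (sym (central h)) w∈H
    -- Now g normalises H, so by maximality all of G does; x then lies in the core of H, which is
    -- trivial.
    ... | yes gx∈H = ⊥-elim (x≢ε (core-free x λ h → normal h x (generator∈ x)))
      where
      normalizes : ∀ {k} → H (conj k x) → ∀ h → H h → H (conj k h)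
      normalizes {k} kx∈ _ (n , refl) = subst H (sym (conj-^ k x n)) (^∈ HS n kx∈)
      normal : ∀ k h → H h → H (conj k h)
      normal = maximal (normalizer H)
        (normalizes (subst H (sym (comm⇒conj-fixed x x refl)) (generator∈ x)))
        (normalizes gx∈H) g∉H

    -- A homomorphism from G onto H that is the identity on H. This form is shared by the transfer
    -- and by the constant map for H = 1.
    record Retraction : Set where
      field
        V     : Fin m → Fin m
        V-∙   : ∀ g h → V (g ∙ h) ≡ V g ∙ V h
        V∈H   : ∀ g → H (V g)
        V-id  : ∀ {h} → H h → V h ≡ h

      N : Fin m → Set
      N g = V g ≡ ε

      -- The Frobenius condition: H acts freely by conjugation on the nontrivial elements of N.
      Semiregular : Set
      Semiregular = ∀ {h v} → H h → N v → v ≢ ε → conj h v ≡ v → h ≡ ε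

      N? : ∀ g → Dec (N g)
      N? g = V g ≟ ε

      V-ε : V ε ≡ ε
      V-ε = V-id (ε∈ HS)

      V-⁻¹ : ∀ g → V (g ⁻¹) ≡ V g ⁻¹
      V-⁻¹ g = inverseˡ-unique _ _ (trans (sym (V-∙ _ g)) (trans (cong V (inverseˡ g)) V-ε))

      N-submonoid : Submonoid N
      N-submonoid = submonoid V-ε λ p q → trans (V-∙ _ _) (trans (cong₂ _∙_ p q) (identityˡ ε))

      V-conj : ∀ g h → V (conj g h) ≡ conj (V g) (V h)
      V-conj g h = trans (V-∙ _ _) (cong₂ _∙_ (V-∙ g h) (V-⁻¹ g))

      N-normal : ∀ g h → N h → N (conj g h)
      N-normal g h p = trans (V-conj g h) (trans (cong (conj (V g)) p) (conj-ε (V g)))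

      N∩H : ∀ {g} → N g → H g → g ≡ ε
      N∩H p q = trans (sym (V-id q)) p

      -- The N-component of g in G = NH, the H-component being `V g`.
      part : Fin m → Fin m
      part g = g ∙ (V g ⁻¹)

      part∈N : ∀ g → N (part g)
      part∈N g = trans (V-∙ g _) (trans (cong (V g ∙_) (V-id (⁻¹∈ HS (V∈H g)))) (inverseʳ _))

      -- The multiplication law of the semidirect product; it later becomes the composition of
      -- affine maps.
      part-∙ : ∀ g h → part (g ∙ h) ≡ part g ∙ conj (V g) (part h)
      part-∙ g h = trans (cong (λ t → (g ∙ h) ∙ (t ⁻¹)) (V-∙ g h))
        (solve 4 (λ g h a b → (g ⊕ h) ⊕ ⊝ (a ⊕ b) ⊜ (g ⊕ ⊝ a) ⊕ ((a ⊕ (h ⊕ ⊝ b)) ⊕ ⊝ a)) refl g h (V g) (V h))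

      part-id : ∀ {g} → N g → part g ≡ g
      part-id {g} p = trans (cong (λ t → g ∙ (t ⁻¹)) p) (trans (cong (g ∙_) ε⁻¹≈ε) (identityʳ g))

      -- K is enlarged to the subgroup KH, which contains H properly.
      irreducible : ∀ {K} → Submonoid K → (∀ {k} → K k → K (conj x k)) →
                    ∀ {k} → K k → N k → k ≢ ε → ∀ g → N g → K g
      irreducible {K} S x-closed {k} k∈K k∈N k≢ε g g∈N =
        subst K (part-id g∈N) (maximal KH x∈KH (subst K (sym (part-id k∈N)) k∈K)
                                       (λ k∈H → k≢ε (N∩H k∈N k∈H)) g)
        where
        H-closed : ∀ {h} → H h → ∀ k → K k → K (conj h k)
        H-closed = ⟨⟩-minimal (normalizer K) λ _ → x-closed
        KH : Submonoid (λ g → K (part g))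
        KH = submonoid (subst K (sym (part-id V-ε)) (ε∈ S)) λ {g} {h} p q →
          subst K (sym (part-∙ g h)) (∙∈ S p (H-closed (V∈H g) _ q))
        x∈KH : K (part x)
        x∈KH = subst K (sym (trans (cong (λ t → x ∙ (t ⁻¹)) (V-id (generator∈ x))) (inverseʳ x))) (ε∈ S)

    module Transfer (x≢ε : x ≢ ε) where
      _~_ : Fin m → Fin m → Set
      g ~ g' = ∃ λ u → ∃ λ w → H u × H w × (u ∙ g) ∙ w ≡ g'

      _~?_ : ∀ g g' → Dec (g ~ g')
      g ~? g' = any? λ u → any? λ w → ⟨ x ⟩? u ×-dec ⟨ x ⟩? w ×-dec ((u ∙ g) ∙ w ≟ g')

      ~-refl : ∀ g → g ~ g
      ~-refl g = ε , ε , ε∈ HS , ε∈ HS , trans (identityʳ _) (identityˡ g)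

      ~-sym : ∀ {g g'} → g ~ g' → g' ~ g
      ~-sym {g} (u , w , u∈ , w∈ , refl) = u ⁻¹ , w ⁻¹ , ⁻¹∈ HS u∈ , ⁻¹∈ HS w∈ ,
        solve 3 (λ u g w → (⊝ u ⊕ ((u ⊕ g) ⊕ w)) ⊕ ⊝ w ⊜ g) refl u g w

      ~-trans : ∀ {g g' g''} → g ~ g' → g' ~ g'' → g ~ g''
      ~-trans {g} (u , w , u∈ , w∈ , refl) (u' , w' , u'∈ , w'∈ , refl) =
        u' ∙ u , w ∙ w' , ∙∈ HS u'∈ u∈ , ∙∈ HS w∈ w'∈ ,
        solve 5 (λ u g w u' w' → ((u' ⊕ u) ⊕ g) ⊕ (w ⊕ w') ⊜ (u' ⊕ ((u ⊕ g) ⊕ w)) ⊕ w') refl u g w u' w'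

      open Representatives _~?_ ~-refl ~-sym ~-trans

      -- An H-valued function with f (g h) = f g h, adapted to double cosets: f⁻¹(ε) is a
      -- left transversal of H on which left multiplication by x only moves cosets,
      -- except for H itself.
      f : Fin m → Fin m
      f g with ⟨ x ⟩? g
      ... | yes _ = g
      ... | no _  = proj₁ (proj₂ (~-sym (~-rep g)))

      f∈H : ∀ g → H (f g)
      f∈H g with ⟨ x ⟩? g
      ... | yes g∈H = g∈H
      ... | no _  = proj₁ (proj₂ (proj₂ (proj₂ (~-sym (~-rep g)))))

      f-H : ∀ {g} → H g → f g ≡ g
      f-H {g} g∈H with ⟨ x ⟩? g
      ... | yes _   = refl
      ... | no g∉H = ⊥-elim (g∉H g∈H)

      decompose : ∀ {g} → ¬ H g → ∃ λ u → H u × (u ∙ rep g) ∙ f g ≡ g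
      decompose {g} g∉H with ⟨ x ⟩? g
      ... | yes g∈H = ⊥-elim (g∉H g∈H)
      ... | no _ with ~-sym (~-rep g)
      ... | u , w , u∈ , w∈ , eq = u , u∈ , eq

      -- Two factorisations of g through its representative c, with right factors w and `f g`, show
      -- that c conjugates w (f g)⁻¹ into H. As c is outside H, malnormality makes this element
      -- trivial.
      f-unique : ∀ {g u w} → ¬ H g → H u → H w → (u ∙ rep g) ∙ w ≡ g → f g ≡ w
      f-unique {g} {u} {w} g∉H u∈ w∈ eq with decompose g∉H
      ... | u' , u'∈ , eq' = sym (trans (solve 2 (λ a w → w ⊜ (w ⊕ ⊝ a) ⊕ a) refl (f g) w)
          (trans (cong (_∙ f g) wf⁻¹≡ε) (identityˡ _)))
        where
        c = rep g
        c∉H : ¬ H c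
        c∉H c∈H = g∉H (subst H eq (∙∈ HS (∙∈ HS u∈ c∈H) w∈))
        wf⁻¹≡ε : w ∙ (f g ⁻¹) ≡ ε
        wf⁻¹≡ε = malnormal x≢ε c∉H (∙∈ HS w∈ (⁻¹∈ HS (f∈H g)))
          (subst H (trans (solve 4 (λ u u' c a → ⊝ u ⊕ u' ⊜ (⊝ u ⊕ ((u' ⊕ c) ⊕ a)) ⊕ (⊝ a ⊕ ⊝ c)) refl u u' c (f g))
                   (trans (cong (λ t → ((u ⁻¹) ∙ t) ∙ ((f g ⁻¹) ∙ (c ⁻¹))) (trans eq' (sym eq)))
                   (solve 4 (λ u c w a → (⊝ u ⊕ ((u ⊕ c) ⊕ w)) ⊕ (⊝ a ⊕ ⊝ c) ⊜ (c ⊕ (w ⊕ ⊝ a)) ⊕ ⊝ c) refl u c w (f g))))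
                 (∙∈ HS (⁻¹∈ HS u∈) u'∈))

      f-right : ∀ g {h} → H h → f (g ∙ h) ≡ f g ∙ h
      f-right g {h} h∈ with ⟨ x ⟩? g
      ... | yes g∈ = f-H (∙∈ HS g∈ h∈)
      ... | no g∉ with ~-sym (~-rep g)
      ... | u , w , u∈ , w∈ , eq = f-unique
        (λ gh∈ → g∉ (subst H (solve 2 (λ g h → (g ⊕ h) ⊕ ⊝ h ⊜ g) refl g h) (∙∈ HS gh∈ (⁻¹∈ HS h∈))))
        u∈ (∙∈ HS w∈ h∈)
        (trans (cong (λ c → (u ∙ c) ∙ (w ∙ h)) (sym (rep-cong (ε , h , ε∈ HS , h∈ , cong (_∙ h) (identityˡ g)))))
               (trans (sym (assoc _ w h)) (cong (_∙ h) eq)))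

      -- The factor x is absorbed by the left factor u of g = u c w, and the right factor is
      -- determined by `f-unique`.
      f-left : ∀ {g} → ¬ H g → f (x ∙ g) ≡ f g
      f-left {g} g∉ with decompose g∉
      ... | u , u∈ , eq = f-unique
        (λ xg∈ → g∉ (subst H (solve 2 (λ x g → ⊝ x ⊕ (x ⊕ g) ⊜ g) refl x g) (∙∈ HS (⁻¹∈ HS x∈) xg∈)))
        (∙∈ HS x∈ u∈) (f∈H g)
        (trans (cong (λ c → ((x ∙ u) ∙ c) ∙ f g) (sym (rep-cong (x , ε , x∈ , ε∈ HS , identityʳ _))))
               (trans (solve 4 (λ x u c a → ((x ⊕ u) ⊕ c) ⊕ a ⊜ x ⊕ ((u ⊕ c) ⊕ a)) refl x u (rep g) (f g)) (cong (x ∙_) eq)))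
        where x∈ = generator∈ x

      -- The transfer is a product over a transversal that will be reindexed, so its factors must
      -- commute; H is cyclic, hence abelian.
      H-monoid : CommutativeMonoid 0ℓ 0ℓ
      H-monoid = record
        { Carrier = Σ (Fin m) H
        ; _≈_ = λ a b → proj₁ a ≡ proj₁ b
        ; _∙_ = λ a b → proj₁ a ∙ proj₁ b , ∙∈ HS (proj₂ a) (proj₂ b)
        ; ε = ε , ε∈ HS
        ; isCommutativeMonoid = record
          { isMonoid = record
            { isSemigroup = record
              { isMagma = record
                { isEquivalence = record { refl = refl ; sym = sym ; trans = trans }
                ; ∙-cong = cong₂ _∙_ }
              ; assoc = λ a b c → assoc _ _ _ }
            ; identity = (λ a → identityˡ _) , (λ a → identityʳ _) }
          ; comm = λ a b → ⟨⟩-comm (proj₂ a) (proj₂ b) } }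

      open CommutativeMonoid H-monoid using () renaming (Carrier to HC)
      open Sums H-monoid using (sum; sum-permute; sum-cong-≋; ∑-distrib-+)

      sum-trivial : ∀ {k} (s : Fin k → HC) → (∀ i → proj₁ (s i) ≡ ε) → proj₁ (sum s) ≡ ε
      sum-trivial {zero}  s eq = refl
      sum-trivial {suc k} s eq =
        trans (cong₂ _∙_ (eq zero) (sum-trivial (λ i → s (suc i)) λ i → eq (suc i))) (identityˡ ε)

      sum-single : ∀ {k} (s : Fin k → HC) c → (∀ i → i ≢ c → proj₁ (s i) ≡ ε) →
                   proj₁ (sum s) ≡ proj₁ (s c)
      sum-single s zero eq = trans (cong (proj₁ (s zero) ∙_)
        (sum-trivial (λ i → s (suc i)) λ i → eq (suc i) λ ())) (identityʳ _)
      sum-single s (suc c) eq = trans (cong₂ _∙_ (eq zero λ ())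
        (sum-single (λ i → s (suc i)) c λ i i≢c → eq (suc i) λ { refl → i≢c refl })) (identityˡ _)

      -- The transversal is the set where f takes the value ε. The sum runs over all of G, with a
      -- trivial factor elsewhere, so the transversal itself is never listed.
      term : Fin m → Fin m → HC
      term g t with f t ≟ ε
      ... | yes _ = f (g ∙ t) , f∈H (g ∙ t)
      ... | no _  = ε , ε∈ HS

      term-yes : ∀ g {t} → f t ≡ ε → proj₁ (term g t) ≡ f (g ∙ t)
      term-yes g {t} eq with f t ≟ ε
      ... | yes _ = refl
      ... | no ≢  = ⊥-elim (≢ eq)

      term-no : ∀ g {t} → f t ≢ ε → proj₁ (term g t) ≡ ε
      term-no g {t} ≢ with f t ≟ ε
      ... | yes eq = ⊥-elim (≢ eq)
      ... | no _   = refl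

      V : Fin m → Fin m
      V g = proj₁ (sum (term g))

      shift : Fin m → Fin m → Fin m
      shift g t = (f (g ∙ t) ⁻¹) ∙ f t

      shift∈H : ∀ g t → H (shift g t)
      shift∈H g t = ∙∈ HS (⁻¹∈ HS (f∈H _)) (f∈H t)

      -- The point of the coset of gt at which f has the same value as at t. On the transversal this
      -- is the usual permutation of coset representatives; defined on all of G, it can reindex the
      -- sum.
      π : Fin m → Fin m → Fin m
      π g t = (g ∙ t) ∙ shift g t

      f-π : ∀ g t → f (π g t) ≡ f t
      f-π g t = trans (f-right (g ∙ t) (shift∈H g t))
        (solve 2 (λ a b → a ⊕ (⊝ a ⊕ b) ⊜ b) refl (f (g ∙ t)) (f t))

      π-inverse : ∀ a b t → b ∙ a ≡ ε → π b (π a t) ≡ t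
      π-inverse a b t ba≡ε = begin
        (b ∙ π a t) ∙ ((f (b ∙ π a t) ⁻¹) ∙ f (π a t))
          ≡⟨ cong₂ (λ s r → s ∙ ((f s ⁻¹) ∙ r)) b∙π (f-π a t) ⟩
        (t ∙ h) ∙ ((f (t ∙ h) ⁻¹) ∙ f t)
          ≡⟨ cong (λ s → (t ∙ h) ∙ ((s ⁻¹) ∙ f t)) (f-right t (shift∈H a t)) ⟩
        (t ∙ h) ∙ (((f t ∙ h) ⁻¹) ∙ f t)
          ≡⟨ solve 3 (λ t h a → (t ⊕ h) ⊕ (⊝ (a ⊕ h) ⊕ a) ⊜ t) refl t h (f t) ⟩
        t ∎
        where
        open ≡-Reasoning
        h = shift a t
        b∙π : b ∙ π a t ≡ t ∙ h
        b∙π = trans (solve 4 (λ b a t h → b ⊕ ((a ⊕ t) ⊕ h) ⊜ (b ⊕ a) ⊕ (t ⊕ h)) refl b a t h)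
                    (trans (cong (_∙ (t ∙ h)) ba≡ε) (identityˡ _))

      π-permutation : Fin m → Permutation′ m
      π-permutation g = permutation (π g) (π (g ⁻¹))
        (λ t → π-inverse (g ⁻¹) g t (inverseʳ g)) (λ t → π-inverse g (g ⁻¹) t (inverseˡ g))

      -- The cocycle identity of the transfer. For t in the transversal, g't is `π g' t` times
      -- `f (g' ∙ t)`, and `f-right` splits this last factor off the value of f at gg't.
      term-∙ : ∀ g g' t → proj₁ (term (g ∙ g') t) ≡ proj₁ (term g (π g' t)) ∙ proj₁ (term g' t)
      term-∙ g g' t = by-cases (f t ≟ ε)
        where
        by-cases : Dec (f t ≡ ε) → _
        by-cases (no ≢) = trans (term-no (g ∙ g') ≢) (sym (trans
          (cong₂ _∙_ (term-no g λ eq → ≢ (trans (sym (f-π g' t)) eq)) (term-no g' ≢)) (identityˡ ε)))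
        by-cases (yes eq) = trans (term-yes (g ∙ g') eq) (sym (trans
          (cong₂ _∙_ (term-yes g (trans (f-π g' t) eq)) (term-yes g' eq))
          (trans (cong (_∙ f (g' ∙ t)) (trans (cong f (trans (sym (assoc g _ _)) (cong (_∙ shift g' t) (sym (assoc g g' t)))))
                                              (f-right ((g ∙ g') ∙ t) (shift∈H g' t))))
          (trans (cong (λ s → (f ((g ∙ g') ∙ t) ∙ ((f (g' ∙ t) ⁻¹) ∙ s)) ∙ f (g' ∙ t)) eq)
          (solve 2 (λ a b → (a ⊕ (⊝ b ⊕ one)) ⊕ b ⊜ a) refl (f ((g ∙ g') ∙ t)) (f (g' ∙ t)))))))

      V-∙ : ∀ g g' → V (g ∙ g') ≡ V g ∙ V g'
      V-∙ g g' = begin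
        V (g ∙ g')
          ≡⟨ sum-cong-≋ {m} (term-∙ g g') ⟩
        _
          ≡⟨ ∑-distrib-+ (λ t → term g (π g' t)) (term g') ⟩
        proj₁ (sum (λ t → term g (π g' t))) ∙ V g'
          ≡⟨ cong (_∙ V g') (sym (sum-permute (term g) (π-permutation g'))) ⟩
        V g ∙ V g' ∎
        where open ≡-Reasoning

      -- Off H the transversal is stable under left multiplication by x, so its points there
      -- contribute ε. Its only point in H is ε, which contributes x.
      V-x : V x ≡ x
      V-x = begin
        V x                ≡⟨ sum-single (term x) ε other ⟩
        proj₁ (term x ε)   ≡⟨ term-yes x (f-H (ε∈ HS)) ⟩
        f (x ∙ ε)          ≡⟨ cong f (identityʳ x) ⟩
        f x                ≡⟨ f-H (generator∈ x) ⟩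
        x                  ∎
        where
        open ≡-Reasoning
        other : ∀ t → t ≢ ε → proj₁ (term x t) ≡ ε
        other t t≢ε = by-cases (f t ≟ ε) (⟨ x ⟩? t)
          where
          by-cases : Dec (f t ≡ ε) → Dec (H t) → proj₁ (term x t) ≡ ε
          by-cases (no ≢)   _         = term-no x ≢
          by-cases (yes eq) (yes t∈H) = ⊥-elim (t≢ε (trans (sym (f-H t∈H)) eq))
          by-cases (yes eq) (no t∉H)  = trans (term-yes x eq) (trans (f-left t∉H) eq)

      retraction : Retraction
      retraction = record
        { V = V ; V-∙ = V-∙ ; V∈H = λ g → proj₂ (sum (term g))
        ; V-id = λ { (n , refl) → V-^ n } }
        where
        V-ε : V ε ≡ ε
        V-ε = ∙-cancelˡ (V ε) _ _ (trans (sym (V-∙ ε ε)) (trans (cong V (identityˡ ε)) (sym (identityʳ _))))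
        V-^ : ∀ n → V (x ^ n) ≡ x ^ n
        V-^ zero    = V-ε
        V-^ (suc n) = trans (V-∙ x (x ^ n)) (cong₂ _∙_ V-x (V-^ n))

-- The kernel N is an abelian p-group.

module FrobeniusKernels where
  open Solvers
  open FiniteCounting
  open FiniteGroups
  open FrobeniusComplements
  open import Data.Fin using (_≟_)
  open import Data.Fin.Properties using (any?; all?)
  open import Data.Nat using (_+_)
  open import Data.Nat.Divisibility using (_∣0; ∣m∣n⇒∣m+n; ∣m+n∣m⇒∣n; ∣1⇒≡1)
  open import Data.Nat.Primality using (¬prime[1])
  open import Data.Nat.Properties as ℕ using (≤-trans; ≤-reflexive)
  open ≡ using (refl; sym; trans; cong; cong₂; subst; module ≡-Reasoning)

  module Towers {m : ℕ} {_∙_ : Fin m → Fin m → Fin m} {ε : Fin m} {_⁻¹ : Fin m → Fin m}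
    (isGroup : IsGroup _≡_ _∙_ ε _⁻¹) {p : ℕ} (p-prime : Prime p) where
    open FiniteGroup isGroup
    open Counting
    open Iteration

    -- A p-group, presented by a subnormal series with factors of order p.
    data Tower : (Fin m → Set) → Set₁ where
      trivial : ∀ {P} → (∀ {g} → P g → g ≡ ε) → Tower P
      extend  : ∀ {Q P} a → Tower Q → (∀ g → Dec (Q g)) → (∀ h → Q h → Q (conj a h)) → Q (a ^ p) →
                P a → (∀ {g} → Q g → P g) → (∀ {g} → P g → ∃ λ k → Q ((a ^ k) ∙ g)) → Tower P

    record Action (L : Fin m → Set) {k : ℕ} (A : Fin k → Set) : Set where
      field
        L-submonoid : Submonoid L
        A?    : ∀ i → Dec (A i)
        act   : Fin m → Fin k → Fin k
        act∈  : ∀ {g i} → L g → A i → A (act g i)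
        act-∙ : ∀ {g h i} → L g → L h → A i → act (g ∙ h) i ≡ act g (act h i)
        act-ε : ∀ {i} → A i → act ε i ≡ i

      Fixed : (Fin m → Set) → Fin k → Set
      Fixed P i = A i × ∀ g → P g → act g i ≡ i

      Fixed? : ∀ {P} → (∀ g → Dec (P g)) → ∀ i → Dec (Fixed P i)
      Fixed? P? i = A? i ×-dec all? λ g → P? g →-dec (act g i ≟ i)

      act-^ : ∀ {g i} n → L g → A i → iterate (act g) n i ≡ act (g ^ n) i
      act-^ zero    l a = sym (act-ε a)
      act-^ (suc n) l a = trans (cong (act _) (act-^ n l a)) (sym (act-∙ l (^∈ L-submonoid n l) a))

      act-fixed-⁻¹ : ∀ {g i} → L g → A i → act g i ≡ i → act (g ⁻¹) i ≡ i
      act-fixed-⁻¹ {g} {i} l a eq = trans (cong (act (g ⁻¹)) (sym eq))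
        (trans (sym (act-∙ (⁻¹∈ L-submonoid l) l a)) (trans (cong (λ t → act t i) (inverseˡ g)) (act-ε a)))

      #-Fixed : ∀ {P} → Tower P → (P? : ∀ g → Dec (P g)) → (∀ {g} → P g → L g) →
                (p ∣ # A? → p ∣ # (Fixed? P?)) × (p ∣ # (Fixed? P?) → p ∣ # A?)
      #-Fixed (trivial P-trivial) P? P⊂L = subst (p ∣_) same , subst (p ∣_) (sym same)
        where
        same : # A? ≡ # (Fixed? P?)
        same = #-cong A? (Fixed? P?)
          (λ i a → a , λ g g∈ → trans (cong (λ t → act t i) (P-trivial g∈)) (act-ε a)) (λ i → proj₁)
      #-Fixed {P} (extend {Q} a Q-tower Q? a-normalizes aᵖ∈Q a∈P Q⊂P split) P? P⊂L
        with #-Fixed Q-tower Q? (λ q → P⊂L (Q⊂P q))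
           | CyclicActions.#-fixed (act a) p-prime (Fixed? Q?) preserves period
        where
        -- As a normalises Q and its p-th power lies in Q, it permutes the points fixed by Q with
        -- period p. Its own fixed points among them are those fixed by P, so each tower step
        -- preserves the count modulo p.
        preserves : ∀ i → Fixed Q i → Fixed Q (act a i)
        preserves i (i∈A , fixed) = act∈ a∈L i∈A , λ q q∈ → begin
          act q (act a i)                   ≡⟨ sym (act-∙ (P⊂L (Q⊂P q∈)) a∈L i∈A) ⟩
          act (q ∙ a) i                     ≡⟨ cong (λ t → act t i) (solve 2 (λ q a → q ⊕ a ⊜ a ⊕ ((⊝ a ⊕ q) ⊕ ⊝ ⊝ a)) refl q a) ⟩
          act (a ∙ conj (a ⁻¹) q) i         ≡⟨ act-∙ a∈L (P⊂L (Q⊂P (q'∈ q q∈))) i∈A ⟩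
          act a (act (conj (a ⁻¹) q) i)     ≡⟨ cong (act a) (fixed _ (q'∈ q q∈)) ⟩
          act a i                           ∎
          where
          open ≡-Reasoning
          a∈L = P⊂L a∈P
          q'∈ = ⁻¹∈ (normalizer Q) a-normalizes
        period : ∀ i → Fixed Q i → iterate (act a) p i ≡ i
        period i (i∈A , fixed) = trans (act-^ p (P⊂L a∈P) i∈A) (fixed _ aᵖ∈Q)
      ... | IH₁ , IH₂ | c , p∣c , count =
        (λ d → subst (p ∣_) same (∣m+n∣m⇒∣n (subst (p ∣_) (trans count (ℕ.+-comm _ c)) (IH₁ d)) p∣c)) ,
        (λ d → IH₂ (subst (p ∣_) (sym count) (∣m∣n⇒∣m+n (subst (p ∣_) (sym same) d) p∣c)))
        where
        same : # (λ i → Fixed? Q? i ×-dec (act a i ≟ i)) ≡ # (Fixed? P?)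
        same = #-cong _ (Fixed? P?)
          (λ { i ((i∈A , fixed) , ai≡i) → i∈A , λ g g∈ → fixed-by i∈A fixed ai≡i g g∈ (split g∈) })
          (λ { i (i∈A , fixed) → (i∈A , λ q q∈ → fixed q (Q⊂P q∈)) , fixed a a∈P })
          where
          fixed-by : ∀ {i} → A i → (∀ q → Q q → act q i ≡ i) → act a i ≡ i →
                     ∀ g → P g → (∃ λ k → Q ((a ^ k) ∙ g)) → act g i ≡ i
          fixed-by {i} i∈A fixed ai≡i g g∈ (k , q∈) = begin
            act g i                               ≡⟨ cong (λ t → act t i) (solve 2 (λ b g → g ⊜ ⊝ b ⊕ (b ⊕ g)) refl (a ^ k) g) ⟩
            act (((a ^ k) ⁻¹) ∙ ((a ^ k) ∙ g)) i  ≡⟨ act-∙ (⁻¹∈ L-submonoid aᵏ∈L) (P⊂L (Q⊂P q∈)) i∈A ⟩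
            act ((a ^ k) ⁻¹) (act ((a ^ k) ∙ g) i) ≡⟨ cong (act _) (fixed _ q∈) ⟩
            act ((a ^ k) ⁻¹) i                    ≡⟨ act-fixed-⁻¹ aᵏ∈L i∈A aᵏi≡i ⟩
            i                                     ∎
            where
            open ≡-Reasoning
            aᵏ∈L = ^∈ L-submonoid k (P⊂L a∈P)
            aᵏi≡i : act (a ^ k) i ≡ i
            aᵏi≡i = trans (sym (act-^ k (P⊂L a∈P) i∈A))
              (subst (λ n → iterate (act a) n i ≡ i) (ℕ.*-identityʳ k) (iterate-fixed (act a) k 1 i ai≡i))

      -- The numbers of points and of fixed points are divisible by p together, and 0 is divisible
      -- by p.
      fixed-point : ∀ {P} → Tower P → (P? : ∀ g → Dec (P g)) → (∀ {g} → P g → L g) →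
                    ¬ (p ∣ # A?) → ∃ (Fixed P)
      fixed-point tower P? P⊂L p∤ with any? (Fixed? P?)
      ... | yes found = found
      ... | no none = ⊥-elim (p∤ (proj₂ (#-Fixed tower P? P⊂L)
              (subst (p ∣_) (sym (#-none (Fixed? P?) λ i fi → none (i , fi))) (p ∣0))))

    -- What is used of a Sylow p-subgroup P of N: the quotient by P of its normaliser in N has no
    -- element of order p.
    Stuck : (N P : Fin m → Set) → Set
    Stuck N P = ∀ a → N a → (∀ h → P h → P (conj a h)) → P (a ^ p) → P a

    -- The conjugate tower is climbed step by step: once one level lies in P, the next generator
    -- normalises P and has its p-th power in P, so `Stuck` puts it into P.
    absorbs : ∀ {N P Q} → Submonoid P → Stuck N P → Tower Q → ∀ g → (∀ {q} → Q q → N (conj g q)) →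
              (∀ {q} → Q q → ∀ h → P h → P (conj (conj g q) h)) → ∀ {q} → Q q → P (conj g q)
    absorbs {P = P} S stuck (trivial Q-trivial) g into norm q∈ =
      subst P (sym (trans (cong (conj g) (Q-trivial q∈)) (conj-ε g))) (ε∈ S)
    absorbs {P = P} S stuck (extend {Q} a Q-tower Q? a-normalizes aᵖ∈Q a∈ Q⊂ split) g into norm {q} q∈ with split q∈
    ... | k , aᵏq∈ = subst P (solve 2 (λ b q → ⊝ b ⊕ (b ⊕ q) ⊜ q) refl (conj g a ^ k) (conj g q))
          (∙∈ S (⁻¹∈ S (^∈ S k ga∈P)) (subst P (trans (conj-∙ g (a ^ k) q) (cong (_∙ conj g q) (conj-^ g a k)))
            (IH aᵏq∈)))
      where
      IH : ∀ {q} → Q q → P (conj g q)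
      IH = absorbs S stuck Q-tower g (λ h → into (Q⊂ h)) (λ h → norm (Q⊂ h))
      ga∈P : P (conj g a)
      ga∈P = stuck _ (into a∈) (norm a∈) (subst P (conj-^ g a p) (IH aᵖ∈Q))

    module _ {N : Fin m → Set} (N-sub : Submonoid N) (N? : ∀ g → Dec (N g)) where
      record StuckTower : Set₁ where
        field
          {P}   : Fin m → Set
          P?    : ∀ g → Dec (P g)
          P-sub : Submonoid P
          tower : Tower P
          P⊂N   : ∀ {g} → P g → N g
          stuck : Stuck N P

      abstract
        -- An element a violating `Stuck` gives the strictly larger p-subgroup ⟨a⟩P, one tower step
        -- higher. The fuel covers the elements still outside P.
        grow : ∀ fuel {P} (P? : ∀ g → Dec (P g)) → Submonoid P → Tower P → (∀ {g} → P g → N g) →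
               m ≤ fuel + # P? → StuckTower
        grow fuel {P} P? S tower P⊂N bound
          with any? (λ a → N? a ×-dec all? (λ h → P? h →-dec P? (conj a h)) ×-dec P? (a ^ p) ×-dec ¬? (P? a))
        ... | no none = record
          { P? = P? ; P-sub = S ; tower = tower ; P⊂N = P⊂N
          ; stuck = λ a a∈N norm aᵖ∈ → decide a a∈N norm aᵖ∈ (P? a) }
          where
          decide : ∀ a → N a → (∀ h → P h → P (conj a h)) → P (a ^ p) → Dec (P a) → P a
          decide a a∈N norm aᵖ∈ (yes a∈) = a∈
          decide a a∈N norm aᵖ∈ (no a∉)  = ⊥-elim (none (a , a∈N , norm , aᵖ∈ , a∉))
        ... | yes (a , a∈N , norm , aᵖ∈ , a∉) = continue fuel bound
          where
          P' : Fin m → Set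
          P' g = ∃ λ b → ⟨ a ⟩ b × P (b ∙ g)
          P'? : ∀ g → Dec (P' g)
          P'? g = any? λ b → ⟨ a ⟩? b ×-dec P? (b ∙ g)
          P⊂P' : ∀ {g} → P g → P' g
          P⊂P' g∈ = ε , ε∈ (cyclic a) , subst P (sym (identityˡ _)) g∈
          a∈P' : P' a
          a∈P' = a ⁻¹ , ⁻¹∈ (cyclic a) (generator∈ a) , subst P (sym (inverseˡ a)) (ε∈ S)
          P'⊂N : ∀ {g} → P' g → N g
          P'⊂N {g} (b , b∈ , bg∈) = subst N (solve 2 (λ b g → ⊝ b ⊕ (b ⊕ g) ⊜ g) refl b g)
            (∙∈ N-sub (⁻¹∈ N-sub (⟨⟩-minimal N-sub a∈N b∈)) (P⊂N bg∈))
          S' : Submonoid P'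
          S' = submonoid (P⊂P' (ε∈ S)) λ { {g} {h} (b , b∈ , bg∈) (c , c∈ , ch∈) →
            c ∙ b , ∙∈ (cyclic a) c∈ b∈ ,
            subst P (solve 4 (λ b c g h → ((c ⊕ (b ⊕ g)) ⊕ ⊝ c) ⊕ (c ⊕ h) ⊜ (c ⊕ b) ⊕ (g ⊕ h)) refl b c g h)
              (∙∈ S (⟨⟩-minimal (normalizer P) norm c∈ _ bg∈) ch∈) }
          tower' : Tower P'
          tower' = extend a tower P? norm aᵖ∈ a∈P' P⊂P' λ { (b , (k , refl) , bg∈) → k , bg∈ }
          larger : # P? < # P'?
          larger = #-strict P? P'? (λ g → P⊂P') a a∈P' a∉
          continue : ∀ fuel → m ≤ fuel + # P? → StuckTower
          continue zero b = ⊥-elim (ℕ.<-irrefl refl (ℕ.≤-trans larger (ℕ.≤-trans (#≤ P'?) b)))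
          continue (suc fuel) b = grow fuel P'? S' tower' P'⊂N
            (ℕ.≤-trans b (ℕ.≤-trans (≤-reflexive (sym (ℕ.+-suc fuel _))) (ℕ.+-monoʳ-≤ fuel larger)))

        stuckTower : StuckTower
        stuckTower = grow m {λ g → g ≡ ε} (_≟ ε)
          (submonoid refl λ { refl refl → identityˡ ε }) (trivial λ eq → eq)
          (λ { refl → ε∈ N-sub }) (ℕ.m≤m+n m _)

  module Kernel {m : ℕ} {_∙_ : Fin m → Fin m → Fin m} {ε : Fin m} {_⁻¹ : Fin m → Fin m}
    (isGroup : IsGroup _≡_ _∙_ ε _⁻¹)
    {x : Fin m} (x-maximal : FiniteGroup.CoreFreeMaximal isGroup x)
    (R : PrimitiveGroup.Retraction isGroup x-maximal) (semiregular : PrimitiveGroup.Retraction.Semiregular R)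
    (x≢ε : x ≢ ε) {p : ℕ} (p-prime : Prime p) {v : Fin m} (v∈N : PrimitiveGroup.Retraction.N R v)
    (v≢ε : v ≢ ε) (vᵖ≡ε : FiniteGroup._^_ isGroup v p ≡ ε)
    where
    open FiniteGroup isGroup
    open PrimitiveGroup isGroup x-maximal
    open Retraction R
    open Towers isGroup p-prime
    open Counting
    open Iteration

    commutator : Fin m → Fin m
    commutator u = (u ⁻¹) ∙ conj x u

    commutator∈N : ∀ {u} → N u → N (commutator u)
    commutator∈N n = ∙∈ N-submonoid (⁻¹∈ N-submonoid n) (N-normal x _ n)

    -- Equal commutators mean that x commutes with wu⁻¹; as x is nontrivial, semiregularity makes
    -- this element of N trivial.
    commutator-injective : ∀ {u w} → N u → N w → commutator u ≡ commutator w → u ≡ w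
    commutator-injective {u} {w} u∈ w∈ eq with w ∙ (u ⁻¹) ≟ ε
    ... | yes wu⁻¹≡ε = sym (trans (solve 2 (λ w u → w ⊜ (w ⊕ ⊝ u) ⊕ u) refl w u)
                            (trans (cong (_∙ u) wu⁻¹≡ε) (identityˡ u)))
    ... | no wu⁻¹≢ε = ⊥-elim (x≢ε (semiregular (generator∈ x)
            (∙∈ N-submonoid w∈ (⁻¹∈ N-submonoid u∈)) wu⁻¹≢ε (begin
            conj x (w ∙ (u ⁻¹))                  ≡⟨ solve 3 (λ x u w → (x ⊕ (w ⊕ ⊝ u)) ⊕ ⊝ x ⊜ (w ⊕ (⊝ w ⊕ ((x ⊕ w) ⊕ ⊝ x))) ⊕ ((x ⊕ ⊝ u) ⊕ ⊝ x)) refl x u w ⟩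
            (w ∙ commutator w) ∙ conj x (u ⁻¹)   ≡⟨ cong (λ t → (w ∙ t) ∙ conj x (u ⁻¹)) (sym eq) ⟩
            (w ∙ commutator u) ∙ conj x (u ⁻¹)   ≡⟨ solve 3 (λ x u w → (w ⊕ (⊝ u ⊕ ((x ⊕ u) ⊕ ⊝ x))) ⊕ ((x ⊕ ⊝ u) ⊕ ⊝ x) ⊜ w ⊕ ⊝ u) refl x u w ⟩
            w ∙ (u ⁻¹)                           ∎)))
      where open ≡-Reasoning

    abstract
      commutator-surjective : ∀ n → N n → ∃ λ u → N u × commutator u ≡ n
      commutator-surjective n n∈ with injective⇒surjective extended injective n
        where
        -- N is a predicate on `Fin m`; extending the map by the identity outside N gives an
        -- injective self-map of `Fin m`.
        extended : Fin m → Fin m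
        extended u with N? u
        ... | yes _ = commutator u
        ... | no _  = u
        injective : ∀ u w → extended u ≡ extended w → u ≡ w
        injective u w eq with N? u | N? w
        ... | yes u∈ | yes w∈ = commutator-injective u∈ w∈ eq
        ... | yes u∈ | no w∉  = ⊥-elim (w∉ (subst N eq (commutator∈N u∈)))
        ... | no u∉  | yes w∈ = ⊥-elim (u∉ (subst N (sym eq) (commutator∈N w∈)))
        ... | no _   | no _   = eq
      ... | u , eq with N? u
      ...   | yes u∈ = u , u∈ , eq
      ...   | no u∉  = ⊥-elim (u∉ (subst N (sym eq) n∈))

    open StuckTower (stuckTower N-submonoid N?)

    -- The normaliser of P in N.
    M : Fin m → Set
    M u = N u × ∀ h → P h → P (conj u h)

    M-sub : Submonoid M
    M-sub = submonoid (ε∈ N-submonoid , ε∈ (normalizer P)) λ (a , b) (c , d) →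
      ∙∈ N-submonoid a c , ∙∈ (normalizer P) b d

    M? : ∀ u → Dec (M u)
    M? u = N? u ×-dec all? λ h → P? h →-dec P? (conj u h)

    P⊂M : ∀ {q} → P q → M q
    P⊂M q∈ = P⊂N q∈ , λ h h∈ → ∙∈ P-sub (∙∈ P-sub q∈ h∈) (⁻¹∈ P-sub q∈)

    _~_ : Fin m → Fin m → Set
    i ~ j = M ((i ⁻¹) ∙ j)

    _~?_ : ∀ i j → Dec (i ~ j)
    i ~? j = M? ((i ⁻¹) ∙ j)

    ~-refl : ∀ i → i ~ i
    ~-refl i = subst M (sym (inverseˡ i)) (ε∈ M-sub)

    ~-sym : ∀ {i j} → i ~ j → j ~ i
    ~-sym {i} {j} r = subst M (solve 2 (λ i j → ⊝ (⊝ i ⊕ j) ⊜ ⊝ j ⊕ i) refl i j) (⁻¹∈ M-sub r)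

    ~-trans : ∀ {i j k} → i ~ j → j ~ k → i ~ k
    ~-trans {i} {j} {k} r s =
      subst M (solve 3 (λ i j k → (⊝ i ⊕ j) ⊕ (⊝ j ⊕ k) ⊜ ⊝ i ⊕ k) refl i j k) (∙∈ M-sub r s)

    open Representatives {_~_ = _~_} _~?_ ~-refl ~-sym (λ {i} {j} {k} → ~-trans {i} {j} {k})

    ~-left : ∀ g {i j} → i ~ j → (g ∙ i) ~ (g ∙ j)
    ~-left g {i} {j} = subst M (solve 3 (λ g i j → ⊝ i ⊕ j ⊜ ⊝ (g ⊕ i) ⊕ (g ⊕ j)) refl g i j)

    rep∈N : ∀ {i} → N i → N (rep i)
    rep∈N {i} i∈ = subst N (solve 2 (λ i j → i ⊕ (⊝ i ⊕ j) ⊜ j) refl i (rep i))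
      (∙∈ N-submonoid i∈ (proj₁ (~-rep i)))

    rep-rep : ∀ i → rep (rep i) ≡ rep i
    rep-rep i = sym (rep-cong (~-rep i))

    -- For y = x this lets P act through its conjugate by x; a coset iM it fixes yields
    -- i⁻¹x as an element normalising P.
    cosets : Fin m → Action N (λ i → N i × rep i ≡ i)
    cosets y = record
      { L-submonoid = N-submonoid
      ; A? = λ i → N? i ×-dec (rep i ≟ i)
      ; act = λ g i → rep (conj y g ∙ i)
      ; act∈ = λ g∈ (i∈ , _) → rep∈N (∙∈ N-submonoid (N-normal y _ g∈) i∈) , rep-rep _
      ; act-∙ = λ {g} {h} {i} _ _ _ → trans (cong rep (trans (cong (_∙ i) (conj-∙ y g h)) (assoc _ _ i)))
                                            (rep-cong (~-left (conj y g) (~-rep _)))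
      ; act-ε = λ (_ , eq) → trans (cong rep (trans (cong (_∙ _) (conj-ε y)) (identityˡ _))) eq
      }

    -- That P, conjugated by y, fixes the coset iM says that the conjugate of P by i⁻¹y lies in M,
    -- hence normalises P; by `absorbs` it lies in P.
    fixed-coset : ∀ y i → Action.Fixed (cosets y) P i → ∀ {q} → P q → P (conj ((i ⁻¹) ∙ y) q)
    fixed-coset y i ((i∈ , _) , fixed) = absorbs P-sub stuck tower ((i ⁻¹) ∙ y)
      (λ q∈ → N-normal _ _ (P⊂N q∈)) (λ {q} q∈ → proj₂ (stabilizes q q∈))
      where
      stabilizes : ∀ q → P q → M (conj ((i ⁻¹) ∙ y) q)
      stabilizes q q∈ = subst M (solve 3 (λ i y q → ⊝ (⊝ (((y ⊕ q) ⊕ ⊝ y) ⊕ i) ⊕ i) ⊜ ((⊝ i ⊕ y) ⊕ q) ⊕ ⊝ (⊝ i ⊕ y)) refl i y q)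
        (⁻¹∈ M-sub (subst (λ j → (conj y q ∙ i) ~ j) (fixed q q∈) (~-rep (conj y q ∙ i))))

    A? = Action.A? (cosets ε)

    -- Under left multiplication P fixes only the base coset: if iM is fixed, then i⁻¹ normalises P.
    -- So the number of cosets is 1 modulo p. The set counted does not involve y, which makes the
    -- result usable for the action twisted by x.
    p∤cosets : ¬ (p ∣ # A?)
    p∤cosets p∣ = ¬prime[1] (subst Prime (∣1⇒≡1 (subst (p ∣_) one-fixed
        (proj₁ (Action.#-Fixed (cosets ε) tower P? P⊂N) p∣))) p-prime)
      where
      Fixed = Action.Fixed (cosets ε) P
      e∈M : M (rep ε)
      e∈M = subst M (trans (cong (_∙ rep ε) ε⁻¹≈ε) (identityˡ _)) (~-rep ε)
      base-fixed : Fixed (rep ε)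
      base-fixed = (rep∈N (ε∈ N-submonoid) , rep-rep ε) , λ q q∈ → sym (rep-cong
        (subst M (trans (sym (identityˡ _)) (cong (_∙ (conj ε q ∙ rep ε)) (sym ε⁻¹≈ε)))
          (∙∈ M-sub (subst M (sym (ε-conj q)) (P⊂M q∈)) e∈M)))
      unique : ∀ i → Fixed i → i ≡ rep ε
      unique i F@((i∈ , ri≡i) , fixed) = trans (sym ri≡i) (rep-cong
        (∙∈ N-submonoid (⁻¹∈ N-submonoid i∈) (ε∈ N-submonoid) , λ h h∈ → fixed-coset ε i F h∈))
      one-fixed : # (Action.Fixed? (cosets ε) P?) ≡ 1
      one-fixed = trans (#-cong _ (_≟ rep ε) unique (λ { _ refl → base-fixed })) (#-single (rep ε))

    abstract
      invariant-coset : ∃ λ i → N i × ∀ {q} → P q → P (conj ((i ⁻¹) ∙ x) q)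
      invariant-coset =
        let i , F = Action.fixed-point (cosets x) tower P? P⊂N p∤cosets
        in i , proj₁ (proj₁ F) , fixed-coset x i F

      -- A trivial P would be normalised by v and contain its p-th power, so `Stuck` would put v
      -- into it.
      P-nontrivial : ∃ λ w → P w × w ≢ ε
      P-nontrivial with any? (λ w → P? w ×-dec ¬? (w ≟ ε))
      ... | yes found = found
      ... | no none = v , stuck v v∈N v-normalizes (subst P (sym vᵖ≡ε) (ε∈ P-sub)) , v≢ε
        where
        v-normalizes : ∀ h → P h → P (conj v h)
        v-normalizes h h∈ with h ≟ ε
        ... | yes refl = subst P (sym (conj-ε v)) h∈
        ... | no h≢ε   = ⊥-elim (none (h , h∈ , h≢ε))

    -- The element i⁻¹x that normalises P is wxw⁻¹ for some w in N, since every element of N is a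
    -- commutator with x. Hence w⁻¹Pw, called Q below, is a nontrivial x-invariant subgroup of N,
    -- and irreducibility makes it N.
    N⊂P : ∀ g → N g → P g
    N⊂P g g∈ with invariant-coset
    ... | i , i∈ , t-normalizes with commutator-surjective (i ⁻¹) (⁻¹∈ N-submonoid i∈)
    ...   | u , u∈ , eq = subst P (conj-inverseˡ u g) (all (conj u g) (N-normal u g g∈))
      where
      w = u ⁻¹
      Q : Fin m → Set
      Q h = P (conj w h)
      Q-sub : Submonoid Q
      Q-sub = submonoid (subst P (sym (conj-ε w)) (ε∈ P-sub))
        λ {g} {h} p q → subst P (sym (conj-∙ w g h)) (∙∈ P-sub p q)
      -- commutator u = i⁻¹ says that w x w⁻¹ = i⁻¹ x.
      x-closed : ∀ {h} → Q h → Q (conj x h)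
      x-closed {h} h∈ = subst P (trans (cong (λ t → conj (t ∙ x) (conj w h)) (sym eq))
          (solve 3 (λ u x h → (((⊝ u ⊕ ((x ⊕ u) ⊕ ⊝ x)) ⊕ x) ⊕ ((⊝ u ⊕ h) ⊕ ⊝ ⊝ u)) ⊕ ⊝ ((⊝ u ⊕ ((x ⊕ u) ⊕ ⊝ x)) ⊕ x)
                            ⊜ (⊝ u ⊕ ((x ⊕ h) ⊕ ⊝ x)) ⊕ ⊝ ⊝ u) refl u x h))
        (t-normalizes h∈)
      all : ∀ h → N h → Q h
      all with P-nontrivial
      ... | k , k∈ , k≢ε = irreducible Q-sub x-closed {conj u k} (subst P (sym (conj-inverseˡ u k)) k∈)
        (N-normal u k (P⊂N k∈)) (λ c≡ε → k≢ε (conj-injective u (trans c≡ε (sym (conj-ε u)))))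

    conjugation : Action N (λ i → N i × i ≢ ε)
    conjugation = record
      { L-submonoid = N-submonoid
      ; A? = λ i → N? i ×-dec ¬? (i ≟ ε)
      ; act = conj
      ; act∈ = λ {g} {i} _ (i∈ , i≢ε) → N-normal g i i∈ ,
                 λ eq → i≢ε (conj-injective g (trans eq (sym (conj-ε g))))
      ; act-∙ = λ {g} {h} {i} _ _ _ → sym (conj-conj g h i)
      ; act-ε = λ {i} _ → ε-conj i
      }

    -- Left translation by v, which has order p, moves every element of N.
    p∣#N : p ∣ # N?
    p∣#N with CyclicActions.#-fixed (v ∙_) p-prime N? (λ i → ∙∈ N-submonoid v∈N)
                (λ i _ → trans (iterate-∙ p i) (trans (cong (_∙ i) vᵖ≡ε) (identityˡ i)))
      where
      iterate-∙ : ∀ n i → iterate (v ∙_) n i ≡ (v ^ n) ∙ i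
      iterate-∙ zero    i = sym (identityˡ i)
      iterate-∙ (suc n) i = trans (cong (v ∙_) (iterate-∙ n i)) (sym (assoc v _ i))
    ... | c , p∣c , eq = subst (p ∣_) (sym (trans eq (cong (_+ c) (#-none (λ i → N? i ×-dec ((v ∙ i) ≟ i))
        λ i (_ , vi≡i) → v≢ε (∙-cancelʳ i v ε (trans vi≡i (sym (identityˡ i)))))))) p∣c

    p∤nontrivial : ¬ (p ∣ # (Action.A? conjugation))
    p∤nontrivial p∣ = ¬prime[1] (subst Prime (∣1⇒≡1 (∣m+n∣m⇒∣n
        (subst (p ∣_) (trans (#-split N? (_≟ ε)) (trans (cong (_+ # nontrivial?) single) (ℕ.+-comm 1 (# nontrivial?)))) p∣#N) p∣)) p-prime)
      where
      nontrivial? = Action.A? conjugation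
      single : # (λ i → N? i ×-dec (i ≟ ε)) ≡ 1
      single = trans (#-cong _ (_≟ ε) (λ i → proj₂) (λ { _ refl → ε∈ N-submonoid , refl })) (#-single ε)

    -- The number of nontrivial elements of N is -1 modulo p, so the p-group N fixes one of them
    -- under conjugation. The centre of N is therefore nontrivial, and being x-invariant it is N.
    N-abelian : ∀ {a b} → N a → N b → a ∙ b ≡ b ∙ a
    N-abelian {a} {b} a∈ b∈ with Action.fixed-point conjugation tower P? P⊂N p∤nontrivial
    ... | z , (z∈ , z≢ε) , central = conj-fixed⇒comm a b (center b b∈ a a∈)
      where
      center : ∀ b → N b → ∀ q → N q → conj q b ≡ b
      center = irreducible {λ k → ∀ q → N q → conj q k ≡ k}
        (submonoid (λ q _ → conj-ε q) λ {g} {h} r s q q∈ → trans (conj-∙ q g h) (cong₂ _∙_ (r q q∈) (s q q∈)))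
        (λ {k} r q q∈ → trans
          (solve 3 (λ q x k → (q ⊕ ((x ⊕ k) ⊕ ⊝ x)) ⊕ ⊝ q ⊜ (x ⊕ ((((⊝ x ⊕ q) ⊕ ⊝ ⊝ x) ⊕ k) ⊕ ⊝ ((⊝ x ⊕ q) ⊕ ⊝ ⊝ x))) ⊕ ⊝ x) refl q x k)
          (cong (conj x) (r (conj (x ⁻¹) q) (N-normal _ q q∈))))
        (λ q q∈ → central q (N⊂P q q∈)) z∈ z≢ε

-- Finite fields: roots of polynomials, the Frobenius map, and 𝔽ₚ[α].

module FiniteFields where
  open FiniteCounting
  open Solvers
  import Algebra.Properties.CommutativeMonoid.Sum as Sums
  import Algebra.Properties.CommutativeSemiring.Binomial as Binomial
  import Algebra.Properties.CommutativeSemiring.Exp as CommPowers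
  import Algebra.Properties.Ring as RingProperties
  import Algebra.Properties.Semiring.Exp as Powers
  import Algebra.Properties.Semiring.Mult as Multiples
  open import Data.Fin using (fromℕ; inject₁; combine; remQuot)
  open import Data.Fin.Permutation using (Permutation′; permutation)
  open import Data.Fin.Properties as Finₚ using (any?; toℕ-fromℕ<; toℕ-fromℕ; toℕ-inject₁; toℕ<n; toℕ-injective; injective⇒≤; combine-remQuot; remQuot-combine)
  open import Data.Nat using (_∸_; _^_; NonZero; _!)
  open import Data.Nat.Combinatorics using (_C_; nCn≡1; k![n∸k]!∣n!)
  open import Data.Nat.Combinatorics.Specification using (nCk≡n!/k![n-k]!)
  open import Data.Nat.Coprimality using (prime⇒coprime; coprime-Bézout)
  open import Data.Nat.DivMod using (_%_; _/_; m%n<n; m≡m%n+[m/n]*n; m/n*n≡m)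
  open import Data.Nat.Divisibility using (∣⇒≤; m∣m*n; ∣1⇒≡1)
  open import Data.Nat.GCD using (module Bézout)
  open import Data.Nat.Primality using (euclidsLemma; ¬prime[1]; prime⇒nonZero; prime⇒nonTrivial)
  import Data.Nat.Properties as ℕ
  open import Data.Vec using (Vec; []; _∷_; replicate)
  import Relation.Binary.Reasoning.Setoid as SetoidReasoning

  prime∣!⇒≤ : ∀ {p} → Prime p → ∀ k → p ∣ k ! → p ≤ k
  prime∣!⇒≤ pr zero d = ⊥-elim (¬prime[1] (≡.subst Prime (∣1⇒≡1 d) pr))
  prime∣!⇒≤ pr (suc k) d with euclidsLemma (suc k) (k !) pr d
  ... | inj₁ p∣sk = ∣⇒≤ p∣sk
  ... | inj₂ p∣k! = ℕ.m≤n⇒m≤1+n (prime∣!⇒≤ pr k p∣k!)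

  -- p divides p! = C(p,k) · k! · (p - k)!, but neither factorial, as k and p - k are below p.
  prime∣C : ∀ {p k} → Prime p → 1 ≤ k → k < p → p ∣ p C k
  prime∣C {p@(suc p-1)} {k@(suc _)} pr 1≤k k<p
    with euclidsLemma (p C k) (k ! ℕ.* (p ∸ k) !) pr (≡.subst (p ∣_) factors (m∣m*n (p-1 !)))
    where
    k≤p = ℕ.<⇒≤ k<p
    instance _ = k ℕ.!* (p ∸ k) !≢0
    factors : p ! ≡ (p C k) ℕ.* (k ! ℕ.* (p ∸ k) !)
    factors = ≡.sym (≡.trans (≡.cong (ℕ._* (k ! ℕ.* (p ∸ k) !)) (nCk≡n!/k![n-k]! k≤p))
                             (m/n*n≡m (k![n∸k]!∣n! k≤p)))
  ... | inj₁ p∣C = p∣C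
  ... | inj₂ p∣d with euclidsLemma (k !) ((p ∸ k) !) pr p∣d
  ...   | inj₁ p∣k! = ⊥-elim (ℕ.<⇒≱ k<p (prime∣!⇒≤ pr k p∣k!))
  ...   | inj₂ p∣[p-k]! = ⊥-elim (ℕ.<⇒≱ (ℕ.∸-monoʳ-< 1≤k (ℕ.<⇒≤ k<p)) (prime∣!⇒≤ pr (p ∸ k) p∣[p-k]!))

  n<m^n : ∀ {m} → 1 < m → ∀ n → n < m ^ n
  n<m^n 1<m zero = s≤s z≤n
  n<m^n {m} 1<m (suc n) = begin-strict
    suc n        ≤⟨ n<m^n 1<m n ⟩
    m ^ n        <⟨ ℕ.m<m*n (m ^ n) m 1<m ⟩
    m ^ n ℕ.* m  ≡⟨ ℕ.*-comm (m ^ n) m ⟩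
    m ℕ.* m ^ n  ∎
    where
    open ℕ.≤-Reasoning
    instance _ = ℕ.>-nonZero (ℕ.≤-<-trans z≤n (n<m^n 1<m n))

  module FieldTheory (F : Field) where
    open Field F hiding (zero)
    open FieldDefs F
    open RingProperties ring
    open Multiples semiring using (×-congʳ; ×-homo-+; ×-assocˡ; ×-comm-*; ×-assoc-*; ×1-homo-*; ×-congˡ)
                            renaming (_×_ to _·_)
    open Powers semiring using (^-congˡ; ^-assocʳ) renaming (_^_ to _↑_)
    open IntegerCoefficients commRing using (solve; _⊜_; _⊕_; _⊗_; ⊝_)
    open SetoidReasoning setoid
    open Counting
    open Iteration

    *-nonzero : ∀ {a b} → ¬ (a ≈ 0#) → a * b ≈ 0# → b ≈ 0#
    *-nonzero {a} {b} a≉0 ab≈0 with inverse a a≉0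
    ... | a' , aa'≈1 = begin
      b             ≈⟨ *-identityˡ b ⟨
      1# * b        ≈⟨ *-congʳ aa'≈1 ⟨
      (a * a') * b  ≈⟨ solve 3 (λ a a' b → (a ⊗ a') ⊗ b ⊜ a' ⊗ (a ⊗ b)) refl a a' b ⟩
      a' * (a * b)  ≈⟨ *-congˡ ab≈0 ⟩
      a' * 0#       ≈⟨ zeroʳ a' ⟩
      0#            ∎

    *-cancelʳ : ∀ {a b c} → ¬ (c ≈ 0#) → a * c ≈ b * c → a ≈ b
    *-cancelʳ {a} {b} {c} c≉0 eq with inverse c c≉0
    ... | c' , cc'≈1 = begin
      a             ≈⟨ *-identityʳ a ⟨
      a * 1#        ≈⟨ *-congˡ cc'≈1 ⟨
      a * (c * c')  ≈⟨ *-assoc a c c' ⟨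
      (a * c) * c'  ≈⟨ *-congʳ eq ⟩
      (b * c) * c'  ≈⟨ *-assoc b c c' ⟩
      b * (c * c')  ≈⟨ *-congˡ cc'≈1 ⟩
      b * 1#        ≈⟨ *-identityʳ b ⟩
      b             ∎

    fpow≡↑ : ∀ a n → fpow a n ≡ a ↑ n
    fpow≡↑ a zero    = ≡.refl
    fpow≡↑ a (suc n) = ≡.cong (a *_) (fpow≡↑ a n)

    ↑-one : ∀ n → 1# ↑ n ≈ 1#
    ↑-one zero    = refl
    ↑-one (suc n) = trans (*-identityˡ _) (↑-one n)

    -- The value at t of the monic polynomial with the given lower coefficients.
    monic : ∀ {n} → Vec Carrier n → Carrier → Carrier
    monic []       t = 1#
    monic (c ∷ cs) t = c + t * monic cs t

    -- Synthetic division by t - r: the coefficients are the intermediate values of Horner's scheme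
    -- at r.
    quotient : ∀ {n} → Carrier → Vec Carrier (suc n) → Vec Carrier n
    quotient r (c ∷ [])         = []
    quotient r (c ∷ cs@(_ ∷ _)) = monic cs r ∷ quotient r cs

    monic-quotient : ∀ {n} r (cs : Vec Carrier (suc n)) t →
                     monic cs t ≈ (t - r) * monic (quotient r cs) t + monic cs r
    monic-quotient r (c ∷ []) t =
      solve 4 (λ c t r i → c ⊕ t ⊗ i ⊜ (t ⊕ ⊝ r) ⊗ i ⊕ (c ⊕ r ⊗ i)) refl c t r 1#
    monic-quotient r (c ∷ cs@(_ ∷ _)) t = begin
      c + t * monic cs t             ≈⟨ +-congˡ (*-congˡ (monic-quotient r cs t)) ⟩
      c + t * ((t - r) * u + s)
        ≈⟨ solve 5 (λ c t r u s → c ⊕ t ⊗ ((t ⊕ ⊝ r) ⊗ u ⊕ s) ⊜ (t ⊕ ⊝ r) ⊗ (s ⊕ t ⊗ u) ⊕ (c ⊕ r ⊗ s)) refl c t r u s ⟩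
      (t - r) * (s + t * u) + (c + r * s) ∎
      where
      u = monic (quotient r cs) t
      s = monic cs r

    roots≤degree : ∀ {n k} (cs : Vec Carrier n) (r : Fin k → Carrier) →
                   (∀ i j → r i ≈ r j → i ≡ j) → (∀ i → monic cs (r i) ≈ 0#) → k ≤ n
    roots≤degree {k = zero}  cs r inj root = z≤n
    roots≤degree {k = suc k} [] r inj root = ⊥-elim (0≉1 (sym (root zero)))
    roots≤degree {k = suc k} cs@(_ ∷ _) r inj root = s≤s (roots≤degree (quotient (r zero) cs) (λ i → r (suc i))
      (λ i j eq → Finₚ.suc-injective (inj _ _ eq))
      (λ i → *-nonzero {r (suc i) - r zero} (λ eq → Finₚ.0≢1+n (inj _ _ (sym (x∙y⁻¹≈ε⇒x≈y _ _ eq)))) (begin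
        (r (suc i) - r zero) * monic (quotient (r zero) cs) (r (suc i))
          ≈⟨ +-identityʳ _ ⟨
        (r (suc i) - r zero) * monic (quotient (r zero) cs) (r (suc i)) + 0#
          ≈⟨ +-congˡ (root zero) ⟨
        (r (suc i) - r zero) * monic (quotient (r zero) cs) (r (suc i)) + monic cs (r zero)
          ≈⟨ monic-quotient (r zero) cs (r (suc i)) ⟨
        monic cs (r (suc i))
          ≈⟨ root (suc i) ⟩
        0# ∎)))

    monic-zeros : ∀ n t → monic (replicate n 0#) t ≈ t ↑ n
    monic-zeros zero    t = refl
    monic-zeros (suc n) t = trans (+-identityˡ _) (*-congˡ (monic-zeros n t))

    power-fixed≤ : ∀ {k} n → 1 < n → (r : Fin k → Carrier) → (∀ i j → r i ≈ r j → i ≡ j) →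
                   (∀ i → r i ↑ n ≈ r i) → k ≤ n
    power-fixed≤ (suc (suc n)) _ r inj fixed =
      -- The polynomial tⁿ⁺² - t, whose lower coefficients are 0, -1, 0, ..., 0.
      roots≤degree (0# ∷ - 1# ∷ replicate n 0#) r inj λ i → begin
        0# + r i * (- 1# + r i * monic (replicate n 0#) (r i))
          ≈⟨ +-congˡ (*-congˡ (+-congˡ (*-congˡ (monic-zeros n (r i))))) ⟩
        0# + r i * (- 1# + r i * r i ↑ n)
          ≈⟨ +-identityˡ _ ⟩
        r i * (- 1# + r i * r i ↑ n)
          ≈⟨ solve 3 (λ t i u → t ⊗ (⊝ i ⊕ t ⊗ u) ⊜ t ⊗ (t ⊗ u) ⊕ ⊝ (t ⊗ i)) refl (r i) 1# (r i ↑ n) ⟩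
        r i ↑ suc (suc n) - r i * 1#
          ≈⟨ +-cong (fixed i) (-‿cong (*-identityʳ (r i))) ⟩
        r i - r i
          ≈⟨ -‿inverseʳ (r i) ⟩
        0# ∎
    power-fixed≤ (suc zero) (s≤s ())

    -- The vanishing of p · 1 is a parameter because it has two sources: the order of the unit in
    -- the field built from N, and a sum over all elements when the field is given.
    module Characteristic {p : ℕ} (p-prime : Prime p) (p·1≈0 : p · 1# ≈ 0#) where

      instance
        p-nonZero : NonZero p
        p-nonZero = prime⇒nonZero p-prime

      p·≈0 : ∀ a → p · a ≈ 0#
      p·≈0 a = begin
        p · a          ≈⟨ ×-congʳ p (*-identityˡ a) ⟨
        p · (1# * a)   ≈⟨ ×-assoc-* p 1# a ⟨
        (p · 1#) * a   ≈⟨ *-congʳ p·1≈0 ⟩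
        0# * a         ≈⟨ zeroˡ a ⟩
        0#             ∎

      ·-zero : ∀ n → n · 0# ≈ 0#
      ·-zero zero    = refl
      ·-zero (suc n) = trans (+-identityˡ _) (·-zero n)

      ∣⇒·≈0 : ∀ {n} → p ∣ n → ∀ a → n · a ≈ 0#
      ∣⇒·≈0 (divides q ≡.refl) a = begin
        (q ℕ.* p) · a  ≈⟨ ×-assocˡ a q p ⟨
        q · (p · a)    ≈⟨ ×-congʳ q (p·≈0 a) ⟩
        q · 0#         ≈⟨ ·-zero q ⟩
        0#             ∎

      frobenius : ∀ a b → (a + b) ↑ p ≈ a ↑ p + b ↑ p
      frobenius a b = expand p p-prime (λ c → ∣⇒·≈0 c)
        where
        open Binomial commutativeSemiring using (theorem; binomialTerm)
        open Sums +-commutativeMonoid using (sum; sum-cong-≋; sum-init-last; sum-replicate-zero)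
        -- p is generalised here so that it can be matched as a successor.
        expand : ∀ p → Prime p → (∀ {n} → p ∣ n → ∀ a → n · a ≈ 0#) → (a + b) ↑ p ≈ a ↑ p + b ↑ p
        expand zero ()
        expand p@(suc p-1) p-prime vanish = begin
          (a + b) ↑ p
            ≈⟨ theorem p a b ⟩
          term zero + sum (λ i → term (suc i))
            ≈⟨ +-cong bottom (sum-init-last (λ i → term (suc i))) ⟩
          b ↑ p + (sum (λ i → term (suc (inject₁ i))) + term (suc (fromℕ p-1)))
            ≈⟨ +-congˡ (+-cong (trans (sum-cong-≋ middle) (sum-replicate-zero p-1)) top) ⟩
          b ↑ p + (0# + a ↑ p)
            ≈⟨ solve 3 (λ b z a → b ⊕ (z ⊕ a) ⊜ z ⊕ (a ⊕ b)) refl (b ↑ p) 0# (a ↑ p) ⟩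
          0# + (a ↑ p + b ↑ p)
            ≈⟨ +-identityˡ _ ⟩
          a ↑ p + b ↑ p ∎
          where
          term : Fin (suc p) → Carrier
          term = binomialTerm a b p
          bottom : term zero ≈ b ↑ p
          bottom = trans (+-identityʳ _) (*-identityˡ _)
          top : term (suc (fromℕ p-1)) ≈ a ↑ p
          top = begin
            (p C suc (toℕ (fromℕ p-1))) · (a ↑ suc (toℕ (fromℕ p-1)) * b ↑ (p-1 ∸ toℕ (fromℕ p-1)))
              ≡⟨ ≡.cong (λ t → (p C suc t) · (a ↑ suc t * b ↑ (p-1 ∸ t))) (toℕ-fromℕ p-1) ⟩
            (p C p) · (a ↑ p * b ↑ (p-1 ∸ p-1))
              ≡⟨ ≡.cong₂ (λ t u → t · (a ↑ p * b ↑ u)) (nCn≡1 p) (ℕ.n∸n≡0 p-1) ⟩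
            1 · (a ↑ p * 1#)
              ≈⟨ trans (+-identityʳ _) (*-identityʳ _) ⟩
            a ↑ p ∎
          middle : ∀ (i : Fin p-1) → term (suc (inject₁ i)) ≈ 0#
          middle i = vanish (prime∣C p-prime (s≤s z≤n)
            (s≤s (≡.subst (_< p-1) (≡.sym (toℕ-inject₁ i)) (toℕ<n i)))) _

      frobenius-^ : ∀ k a b → (a + b) ↑ (p ^ k) ≈ a ↑ (p ^ k) + b ↑ (p ^ k)
      frobenius-^ zero a b = trans (*-identityʳ _) (+-cong (sym (*-identityʳ a)) (sym (*-identityʳ b)))
      frobenius-^ (suc k) a b = begin
        (a + b) ↑ (p ℕ.* p ^ k)              ≈⟨ ^-assocʳ (a + b) p (p ^ k) ⟨
        ((a + b) ↑ p) ↑ (p ^ k)              ≈⟨ ^-congˡ (p ^ k) (frobenius a b) ⟩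
        (a ↑ p + b ↑ p) ↑ (p ^ k)            ≈⟨ frobenius-^ k (a ↑ p) (b ↑ p) ⟩
        (a ↑ p) ↑ (p ^ k) + (b ↑ p) ↑ (p ^ k) ≈⟨ +-cong (^-assocʳ a p (p ^ k)) (^-assocʳ b p (p ^ k)) ⟩
        a ↑ (p ℕ.* p ^ k) + b ↑ (p ℕ.* p ^ k) ∎

      -- The ring 𝔽ₚ[α], as the least additive submonoid containing 1 and stable under α;
      -- characteristic p supplies the negatives.
      data Generated (α : Carrier) : Carrier → Set where
        gen-≈ : ∀ {a b} → a ≈ b → Generated α a → Generated α b
        gen-0 : Generated α 0#
        gen-1 : Generated α 1#
        gen-+ : ∀ {a b} → Generated α a → Generated α b → Generated α (a + b)
        gen-α : ∀ {a} → Generated α a → Generated α (α * a)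

      gen-· : ∀ {α a} n → Generated α a → Generated α (n · a)
      gen-· zero    g = gen-0
      gen-· (suc n) g = gen-+ g (gen-· n g)

      gen-↑ : ∀ {α} n → Generated α (α ↑ n)
      gen-↑ zero    = gen-1
      gen-↑ (suc n) = gen-α (gen-↑ n)

      -- The level is free because the blocks of a dessin are predicates at the level of the dessin.
      Generated-elim : ∀ {κ : Level} {α} (K : Carrier → Set κ) → (∀ {a b} → a ≈ b → K a → K b) →
                       K 0# → K 1# → (∀ {a b} → K a → K b → K (a + b)) → (∀ {a} → K a → K (α * a)) →
                       ∀ {a} → Generated α a → K a
      Generated-elim {α = α} K K-≈ K-0 K-1 K-+ K-α = elim
        where
        elim : ∀ {a} → Generated α a → K a
        elim (gen-≈ eq g) = K-≈ eq (elim g)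
        elim gen-0       = K-0
        elim gen-1       = K-1
        elim (gen-+ g h) = K-+ (elim g) (elim h)
        elim (gen-α g)   = K-α (elim g)

      frobenius-trivial : ∀ {α} k → α ↑ (p ^ k) ≈ α → ∀ {a} → Generated α a → a ↑ (p ^ k) ≈ a
      frobenius-trivial {α} k fixed = Generated-elim (λ a → a ↑ q ≈ a)
        (λ eq h → trans (^-congˡ q (sym eq)) (trans h eq))
        0-fixed (↑-one q)
        (λ {a} {b} h h' → trans (frobenius-^ k a b) (+-cong h h'))
        (λ {a} h → trans (↑-* q α a) (*-cong fixed h))
        where
        q = p ^ k
        instance _ = ℕ.m^n≢0 p k
        0-fixed : 0# ↑ q ≈ 0#
        0-fixed with q | ℕ.m^n≢0 p k
        ... | suc n | _ = zeroˡ _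
        ↑-* : ∀ n a b → (a * b) ↑ n ≈ a ↑ n * b ↑ n
        ↑-* n a b = CommPowers.^-distrib-* commutativeSemiring a b n

      -- The subspaces spanned by 1, α, …, αⁱ⁻¹ over the prime field.
      module Span (_≟_ : Decidable _≈_) {M : ℕ} (index : Carrier → Fin M)
                  (index-injective : ∀ {a b} → index a ≡ index b → a ≈ b) (α : Carrier) where

        -- `E` lists the span without repetition. `shift` says that multiplication by α leaves the
        -- span only in the direction of αⁱ, and `one∈` allows 1 to be missing from the zero span
        -- alone.
        record Stage (i : ℕ) : Set where
          field
            E         : Fin (p ^ i) → Carrier
            injective : ∀ j k → E j ≈ E k → j ≡ k
            generated : ∀ j → Generated α (E j)

          Im : Carrier → Set
          Im a = ∃ λ j → E j ≈ a

          field
            zero∈ : Im 0#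
            +∈    : ∀ j k → Im (E j + E k)
            shift : ∀ j → ∃ λ c → ∃ λ k → E k + c · (α ↑ i) ≈ α * E j
            one∈  : i ≡ 0 ⊎ Im 1#

          Im-≈ : ∀ {a b} → a ≈ b → Im a → Im b
          Im-≈ eq (j , e) = j , trans e eq

          Im-+ : ∀ {a b} → Im a → Im b → Im (a + b)
          Im-+ (j , e) (k , e') = Im-≈ (+-cong e e') (+∈ j k)

          Im-· : ∀ {a} n → Im a → Im (n · a)
          Im-· zero    h = zero∈
          Im-· (suc n) h = Im-+ h (Im-· n h)

          -- In characteristic p, negation is multiplication by p - 1.
          Im-neg : ∀ {a} → Im a → Im (- a)
          Im-neg {a} h = Im-≈ (-‿unique (ℕ.pred p · a) (trans (×-congˡ (ℕ.suc-pred p)) (p·≈0 a))) (Im-· (ℕ.pred p) h)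
            where
            -‿unique : ∀ b → a + b ≈ 0# → b ≈ - a
            -‿unique b eq = begin
              b              ≈⟨ solve 2 (λ a b → b ⊜ (a ⊕ b) ⊕ ⊝ a) refl a b ⟩
              (a + b) - a    ≈⟨ +-congʳ eq ⟩
              0# - a         ≈⟨ +-identityˡ _ ⟩
              - a            ∎

          Im? : ∀ a → Dec (Im a)
          Im? a = any? λ j → E j ≟ a

          size-bound : p ^ i ≤ M
          size-bound = injective⇒≤ {f = λ j → index (E j)} λ eq → injective _ _ (index-injective eq)

        base : Stage 0
        base = record
          { E = λ _ → 0#
          ; injective = λ { zero zero _ → ≡.refl }
          ; generated = λ _ → gen-0
          ; zero∈ = zero , refl
          ; +∈ = λ _ _ → zero , sym (+-identityˡ 0#)
          ; shift = λ _ → 0 , zero , trans (+-identityˡ _) (sym (zeroʳ α))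
          ; one∈ = inj₁ ≡.refl }

        module Next {i : ℕ} (S : Stage i) (αⁱ∉ : ¬ Stage.Im S (α ↑ i)) where
          open Stage S
          w = α ↑ i

          E' : Fin (p ^ suc i) → Carrier
          E' j = toℕ (proj₁ (remQuot {p} (p ^ i) j)) · w + E (proj₂ (remQuot {p} (p ^ i) j))

          Im' : Carrier → Set
          Im' a = ∃ λ j → E' j ≈ a

          ·-mod : ∀ c a → (c % p) · a ≈ c · a
          ·-mod c a = begin
            (c % p) · a                          ≈⟨ +-identityʳ _ ⟨
            (c % p) · a + 0#                     ≈⟨ +-congˡ (∣⇒·≈0 (divides (c / p) ≡.refl) a) ⟨
            (c % p) · a + (c / p ℕ.* p) · a      ≈⟨ ×-homo-+ a (c % p) (c / p ℕ.* p) ⟨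
            (c % p ℕ.+ c / p ℕ.* p) · a          ≡⟨ ≡.cong (_· a) (m≡m%n+[m/n]*n c p) ⟨
            c · a                                ∎

          combination∈ : ∀ c {a} → Im a → Im' (c · w + a)
          combination∈ c {a} (j , eq) = combine d j , (begin
            E' (combine d j)
              ≡⟨ ≡.cong (λ t → toℕ (proj₁ t) · w + E (proj₂ t)) (remQuot-combine d j) ⟩
            toℕ d · w + E j
              ≡⟨ ≡.cong (λ t → t · w + E j) (toℕ-fromℕ< (m%n<n c p)) ⟩
            (c % p) · w + E j
              ≈⟨ +-cong (·-mod c w) eq ⟩
            c · w + a ∎)
            where d = fromℕ< (m%n<n c p)

          -- By Bézout d is invertible modulo p, so a multiple d · w in the span would bring w
          -- itself into it.
          independent : ∀ d → 1 ≤ d → d < p → ¬ Im (d · w)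
          independent d@(suc _) _ d<p h with coprime-Bézout (prime⇒coprime p-prime d<p)
          ... | Bézout.-+ u v eq = αⁱ∉ (Im-≈ (begin
            v · (d · w)              ≈⟨ ×-assocˡ w v d ⟩
            (v ℕ.* d) · w            ≡⟨ ≡.cong (_· w) eq ⟨
            w + (u ℕ.* p) · w        ≈⟨ +-congˡ (∣⇒·≈0 (divides u ≡.refl) w) ⟩
            w + 0#                   ≈⟨ +-identityʳ w ⟩
            w                        ∎) (Im-· v h))
          ... | Bézout.+- u v eq = αⁱ∉ (Im-≈ (begin
            - (v · (d · w))                    ≈⟨ -‿cong (×-assocˡ w v d) ⟩
            - ((v ℕ.* d) · w)                  ≈⟨ solve 2 (λ a b → ⊝ b ⊜ a ⊕ ⊝ (a ⊕ b)) refl w ((v ℕ.* d) · w) ⟩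
            w - (w + (v ℕ.* d) · w)            ≡⟨ ≡.cong (λ t → w - t · w) eq ⟩
            w - (u ℕ.* p) · w                  ≈⟨ +-congˡ (-‿cong (∣⇒·≈0 (divides u ≡.refl) w)) ⟩
            w - 0#                             ≈⟨ +-congˡ -0#≈0# ⟩
            w + 0#                             ≈⟨ +-identityʳ w ⟩
            w                                  ∎) (Im-neg (Im-· v h)))

          no-relation : ∀ c c' j j' → c < c' → c' < p → ¬ (c · w + E j ≈ c' · w + E j')
          no-relation c c' j j' c<c' c'<p eq =
            independent (c' ∸ c) (ℕ.m<n⇒0<n∸m c<c') (ℕ.≤-<-trans (ℕ.m∸n≤m c' c) c'<p)
              (Im-≈ (begin
                E j - E j'
                  ≈⟨ solve 3 (λ a b c → a ⊕ ⊝ b ⊜ (c ⊕ a) ⊕ ⊝ (c ⊕ b)) refl (E j) (E j') (c · w) ⟩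
                (c · w + E j) - (c · w + E j')
                  ≈⟨ +-congʳ eq ⟩
                (c' · w + E j') - (c · w + E j')
                  ≡⟨ ≡.cong (λ t → (t · w + E j') - (c · w + E j')) (ℕ.m∸n+n≡m (ℕ.<⇒≤ c<c')) ⟨
                ((c' ∸ c ℕ.+ c) · w + E j') - (c · w + E j')
                  ≈⟨ +-congʳ (+-congʳ (×-homo-+ w (c' ∸ c) c)) ⟩
                (((c' ∸ c) · w + c · w) + E j') - (c · w + E j')
                  ≈⟨ solve 3 (λ d c b → ((d ⊕ c) ⊕ b) ⊕ ⊝ (c ⊕ b) ⊜ d) refl ((c' ∸ c) · w) (c · w) (E j') ⟩
                (c' ∸ c) · w ∎)
                (Im-+ (j , refl) (Im-neg (j' , refl))))

          injective' : ∀ j k → E' j ≈ E' k → j ≡ k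
          injective' j k eq = ≡.trans (≡.sym (combine-remQuot {p} (p ^ i) j))
            (≡.trans (≡.cong₂ combine c≡c' j≡k) (combine-remQuot {p} (p ^ i) k))
            where
            cj = remQuot {p} (p ^ i) j
            ck = remQuot {p} (p ^ i) k
            c≡c' : proj₁ cj ≡ proj₁ ck
            c≡c' with ℕ.<-cmp (toℕ (proj₁ cj)) (toℕ (proj₁ ck))
            ... | tri< lt _ _ = ⊥-elim (no-relation _ _ _ _ lt (toℕ<n (proj₁ ck)) eq)
            ... | tri≈ _ e _  = toℕ-injective e
            ... | tri> _ _ gt = ⊥-elim (no-relation _ _ _ _ gt (toℕ<n (proj₁ cj)) (sym eq))
            j≡k : proj₂ cj ≡ proj₂ ck
            j≡k = injective _ _ (begin
              E (proj₂ cj)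
                ≈⟨ solve 2 (λ c b → b ⊜ (c ⊕ b) ⊕ ⊝ c) refl (toℕ (proj₁ cj) · w) (E (proj₂ cj)) ⟩
              (toℕ (proj₁ cj) · w + E (proj₂ cj)) - toℕ (proj₁ cj) · w
                ≈⟨ +-congʳ eq ⟩
              (toℕ (proj₁ ck) · w + E (proj₂ ck)) - toℕ (proj₁ cj) · w
                ≡⟨ ≡.cong (λ t → (toℕ (proj₁ ck) · w + E (proj₂ ck)) - toℕ t · w) c≡c' ⟩
              (toℕ (proj₁ ck) · w + E (proj₂ ck)) - toℕ (proj₁ ck) · w
                ≈⟨ solve 2 (λ c b → b ⊜ (c ⊕ b) ⊕ ⊝ c) refl (toℕ (proj₁ ck) · w) (E (proj₂ ck)) ⟨
              E (proj₂ ck) ∎)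

          Im'-≈ : ∀ {a b} → a ≈ b → Im' a → Im' b
          Im'-≈ eq (j , e) = j , trans e eq

          next : Stage (suc i)
          next = record
            { E = E'
            ; injective = injective'
            ; generated = λ j → gen-+ (gen-· (toℕ (proj₁ (remQuot {p} (p ^ i) j))) (gen-↑ i)) (generated _)
            ; zero∈ = Im'-≈ (+-identityˡ 0#) (combination∈ 0 zero∈)
            ; +∈ = λ j k → let cj = toℕ (proj₁ (remQuot {p} (p ^ i) j)); ck = toℕ (proj₁ (remQuot {p} (p ^ i) k)) in
                Im'-≈ (trans (+-congʳ (×-homo-+ w cj ck))
                             (solve 4 (λ c d a b → (c ⊕ d) ⊕ (a ⊕ b) ⊜ (c ⊕ a) ⊕ (d ⊕ b)) refl (cj · w) (ck · w) _ _))
                      (combination∈ (cj ℕ.+ ck) (+∈ _ _))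
            ; shift = shift'
            ; one∈ = inj₂ (one∈' one∈) }
            where
            shift' : ∀ j → ∃ λ c → ∃ λ k → E' k + c · (α ↑ suc i) ≈ α * E' j
            shift' j with shift (proj₂ (remQuot {p} (p ^ i) j))
            ... | d , k , eq with combination∈ d (k , refl)
            ... | l , eq' = c , l , (begin
              E' l + c · (α * w)          ≈⟨ +-cong (trans eq' (+-comm _ _)) (sym (×-comm-* c α w)) ⟩
              (E k + d · w) + α * (c · w) ≈⟨ +-congʳ eq ⟩
              α * b + α * (c · w)         ≈⟨ solve 3 (λ α b u → α ⊗ b ⊕ α ⊗ u ⊜ α ⊗ (u ⊕ b)) refl α b (c · w) ⟩
              α * (c · w + b)             ∎)
              where
              c = toℕ (proj₁ (remQuot {p} (p ^ i) j))
              b = E (proj₂ (remQuot {p} (p ^ i) j))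
            one∈' : i ≡ 0 ⊎ Im 1# → Im' 1#
            one∈' (inj₁ ≡.refl) = Im'-≈ (trans (+-identityʳ _) (+-identityʳ _)) (combination∈ 1 zero∈)
            one∈' (inj₂ h) = Im'-≈ (+-identityˡ _) (combination∈ 0 h)

        -- Once αᵉ lies in the span of the lower powers, that span is stable under α; it is then
        -- 𝔽ₚ[α], listed with exactly pᵉ elements.
        record Complete : Set where
          field
            {e}   : ℕ
            stage : Stage e
            1≤e   : 1 ≤ e
          open Stage stage public
          field
            α-closed : ∀ j → Im (α * E j)

          Generated⇒Im : ∀ {a} → Generated α a → Im a
          Generated⇒Im = Generated-elim Im Im-≈ zero∈ (one 1≤e one∈) Im-+
            (λ { (j , eq) → Im-≈ (*-congˡ eq) (α-closed j) })
            where
            one : 1 ≤ e → e ≡ 0 ⊎ Im 1# → Im 1#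
            one 1≤e (inj₁ e≡0) = ⊥-elim (ℕ.<⇒≢ 1≤e (≡.sym e≡0))
            one _   (inj₂ h)   = h

        search : ∀ fuel i → M ≤ i ℕ.+ fuel → Stage i → Complete
        search fuel i bound S with Stage.Im? S (α ↑ i)
        -- The zero span does not contain α⁰ = 1, so the search cannot stop at stage 0.
        search fuel zero bound S | yes (j , αⁱ) = ⊥-elim (single (proj₁ zero∈) j (proj₂ zero∈) αⁱ)
          where
          open Stage S
          single : ∀ (j k : Fin 1) → E j ≈ 0# → E k ≈ 1# → ⊥
          single zero zero e e' = 0≉1 (trans (sym e) e')
        search fuel (suc i) bound S | yes αⁱ∈ = record
          { stage = S ; 1≤e = s≤s z≤n
          ; α-closed = λ j → let c , k , eq = shift j in Im-≈ eq (Im-+ (k , refl) (Im-· c αⁱ∈)) }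
          where open Stage S
        -- Without fuel M ≤ i, against i < pⁱ ≤ M.
        search zero i bound S | no _ = ⊥-elim (ℕ.<-irrefl ≡.refl
          (ℕ.<-≤-trans (n<m^n (ℕ.nonTrivial⇒n>1 p {{prime⇒nonTrivial p-prime}}) i)
            (ℕ.≤-trans (Stage.size-bound S) (≡.subst (M ≤_) (ℕ.+-identityʳ i) bound))))
        search (suc fuel) i bound S | no αⁱ∉ =
          search fuel (suc i) (≡.subst (M ≤_) (ℕ.+-suc i fuel) bound) (Next.next S αⁱ∉)

        abstract
          complete : Complete
          complete = search M 0 ℕ.≤-refl base

        module _ (C : Complete) where
          open Complete C

          order∣ : ∀ {n} → HasMulOrder α n → n ∣ p ^ e ∸ 1
          order∣ {zero} (() , _)
          order∣ {suc n} (_ , αⁿ≈1 , minimal) = ≡.subst (suc n ∣_) count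
            (CyclicActions.∣#-free a n (# nonzero?) nonzero? ℕ.≤-refl preserves period free)
            where
            a : Fin (p ^ e) → Fin (p ^ e)
            a j = proj₁ (α-closed j)
            nonzero? : ∀ j → Dec (¬ (E j ≈ 0#))
            nonzero? j = ¬? (E j ≟ 0#)
            iterate-a : ∀ k j → E (iterate a k j) ≈ fpow α k * E j
            iterate-a zero    j = sym (*-identityˡ _)
            iterate-a (suc k) j = trans (proj₂ (α-closed _)) (trans (*-congˡ (iterate-a k j)) (sym (*-assoc _ _ _)))
            α≉0 : ¬ (α ≈ 0#)
            α≉0 α≈0 = 0≉1 (trans (sym (zeroˡ _)) (trans (*-congʳ (sym α≈0)) αⁿ≈1))
            preserves : ∀ j → ¬ (E j ≈ 0#) → ¬ (E (a j) ≈ 0#)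
            preserves j Ej≉0 eq = Ej≉0 (*-nonzero α≉0 (trans (sym (proj₂ (α-closed j))) eq))
            period : ∀ j → ¬ (E j ≈ 0#) → iterate a (suc n) j ≡ j
            period j _ = injective _ _ (trans (iterate-a (suc n) j) (trans (*-congʳ αⁿ≈1) (*-identityˡ _)))
            free : ∀ j → ¬ (E j ≈ 0#) → ∀ k → 1 ≤ k → k < suc n → iterate a k j ≢ j
            free j Ej≉0 k 1≤k k<n eq = minimal k 1≤k k<n (*-cancelʳ Ej≉0 (begin
              fpow α k * E j      ≈⟨ iterate-a k j ⟨
              E (iterate a k j)   ≡⟨ ≡.cong E eq ⟩
              E j                 ≈⟨ *-identityˡ _ ⟨
              1# * E j            ∎))
            count : # nonzero? ≡ p ^ e ∸ 1
            count = ≡.sym (≡.trans (≡.cong (_∸ 1) (≡.trans (≡.sym (#-all all? λ _ → ≡.refl)) (≡.trans (#-split all? zero?)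
                (≡.cong₂ ℕ._+_
                  (≡.trans (#-cong _ (Fin._≟ proj₁ zero∈)
                      (λ j (_ , eq) → injective _ _ (trans eq (sym (proj₂ zero∈))))
                      (λ { _ ≡.refl → ≡.refl , proj₂ zero∈ })) (#-single (proj₁ zero∈)))
                  (#-cong _ nonzero? (λ _ → proj₂) (λ _ h → ≡.refl , h)))))) ≡.refl)
              where
              all? : ∀ (j : Fin (p ^ e)) → Dec (j ≡ j)
              all? j = j Fin.≟ j
              zero? : ∀ j → Dec (E j ≈ 0#)
              zero? j = E j ≟ 0#

      degree-minimal : ∀ {d} → HasOrder F (p ^ d) → ∀ {α n} → (∀ a → Generated α a) → HasMulOrder α n →
                       ∀ k → 1 ≤ k → n ∣ p ^ k ∸ 1 → d ≤ k
      degree-minimal {d} order {α} {n} gen (_ , αⁿ≈1 , _) k 1≤k (divides c eq) =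
        ℕ.≮⇒≥ λ k<d → (ℕ.<⇒≱ (ℕ.^-monoʳ-< p 1<p k<d)
          (power-fixed≤ (p ^ k) (ℕ.<-≤-trans 1<p (≡.subst (_≤ p ^ k) (ℕ.*-identityʳ p) (ℕ.^-monoʳ-≤ p 1≤k)))
            enum enum-inj λ i → frobenius-trivial k α-fixed (gen (enum i))))
        where
        open HasOrder order
        1<p = ℕ.nonTrivial⇒n>1 p {{prime⇒nonTrivial p-prime}}
        α-fixed : α ↑ (p ^ k) ≈ α
        α-fixed = begin
          α ↑ (p ^ k)              ≡⟨ ≡.cong (α ↑_) (ℕ.m+[n∸m]≡n (ℕ.m^n>0 p k)) ⟨
          α * α ↑ (p ^ k ∸ 1)      ≡⟨ ≡.cong (λ t → α * α ↑ t) eq ⟩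
          α * α ↑ (c ℕ.* n)        ≡⟨ ≡.cong (λ t → α * α ↑ t) (ℕ.*-comm c n) ⟩
          α * α ↑ (n ℕ.* c)        ≈⟨ *-congˡ (^-assocʳ α n c) ⟨
          α * (α ↑ n) ↑ c          ≈⟨ *-congˡ (^-congˡ c (trans (reflexive (≡.sym (fpow≡↑ α n))) αⁿ≈1)) ⟩
          α * 1# ↑ c               ≈⟨ *-congˡ (↑-one c) ⟩
          α * 1#                   ≈⟨ *-identityʳ α ⟩
          α                        ∎

    -- Translation by 1 permutes F, so the sum of all elements is unchanged by adding q · 1.
    abstract
      q·1≈0 : ∀ {q} → HasOrder F q → q · 1# ≈ 0#
      q·1≈0 {q} order = begin
        q · 1#                        ≈⟨ solve 2 (λ s u → u ⊜ (s ⊕ u) ⊕ ⊝ s) refl (sum enum) (q · 1#) ⟩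
        (sum enum + q · 1#) - sum enum ≈⟨ +-congʳ shifted ⟨
        sum enum - sum enum           ≈⟨ -‿inverseʳ _ ⟩
        0#                            ∎
        where
        open HasOrder order
        open Sums +-commutativeMonoid using (sum; sum-permute; sum-cong-≋; ∑-distrib-+; sum-replicate)
        index : Carrier → Fin q
        index a = proj₁ (enum-surj a)
        π : Permutation′ q
        π = permutation (λ i → index (enum i + 1#)) (λ i → index (enum i - 1#))
          (λ i → enum-inj _ _ (begin
            enum (index (enum (index (enum i - 1#)) + 1#)) ≈⟨ proj₂ (enum-surj _) ⟩
            enum (index (enum i - 1#)) + 1#                ≈⟨ +-congʳ (proj₂ (enum-surj _)) ⟩
            (enum i - 1#) + 1#                             ≈⟨ solve 2 (λ a b → (a ⊕ ⊝ b) ⊕ b ⊜ a) refl (enum i) 1# ⟩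
            enum i                                         ∎))
          (λ i → enum-inj _ _ (begin
            enum (index (enum (index (enum i + 1#)) - 1#)) ≈⟨ proj₂ (enum-surj _) ⟩
            enum (index (enum i + 1#)) - 1#                ≈⟨ +-congʳ (proj₂ (enum-surj _)) ⟩
            (enum i + 1#) - 1#                             ≈⟨ solve 2 (λ a b → (a ⊕ b) ⊕ ⊝ b ⊜ a) refl (enum i) 1# ⟩
            enum i                                         ∎))
        shifted : sum enum ≈ sum enum + q · 1#
        shifted = begin
          sum enum                                    ≈⟨ sum-permute enum π ⟩
          sum (λ i → enum (index (enum i + 1#)))      ≈⟨ sum-cong-≋ (λ i → proj₂ (enum-surj (enum i + 1#))) ⟩
          sum (λ i → enum i + 1#)                     ≈⟨ ∑-distrib-+ enum (λ _ → 1#) ⟩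
          sum enum + sum (λ (_ : Fin q) → 1#)         ≈⟨ +-congˡ (sum-replicate q) ⟩
          sum enum + q · 1#                           ∎

      -- (pᵈ) · 1 is the d-th power of p · 1, and a field has no nonzero nilpotents.
      p·1≈0 : ∀ {p} d → HasOrder F (p ^ d) → p · 1# ≈ 0#
      p·1≈0 {p} d order = root d (q·1≈0 order)
        where
        open HasOrder order
        root : ∀ d → (p ^ d) · 1# ≈ 0# → p · 1# ≈ 0#
        root zero eq = ⊥-elim (0≉1 (trans (sym eq) (+-identityʳ 1#)))
        root (suc d) eq with (p · 1#) ≟ 0#
        ... | yes p·1≈0 = p·1≈0
        ... | no p·1≉0  = root d (*-nonzero p·1≉0 (trans (sym (×1-homo-* p (p ^ d))) eq))

    module _ {p d n : ℕ} (p-prime : Prime p) (order : HasOrder F (p ^ d))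
             (numerical : (n ≡ 1 × d ≡ 1) ⊎ (1 < n × MulOrderMod p d n)) where
      open HasOrder order
      open Characteristic p-prime (p·1≈0 d order)

      -- 𝔽ₚ[α] has pᵉ elements with e ≤ d by size. Conversely n divides pᵉ - 1, so e is not below
      -- the order d of p modulo n; for d = 1 the bound 1 ≤ e is enough.
      generates : ∀ {α} → HasMulOrder α n → ∀ a → Generated α a
      generates {α} α-order a =
        let j , eq = surjective (≡.cong (p ^_) e≡d) (λ j → index (E j))
                       (λ j k eq → injective j k (index-injective eq)) (index a)
        in gen-≈ (index-injective eq) (generated j)
        where
        index : Carrier → Fin (p ^ d)
        index a = proj₁ (enum-surj a)
        index-injective : ∀ {a b} → index a ≡ index b → a ≈ b
        index-injective {a} {b} eq =
          trans (sym (proj₂ (enum-surj a))) (trans (reflexive (≡.cong enum eq)) (proj₂ (enum-surj b)))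
        open Span _≟_ index index-injective α
        open Complete complete
        d≤e : (n ≡ 1 × d ≡ 1) ⊎ (1 < n × MulOrderMod p d n) → d ≤ e
        d≤e (inj₁ (_ , ≡.refl)) = 1≤e
        d≤e (inj₂ (_ , _ , _ , minimal)) =
          ℕ.≮⇒≥ λ e<d → minimal e 1≤e e<d (order∣ complete α-order)
        e≡d : e ≡ d
        e≡d = ℕ.≤-antisym
          (ℕ.≮⇒≥ λ d<e → ℕ.<⇒≱ (ℕ.^-monoʳ-< p (ℕ.nonTrivial⇒n>1 p {{prime⇒nonTrivial p-prime}}) d<e) size-bound)
          (d≤e numerical)
        surjective : ∀ {k m} → k ≡ m → (f : Fin k → Fin m) → (∀ i j → f i ≡ f j → i ≡ j) → ∀ c → ∃ λ i → f i ≡ c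
        surjective ≡.refl = injective⇒surjective

-- The field structure on N and the isomorphism with an affine group.

module PaleyModels where
  open Solvers
  open FiniteCounting
  open FiniteGroups
  open FrobeniusComplements
  open FrobeniusKernels
  open FiniteFields
  import Algebra.Properties.AbelianGroup as AbelianGroupProperties
  import Algebra.Properties.CommutativeSemigroup as CommutativeSemigroupProperties
  import Algebra.Properties.Semiring.Mult as Multiples
  open import Data.Fin using (_≟_)
  open import Data.List using ([]; _∷_)
  open import Data.List.Relation.Unary.All using (_∷_)
  open import Data.Nat.Divisibility using (1∣_)
  open import Data.Nat.ListAction using (product)
  open import Data.Nat.Primality using (prime⇒nonTrivial)
  open import Data.Nat.Primality.Factorisation using (factorise)
  import Data.Nat.Properties as ℕ
  import Relation.Binary.Reasoning.Setoid as SetoidReasoning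

  -- A simple ℤ[σ]-module with a chosen nonzero vector v, the future unit. Irreducibility speaks of
  -- σ-stable submonoids, which in a finite module are the submodules.
  record SimpleModule : Set₁ where
    field
      abelianGroup : AbelianGroup 0ℓ 0ℓ
    open AbelianGroup abelianGroup public renaming (_∙_ to _+_; ε to 0#; _⁻¹ to -_)
    field
      σ           : Carrier → Carrier
      σ-cong      : ∀ {a b} → a ≈ b → σ a ≈ σ b
      σ-+         : ∀ a b → σ (a + b) ≈ σ a + σ b
      irreducible : ∀ (K : Carrier → Set) → (∀ {a b} → a ≈ b → K a → K b) → K 0# →
                    (∀ {a b} → K a → K b → K (a + b)) → (∀ {a} → K a → K (σ a)) →
                    ∀ {a} → K a → ¬ (a ≈ 0#) → ∀ b → K b
      v           : Carrier
      v≉0         : ¬ (v ≈ 0#)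

  -- Schur's lemma: since the polynomials in σ commute, the one taking v to a is an
  -- endomorphism determined by a, and these endomorphisms form a field.
  module SchurField (M : SimpleModule) where
    open SimpleModule M
    open SetoidReasoning setoid
    open AbelianGroupProperties abelianGroup using (∙-cancelˡ)
    open CommutativeSemigroupProperties commutativeSemigroup using (interchange)

    infixl 6 _⊕_
    data Poly : Set where
      0ᵖ 1ᵖ : Poly
      shift : Poly → Poly
      _⊕_   : Poly → Poly → Poly

    ⟦_⟧ : Poly → Carrier → Carrier
    ⟦ 0ᵖ ⟧      a = 0#
    ⟦ 1ᵖ ⟧      a = a
    ⟦ shift e ⟧ a = σ (⟦ e ⟧ a)
    ⟦ e ⊕ f ⟧   a = ⟦ e ⟧ a + ⟦ f ⟧ a

    σ-0 : σ 0# ≈ 0#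
    σ-0 = ∙-cancelˡ (σ 0#) _ _ (trans (sym (σ-+ 0# 0#)) (trans (σ-cong (identityˡ 0#)) (sym (identityʳ _))))

    ⟦⟧-cong : ∀ e {a b} → a ≈ b → ⟦ e ⟧ a ≈ ⟦ e ⟧ b
    ⟦⟧-cong 0ᵖ        eq = refl
    ⟦⟧-cong 1ᵖ        eq = eq
    ⟦⟧-cong (shift e) eq = σ-cong (⟦⟧-cong e eq)
    ⟦⟧-cong (e ⊕ f)   eq = ∙-cong (⟦⟧-cong e eq) (⟦⟧-cong f eq)

    ⟦⟧-+ : ∀ e a b → ⟦ e ⟧ (a + b) ≈ ⟦ e ⟧ a + ⟦ e ⟧ b
    ⟦⟧-+ 0ᵖ        a b = sym (identityˡ 0#)
    ⟦⟧-+ 1ᵖ        a b = refl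
    ⟦⟧-+ (shift e) a b = trans (σ-cong (⟦⟧-+ e a b)) (σ-+ _ _)
    ⟦⟧-+ (e ⊕ f)   a b = trans (∙-cong (⟦⟧-+ e a b) (⟦⟧-+ f a b)) (interchange _ _ _ _)

    ⟦⟧-0 : ∀ e → ⟦ e ⟧ 0# ≈ 0#
    ⟦⟧-0 e = ∙-cancelˡ (⟦ e ⟧ 0#) _ _
      (trans (sym (⟦⟧-+ e 0# 0#)) (trans (⟦⟧-cong e (identityˡ 0#)) (sym (identityʳ _))))

    ⟦⟧-σ : ∀ e a → ⟦ e ⟧ (σ a) ≈ σ (⟦ e ⟧ a)
    ⟦⟧-σ 0ᵖ        a = sym σ-0
    ⟦⟧-σ 1ᵖ        a = refl
    ⟦⟧-σ (shift e) a = σ-cong (⟦⟧-σ e a)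
    ⟦⟧-σ (e ⊕ f)   a = trans (∙-cong (⟦⟧-σ e a) (⟦⟧-σ f a)) (sym (σ-+ _ _))

    ⟦⟧-comm : ∀ e f a → ⟦ e ⟧ (⟦ f ⟧ a) ≈ ⟦ f ⟧ (⟦ e ⟧ a)
    ⟦⟧-comm 0ᵖ        f a = sym (⟦⟧-0 f)
    ⟦⟧-comm 1ᵖ        f a = refl
    ⟦⟧-comm (shift e) f a = trans (σ-cong (⟦⟧-comm e f a)) (sym (⟦⟧-σ f _))
    ⟦⟧-comm (e ⊕ g)   f a = trans (∙-cong (⟦⟧-comm e f a) (⟦⟧-comm g f a)) (sym (⟦⟧-+ f _ _))

    abstract
      -- The values at a of all polynomials in σ form a σ-stable submonoid containing a.
      orbit : ∀ {a} → ¬ (a ≈ 0#) → ∀ b → ∃ λ e → ⟦ e ⟧ a ≈ b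
      orbit {a} = irreducible (λ b → ∃ λ e → ⟦ e ⟧ a ≈ b) (λ { eq (e , h) → e , trans h eq }) (0ᵖ , refl)
        (λ { (e , h) (f , h') → e ⊕ f , ∙-cong h h' }) (λ { (e , h) → shift e , σ-cong h }) (1ᵖ , refl)

      poly : Carrier → Poly
      poly a = proj₁ (orbit v≉0 a)

      poly-v : ∀ a → ⟦ poly a ⟧ v ≈ a
      poly-v a = proj₂ (orbit v≉0 a)

    _*_ : Carrier → Carrier → Carrier
    a * b = ⟦ poly a ⟧ b

    *-comm : ∀ a b → a * b ≈ b * a
    *-comm a b = begin
      ⟦ poly a ⟧ b                  ≈⟨ ⟦⟧-cong (poly a) (poly-v b) ⟨
      ⟦ poly a ⟧ (⟦ poly b ⟧ v)     ≈⟨ ⟦⟧-comm (poly a) (poly b) v ⟩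
      ⟦ poly b ⟧ (⟦ poly a ⟧ v)     ≈⟨ ⟦⟧-cong (poly b) (poly-v a) ⟩
      ⟦ poly b ⟧ a                  ∎

    *-congˡ : ∀ a {b c} → b ≈ c → a * b ≈ a * c
    *-congˡ a = ⟦⟧-cong (poly a)

    *-cong : ∀ {a b c d} → a ≈ b → c ≈ d → a * c ≈ b * d
    *-cong {a} {b} {c} {d} a≈b c≈d = begin
      a * c ≈⟨ *-congˡ a c≈d ⟩
      a * d ≈⟨ *-comm a d ⟩
      d * a ≈⟨ *-congˡ d a≈b ⟩
      d * b ≈⟨ *-comm d b ⟩
      b * d ∎

    *-assoc : ∀ a b c → (a * b) * c ≈ a * (b * c)
    *-assoc a b c = begin
      (a * b) * c ≈⟨ *-comm (a * b) c ⟩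
      c * (a * b) ≈⟨ ⟦⟧-comm (poly c) (poly a) b ⟩
      a * (c * b) ≈⟨ *-congˡ a (*-comm c b) ⟩
      a * (b * c) ∎

    *-distribˡ : ∀ a b c → a * (b + c) ≈ a * b + a * c
    *-distribˡ a = ⟦⟧-+ (poly a)

    *-distribʳ : ∀ a b c → (b + c) * a ≈ b * a + c * a
    *-distribʳ a b c = trans (*-comm (b + c) a) (trans (*-distribˡ a b c) (∙-cong (*-comm a b) (*-comm a c)))

    commutativeRing : CommutativeRing 0ℓ 0ℓ
    commutativeRing = record
      { Carrier = Carrier ; _≈_ = _≈_ ; _+_ = _+_ ; _*_ = _*_ ; -_ = -_ ; 0# = 0# ; 1# = v
      ; isCommutativeRing = record
        { isRing = record
          { +-isAbelianGroup = isAbelianGroup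
          ; *-cong = *-cong
          ; *-assoc = *-assoc
          ; *-identity = (λ a → trans (*-comm v a) (poly-v a)) , poly-v
          ; distrib = *-distribˡ , *-distribʳ }
        ; *-comm = *-comm } }

    abstract
      *-inverse : ∀ a → ¬ (a ≈ 0#) → ∃ λ b → a * b ≈ v
      *-inverse a a≉0 with orbit a≉0 v
      ... | e , ea≈v = ⟦ e ⟧ v , (begin
        ⟦ poly a ⟧ (⟦ e ⟧ v) ≈⟨ ⟦⟧-comm (poly a) e v ⟩
        ⟦ e ⟧ (⟦ poly a ⟧ v) ≈⟨ ⟦⟧-cong e (poly-v a) ⟩
        ⟦ e ⟧ a              ≈⟨ ea≈v ⟩
        v                    ∎)

    schurField : Field
    schurField = record { commRing = commutativeRing ; 0≉1 = λ eq → v≉0 (sym eq) ; inverse = *-inverse }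

    -- Multiplication by the field element σ v is the operator σ itself; this identifies conjugation
    -- by x with multiplication by α.
    σv* : ∀ a → σ v * a ≈ σ a
    σv* a = begin
      σ v * a            ≈⟨ *-comm (σ v) a ⟩
      ⟦ poly a ⟧ (σ v)   ≈⟨ ⟦⟧-σ (poly a) v ⟩
      σ (⟦ poly a ⟧ v)   ≈⟨ σ-cong (poly-v a) ⟩
      σ a                ∎

  prime-divisor : ∀ n → 1 < n → ∃ λ p → Prime p × p ∣ n
  prime-divisor n@(suc _) 1<n with factorise n
  ... | record { factors = [] ; isFactorisation = n≡1 } = ⊥-elim (ℕ.<⇒≢ 1<n (≡.sym n≡1))
  ... | record { factors = p ∷ ps ; isFactorisation = n≡pps ; factorsPrime = p-prime ∷ _ } =
    p , p-prime , divides (product ps) (≡.trans n≡pps (ℕ.*-comm p _))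

  module _ {m : ℕ} {_∙_ : Fin m → Fin m → Fin m} {ε : Fin m} {_⁻¹ : Fin m → Fin m}
    (isGroup : IsGroup _≡_ _∙_ ε _⁻¹) (x : Fin m) where
    open FiniteGroup isGroup

    -- A Paley structure for the pair (G, x) alone. `φ-kernel` later yields the condition on y,
    -- since y lies outside ⟨x⟩.
    record PaleyModel : Set₁ where
      field
        {p d n}   : ℕ
        F         : Field
      open Field F renaming (Carrier to FC) using (_≈_; 0#) public
      open FieldDefs F public
      field
        p-prime   : Prime p
        1≤d       : 1 ≤ d
        order-F   : HasOrder F (p ℕ.^ d)
        numerical : (n ≡ 1 × d ≡ 1) ⊎ (1 < n × MulOrderMod p d n)
        α         : FC
        α-order   : HasMulOrder α n
        φ         : Fin m → Aff
        φ-∙       : ∀ g h → φ (g ∙ h) ≈A (φ g ∘A φ h)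
        φ-inj     : ∀ g h → φ g ≈A φ h → g ≡ h
        φ-power   : ∀ g → ∃ λ k → fpow α k ≈ proj₁ (φ g)
        φ-onto    : ∀ k b → ∃ λ g → φ g ≈A (fpow α k , b)
        φ-x       : φ x ≈A (α , 0#)
        φ-kernel  : ∀ g → proj₂ (φ g) ≈ 0# → ⟨ x ⟩ g

  module _ {m : ℕ} {_∙_ : Fin m → Fin m → Fin m} {ε : Fin m} {_⁻¹ : Fin m → Fin m}
    (isGroup : IsGroup _≡_ _∙_ ε _⁻¹) where
    open FiniteGroup isGroup

    prime-order-element : ∀ {P : Fin m → Set} → Submonoid P → ∀ {v} → P v → v ≢ ε →
                          ∃ λ p → Prime p × ∃ λ w → P w × w ≢ ε × w ^ p ≡ ε
    prime-order-element S {v} v∈ v≢ε with order v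
    ... | n , 1≤n , vⁿ≡ε , minimal with prime-divisor n (ℕ.≤∧≢⇒< 1≤n λ 1≡n →
            v≢ε (≡.trans (≡.sym (^-1 v)) (≡.trans (≡.cong (v ^_) 1≡n) vⁿ≡ε)))
    ...   | p , p-prime , divides r n≡rp = p , p-prime , v ^ r , ^∈ S r v∈ ,
            minimal r 0<r r<n , ≡.trans (^-* v p r) (≡.trans (≡.cong (v ^_) (≡.trans (ℕ.*-comm p r) (≡.sym n≡rp))) vⁿ≡ε)
      where
      0<r : 1 ≤ r
      0<r = ℕ.n≢0⇒n>0 λ { ≡.refl → ℕ.<⇒≢ 1≤n (≡.sym n≡rp) }
      r<n : r < n
      r<n = ≡.subst (r <_) (≡.sym n≡rp)
        (ℕ.m<m*n r p {{ℕ.>-nonZero 0<r}} (ℕ.nonTrivial⇒n>1 p {{prime⇒nonTrivial p-prime}}))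

  module Model {m : ℕ} {_∙_ : Fin m → Fin m → Fin m} {ε : Fin m} {_⁻¹ : Fin m → Fin m}
    (isGroup : IsGroup _≡_ _∙_ ε _⁻¹)
    {x : Fin m} (x-maximal : FiniteGroup.CoreFreeMaximal isGroup x)
    (R : PrimitiveGroup.Retraction isGroup x-maximal) (semiregular : PrimitiveGroup.Retraction.Semiregular R)
    (N-abelian : ∀ {a b} → PrimitiveGroup.Retraction.N R a → PrimitiveGroup.Retraction.N R b → a ∙ b ≡ b ∙ a)
    {p : ℕ} (p-prime : Prime p) {v : Fin m} (v∈N : PrimitiveGroup.Retraction.N R v)
    (v≢ε : v ≢ ε) (vᵖ≡ε : FiniteGroup._^_ isGroup v p ≡ ε)
    where
    open FiniteGroup isGroup
    open PrimitiveGroup isGroup x-maximal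
    open Retraction R

    N-group : AbelianGroup 0ℓ 0ℓ
    N-group = record
      { Carrier = Σ (Fin m) N
      ; _≈_ = λ a b → proj₁ a ≡ proj₁ b
      ; _∙_ = λ a b → proj₁ a ∙ proj₁ b , ∙∈ N-submonoid (proj₂ a) (proj₂ b)
      ; ε = ε , ε∈ N-submonoid
      ; _⁻¹ = λ a → proj₁ a ⁻¹ , ⁻¹∈ N-submonoid (proj₂ a)
      ; isAbelianGroup = record
        { isGroup = record
          { isMonoid = record
            { isSemigroup = record
              { isMagma = record
                { isEquivalence = record { refl = ≡.refl ; sym = ≡.sym ; trans = ≡.trans }
                ; ∙-cong = ≡.cong₂ _∙_ }
              ; assoc = λ a b c → assoc _ _ _ }
            ; identity = (λ a → identityˡ _) , (λ a → identityʳ _) }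
          ; inverse = (λ a → inverseˡ _) , (λ a → inverseʳ _)
          ; ⁻¹-cong = ≡.cong _⁻¹ }
        ; comm = λ a b → N-abelian (proj₂ a) (proj₂ b) } }

    σ : Σ (Fin m) N → Σ (Fin m) N
    σ a = conj x (proj₁ a) , N-normal x _ (proj₂ a)

    N-irreducible : ∀ (K : Σ (Fin m) N → Set) → (∀ {a b} → proj₁ a ≡ proj₁ b → K a → K b) →
      K (ε , ε∈ N-submonoid) → (∀ {a b} → K a → K b → K (proj₁ a ∙ proj₁ b , ∙∈ N-submonoid (proj₂ a) (proj₂ b))) →
      (∀ {a} → K a → K (σ a)) → ∀ {a} → K a → ¬ (proj₁ a ≡ ε) → ∀ b → K b
    N-irreducible K K-≈ K-0 K-+ K-σ {a , a∈} k a≢ε (b , b∈) =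
      -- K depends on the proof of membership in N, so the predicate on G pairs such a proof with K,
      -- and `K-≈` exchanges it at the end.
      K-≈ ≡.refl (proj₂ (irreducible {λ g → Σ (N g) λ g∈ → K (g , g∈)}
        (submonoid (_ , K-0) λ (_ , k) (_ , k') → _ , K-+ k k')
        (λ (_ , k) → _ , K-σ k) (a∈ , k) a∈ a≢ε b b∈))

    N-module : SimpleModule
    N-module = record
      { abelianGroup = N-group ; σ = σ ; σ-cong = ≡.cong (conj x) ; σ-+ = λ a b → conj-∙ x _ _
      ; irreducible = N-irreducible ; v = v , v∈N ; v≉0 = v≢ε }

    open SchurField N-module using (σv*) renaming (schurField to F)
    open Field F using (_*_; 1#) renaming (Carrier to FC; _≈_ to _≈F_; semiring to F-semiring)
    open FieldDefs F
    open FieldTheory F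
    open Multiples F-semiring using () renaming (_×_ to _·_)

    ·-^ : ∀ n a → proj₁ (n · a) ≡ proj₁ a ^ n
    ·-^ zero    a = ≡.refl
    ·-^ (suc n) a = ≡.cong (proj₁ a ∙_) (·-^ n a)

    open Characteristic p-prime (≡.trans (·-^ p 1#) vᵖ≡ε)

    α : FC
    α = σ 1#

    fpow-α : ∀ k → proj₁ (fpow α k) ≡ conj (x ^ k) v
    fpow-α zero    = ≡.sym (ε-conj v)
    fpow-α (suc k) = ≡.trans (σv* (fpow α k)) (≡.trans (≡.cong (conj x) (fpow-α k)) (conj-conj x (x ^ k) v))

    fpow-* : ∀ k a → proj₁ (fpow α k * a) ≡ conj (x ^ k) (proj₁ a)
    fpow-* zero    a = ≡.trans (Field.*-identityˡ F a) (≡.sym (ε-conj _))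
    fpow-* (suc k) a = ≡.trans (Field.*-assoc F α (fpow α k) a) (≡.trans (σv* (fpow α k * a))
      (≡.trans (≡.cong (conj x) (fpow-* k a)) (conj-conj x (x ^ k) _)))

    -- If xʲ and xᵏ act alike on v, their quotient fixes v, and semiregularity makes it trivial.
    fpow-faithful : ∀ {j k} → fpow α j ≈F fpow α k → x ^ j ≡ x ^ k
    fpow-faithful {j} {k} eq = ≡.trans (solve 2 (λ a b → a ⊜ b ⊕ (⊝ b ⊕ a)) ≡.refl (x ^ j) (x ^ k))
      (≡.trans (≡.cong ((x ^ k) ∙_) (semiregular (∙∈ HS (⁻¹∈ HS (k , ≡.refl)) (j , ≡.refl)) v∈N v≢ε
        (≡.trans (≡.sym (conj-conj ((x ^ k) ⁻¹) (x ^ j) v))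
          (≡.trans (≡.cong (conj _) (≡.trans (≡.sym (fpow-α j)) (≡.trans eq (fpow-α k))))
                   (conj-inverseˡ (x ^ k) v))))) (identityʳ _))

    n = proj₁ (order x)

    α-order : HasMulOrder α n
    α-order = let 1≤n , xⁿ≡ε , minimal = proj₂ (order x) in
      1≤n , ≡.trans (fpow-α n) (≡.trans (≡.cong (λ t → conj t v) xⁿ≡ε) (ε-conj v)) ,
      λ k 1≤k k<n eq → minimal k 1≤k k<n (fpow-faithful {k} {0} eq)

    all-generated : ∀ a → Generated α a
    all-generated = N-irreducible (Generated α) gen-≈ gen-0 gen-+
      (λ {a} g → gen-≈ (σv* a) (gen-α g)) {1#} gen-1 v≢ε

    open Span (λ a b → proj₁ a ≟ proj₁ b) proj₁ (λ eq → eq) α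
    open Complete complete renaming (e to d; 1≤e to 1≤d)

    order-F : HasOrder F (p ℕ.^ d)
    order-F = record
      { _≟_ = λ a b → proj₁ a ≟ proj₁ b ; enum = E ; enum-inj = injective
      ; enum-surj = λ a → Generated⇒Im (all-generated a) }

    numerical : (n ≡ 1 × d ≡ 1) ⊎ (1 < n × MulOrderMod p d n)
    numerical = by-cases (1 ℕ.≟ n)
      where
      by-cases : Dec (1 ≡ n) → (n ≡ 1 × d ≡ 1) ⊎ (1 < n × MulOrderMod p d n)
      -- For n = 1 the divisibility already holds at k = 1, so d ≤ 1.
      by-cases (yes 1≡n) = inj₁ (≡.sym 1≡n , ℕ.≤-antisym
        (degree-minimal order-F all-generated α-order 1 ℕ.≤-refl (≡.subst (_∣ _) 1≡n (1∣ _))) 1≤d)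
      by-cases (no 1≢n) = inj₂ (ℕ.≤∧≢⇒< (proj₁ α-order) 1≢n , 1≤d , order∣ complete α-order ,
        λ k 1≤k k<d n∣ → ℕ.<⇒≱ k<d (degree-minimal order-F all-generated α-order k 1≤k n∣))

    exponent : Fin m → ℕ
    exponent g = proj₁ (V∈H g)

    x^exponent : ∀ g → x ^ exponent g ≡ V g
    x^exponent g = proj₂ (V∈H g)

    conj-exponent : ∀ g → proj₁ (fpow α (exponent g)) ≡ conj (V g) v
    conj-exponent g = ≡.trans (fpow-α (exponent g)) (≡.cong (λ t → conj t v) (x^exponent g))

    -- Read off from g = `part g` ∙ `V g`: N becomes the translations, and the H-component a power
    -- of α.
    φ : Fin m → Aff
    φ g = fpow α (exponent g) , (part g , part∈N g)

    part-determines : ∀ {g h} → V g ≡ V h → part g ≡ part h → g ≡ h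
    part-determines {g} {h} V≡ part≡ = ≡.trans (restore g) (≡.trans (≡.cong₂ _∙_ part≡ V≡) (≡.sym (restore h)))
      where
      restore : ∀ g → g ≡ part g ∙ V g
      restore g = solve 2 (λ g a → g ⊜ (g ⊕ ⊝ a) ⊕ a) ≡.refl g (V g)

    part-H : ∀ {h} → H h → part h ≡ ε
    part-H {h} h∈ = ≡.trans (≡.cong (λ t → h ∙ (t ⁻¹)) (V-id h∈)) (inverseʳ h)

    model : PaleyModel isGroup x
    model = record
      { p = p ; d = d ; n = n ; F = F ; p-prime = p-prime ; 1≤d = 1≤d ; order-F = order-F
      ; numerical = numerical ; α = α ; α-order = α-order ; φ = φ
      ; φ-∙ = λ g h →
          ≡.trans (conj-exponent (g ∙ h)) (≡.trans (≡.cong (λ t → conj t v) (V-∙ g h))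
            (≡.trans (≡.sym (conj-conj (V g) (V h) v))
            (≡.trans (≡.cong₂ conj (≡.sym (x^exponent g)) (≡.sym (conj-exponent h)))
                     (≡.sym (fpow-* (exponent g) (fpow α (exponent h))))))) ,
          -- The affine law puts the translation part of g last, `part-∙` puts it first;
          -- commutativity of N reconciles them.
          ≡.trans (part-∙ g h) (≡.trans (N-abelian (part∈N g) (N-normal (V g) _ (part∈N h)))
            (≡.cong (_∙ part g) (≡.trans (≡.cong (λ t → conj t (part h)) (≡.sym (x^exponent g)))
                                        (≡.sym (fpow-* (exponent g) (part h , part∈N h))))))
      ; φ-inj = λ g h (eq , eq') → part-determines
          (≡.trans (≡.sym (x^exponent g)) (≡.trans (fpow-faithful {exponent g} {exponent h} eq) (x^exponent h))) eq'
      ; φ-power = λ g → exponent g , ≡.refl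
      ; φ-onto = λ k (b , b∈) →
          let V≡ : V (b ∙ (x ^ k)) ≡ x ^ k
              V≡ = ≡.trans (V-∙ b _) (≡.trans (≡.cong₂ _∙_ b∈ (V-id (k , ≡.refl))) (identityˡ _))
          in b ∙ (x ^ k) ,
             ≡.trans (conj-exponent _) (≡.trans (≡.cong (λ t → conj t v) V≡) (≡.sym (fpow-α k))) ,
             ≡.trans (≡.cong (λ t → (b ∙ (x ^ k)) ∙ (t ⁻¹)) V≡) (solve 2 (λ b y → (b ⊕ y) ⊕ ⊝ y ⊜ b) ≡.refl b (x ^ k))
      ; φ-x = ≡.trans (conj-exponent x) (≡.cong (λ t → conj t v) (V-id (generator∈ x))) , part-H (generator∈ x)
      ; φ-kernel = λ g eq → ≡.subst H (part-determines (V-id (V∈H g)) (≡.trans (part-H (V∈H g)) (≡.sym eq))) (V∈H g)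
      }

-- Primitive and faithful dessins are generalised Paley dessins.

module PrimitiveDessins where
  open Solvers
  open FiniteCounting
  open FiniteGroups
  open FrobeniusComplements
  open FrobeniusKernels
  open PaleyModels
  open import Data.Fin.Properties using (any?)
  open import Data.Integer using (+_; -[1+_])
  import Relation.Binary.Reasoning.Setoid as SetoidReasoning

  module _ {m : ℕ} {_∙_ : Fin m → Fin m → Fin m} {ε : Fin m} {_⁻¹ : Fin m → Fin m}
    (isGroup : IsGroup _≡_ _∙_ ε _⁻¹)
    {x : Fin m} (x-maximal : FiniteGroup.CoreFreeMaximal isGroup x) where
    open FiniteGroup isGroup
    open CoreFreeMaximal x-maximal
    open PrimitiveGroup isGroup x-maximal

    -- With H = 1, maximality says that any nontrivial element generates G, so G is cyclic and N =
    -- G.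
    trivial-model : x ≡ ε → ∀ {g} → ¬ ⟨ x ⟩ g → PaleyModel isGroup x
    trivial-model x≡ε {g} g∉H =
      let p , p-prime , v , v∈ , v≢ε , vᵖ≡ε = prime-order-element isGroup N-submonoid {g} ≡.refl
                                                (λ g≡ε → g∉H (≡.subst H (≡.sym g≡ε) (ε∈ HS)))
      in Model.model isGroup x-maximal retraction (λ h∈ _ _ _ → H-trivial h∈)
           (λ {a} {b} _ _ → ⟨⟩-comm (G-cyclic a) (G-cyclic b)) p-prime v∈ v≢ε vᵖ≡ε
      where
      H-trivial : ∀ {h} → H h → h ≡ ε
      H-trivial (k , ≡.refl) = ≡.trans (≡.cong (_^ k) x≡ε) (ε^ k)
      retraction : Retraction
      retraction = record
        { V = λ _ → ε ; V-∙ = λ _ _ → ≡.sym (identityˡ ε) ; V∈H = λ _ → ε∈ HS ; V-id = λ h∈ → ≡.sym (H-trivial h∈) }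
      open Retraction retraction using (N-submonoid)
      G-cyclic : ∀ a → ⟨ g ⟩ a
      G-cyclic = maximal (cyclic g) (≡.subst ⟨ g ⟩ (≡.sym x≡ε) (ε∈ (cyclic g))) (generator∈ g) g∉H

    frobenius-model : x ≢ ε → ∀ {g} → ¬ ⟨ x ⟩ g → PaleyModel isGroup x
    frobenius-model x≢ε {g} g∉H =
      let p , p-prime , v , v∈ , v≢ε , vᵖ≡ε = prime-order-element isGroup N-submonoid (part∈N g) part≢ε
      in Model.model isGroup x-maximal R semiregular
           (Kernel.N-abelian isGroup x-maximal R semiregular x≢ε p-prime v∈ v≢ε vᵖ≡ε)
           p-prime v∈ v≢ε vᵖ≡ε
      where
      R = Transfer.retraction x≢ε
      open Retraction R
      part≢ε : part g ≢ ε
      part≢ε eq = g∉H (≡.subst H (≡.sym (≡.trans (solve 2 (λ g a → g ⊜ (g ⊕ ⊝ a) ⊕ a) ≡.refl g (V g))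
        (≡.trans (≡.cong (_∙ V g) eq) (identityˡ _)))) (V∈H g))
      -- If h fixes v under conjugation, then v fixes h, so h lies in H and in vHv⁻¹ while v is
      -- outside H.
      semiregular : ∀ {h v} → H h → N v → v ≢ ε → conj h v ≡ v → h ≡ ε
      semiregular {h} {v} h∈ v∈ v≢ε eq = malnormal x≢ε (λ v∈H → v≢ε (N∩H v∈ v∈H)) h∈
        (≡.subst H (≡.sym (comm⇒conj-fixed v h (≡.sym (conj-fixed⇒comm h v eq)))) h∈)

    paley-model : ∀ {g} → ¬ ⟨ x ⟩ g → PaleyModel isGroup x
    paley-model g∉H with x Fin.≟ ε
    ... | yes x≡ε = trivial-model x≡ε g∉H
    ... | no x≢ε  = frobenius-model x≢ε g∉H

  -- The enumeration that comes with a dessin may repeat elements; without repetitions, equality in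
  -- the group becomes equality of indices.
  record Enumeration {c ℓ} (S : Setoid c ℓ) : Set (c ⊔ ℓ) where
    open Setoid S
    field
      {size}    : ℕ
      e         : Fin size → Carrier
      injective : ∀ i j → e i ≈ e j → i ≡ j
      onto      : ∀ a → ∃ λ i → e i ≈ a

  module _ {c ℓ} (S : Setoid c ℓ) where
    open Setoid S

    remove-duplicates : Decidable _≈_ → ∀ {n} (f : Fin n → Carrier) → ∃ λ m → Σ (Fin m → Carrier) λ e →
      (∀ i j → e i ≈ e j → i ≡ j) × (∀ i → ∃ λ j → e j ≈ f i)
    remove-duplicates _≟_ {zero} f = 0 , f , (λ ()) , λ ()
    remove-duplicates _≟_ {suc n} f with remove-duplicates _≟_ (λ i → f (suc i))
    ... | m , e , inj , covers with any? (λ j → e j ≟ f zero)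
    ...   | yes found = m , e , inj , λ { zero → found ; (suc i) → covers i }
    ...   | no new = suc m , e' , inj' , λ { zero → zero , refl ; (suc i) → suc (proj₁ (covers i)) , proj₂ (covers i) }
      where
      e' : Fin (suc m) → Carrier
      e' zero    = f zero
      e' (suc j) = e j
      inj' : ∀ i j → e' i ≈ e' j → i ≡ j
      inj' zero    zero    eq = ≡.refl
      inj' zero    (suc j) eq = ⊥-elim (new (j , sym eq))
      inj' (suc i) zero    eq = ⊥-elim (new (i , eq))
      inj' (suc i) (suc j) eq = ≡.cong suc (inj i j eq)

    enumeration : Decidable _≈_ → ∀ {n} (f : Fin n → Carrier) → (∀ a → ∃ λ i → f i ≈ a) → Enumeration S
    enumeration _≟_ f f-onto =
      let _ , e , inj , covers = remove-duplicates _≟_ f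
      in record { e = e ; injective = inj ; onto = λ a →
           let i , eq = f-onto a ; j , eq' = covers i in j , trans eq' eq }

  module FiniteModel {c ℓ} (G : Group c ℓ) (enumerated : Enumeration (Group.setoid G)) where

    open Group G renaming (_∙_ to _·_)
    open Enumeration enumerated renaming (size to m; injective to e-injective; onto to e-onto)
    open GroupDefs G
    open GroupSolver G using () renaming (solve to solveG; _⊕_ to _⊕'_; ⊝_ to ⊝'_; _⊜_ to _⊜'_; one to one')
    open SetoidReasoning setoid

    index : Carrier → Fin m
    index g = proj₁ (e-onto g)

    e-index : ∀ g → e (index g) ≈ g
    e-index g = proj₂ (e-onto g)

    index-unique : ∀ {g i} → g ≈ e i → index g ≡ i
    index-unique eq = e-injective _ _ (trans (e-index _) eq)

    index-cong : ∀ {g h} → g ≈ h → index g ≡ index h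
    index-cong eq = index-unique (trans eq (sym (e-index _)))

    infixl 7 _∙_
    _∙_ : Fin m → Fin m → Fin m
    i ∙ j = index (e i · e j)

    1̂ : Fin m
    1̂ = index ε

    inv : Fin m → Fin m
    inv i = index (e i ⁻¹)

    isGroup' : IsGroup _≡_ _∙_ 1̂ inv
    isGroup' = record
      { isMonoid = record
        { isSemigroup = record
          { isMagma = record { isEquivalence = ≡.isEquivalence ; ∙-cong = ≡.cong₂ _∙_ }
          ; assoc = λ i j k → index-cong (trans (∙-congʳ (e-index _)) (trans (assoc _ _ _) (∙-congˡ (sym (e-index _))))) }
        ; identity = (λ i → index-unique (trans (∙-congʳ (e-index ε)) (identityˡ _)))
                   , (λ i → index-unique (trans (∙-congˡ (e-index ε)) (identityʳ _))) }
      ; inverse = (λ i → index-cong (trans (∙-congʳ (e-index _)) (inverseˡ _)))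
                , (λ i → index-cong (trans (∙-congˡ (e-index _)) (inverseʳ _)))
      ; ⁻¹-cong = ≡.cong inv }

    open FiniteGroup isGroup' using (Submonoid; ε∈; ∙∈; ⁻¹∈; ⟨_⟩; cyclic; ⟨⟩-minimal; conj; generator∈; _^_)

    index-∙ : ∀ g h → index (g · h) ≡ index g ∙ index h
    index-∙ g h = index-cong (∙-cong (sym (e-index g)) (sym (e-index h)))

    index-⁻¹ : ∀ g → index (g ⁻¹) ≡ inv (index g)
    index-⁻¹ g = index-cong (⁻¹-cong (sym (e-index g)))

    index-pow : ∀ g n → index (pow g n) ≡ index g ^ n
    index-pow g zero    = ≡.refl
    index-pow g (suc n) = ≡.trans (index-∙ g (pow g n)) (≡.cong (index g ∙_) (index-pow g n))

    to-cyclic : ∀ {g h} → h ∈⟨ g ⟩ → ⟨ index g ⟩ (index h)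
    to-cyclic {g} (+ n , eq) = n , ≡.trans (≡.sym (index-pow g n)) (index-cong eq)
    to-cyclic {g} (-[1+ n ] , eq) = ≡.subst ⟨ index g ⟩
      (≡.trans (≡.sym (index-⁻¹ (pow g (suc n)))) (index-cong eq))
      (⁻¹∈ (cyclic (index g)) (suc n , ≡.sym (index-pow g (suc n))))

    from-cyclic : ∀ {g h} → ⟨ index g ⟩ (index h) → h ∈⟨ g ⟩
    from-cyclic {g} {h} (n , eq) = + n , (begin
      pow g n              ≈⟨ e-index _ ⟨
      e (index (pow g n))  ≡⟨ ≡.cong e (≡.trans (index-pow g n) eq) ⟩
      e (index h)          ≈⟨ e-index h ⟩
      h                    ∎)

    -- That g fixes the coset of h reads (gh)⁻¹h ∈ ⟨x⟩, and this element is the inverse of the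
    -- conjugate of g by h⁻¹; so the kernel of the action is the core.
    index-conj : ∀ g h → index ((e g · h) ⁻¹ · h) ≡ inv (conj (inv (index h)) g)
    index-conj g h = index-cong (begin
      (e g · h) ⁻¹ · h
        ≈⟨ solveG 2 (λ a h → ⊝' (a ⊕' h) ⊕' h ⊜' ⊝' ((⊝' h ⊕' a) ⊕' ⊝' ⊝' h)) refl (e g) h ⟩
      ((h ⁻¹ · e g) · (h ⁻¹) ⁻¹) ⁻¹
        ≈⟨ ⁻¹-cong (∙-cong (∙-congʳ h⁻¹) (⁻¹-cong h⁻¹)) ⟨
      ((e (inv (index h)) · e g) · e (inv (index h)) ⁻¹) ⁻¹
        ≈⟨ ⁻¹-cong (∙-cong (e-index _) (e-index _)) ⟨
      (e (inv (index h) ∙ g) · e (inv (inv (index h)))) ⁻¹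
        ≈⟨ ⁻¹-cong (e-index _) ⟨
      e (conj (inv (index h)) g) ⁻¹ ∎)
      where
      h⁻¹ : e (inv (index h)) ≈ h ⁻¹
      h⁻¹ = trans (e-index _) (⁻¹-cong (e-index h))

    core-free : ∀ {x} → Faithful x → ∀ g → (∀ h → ⟨ index x ⟩ (conj h g)) → g ≡ 1̂
    core-free {x} faithful g core = ≡.sym (index-unique (sym (faithful (e g) λ h →
      from-cyclic (≡.subst ⟨ index x ⟩ (≡.sym (index-conj g h)) (⁻¹∈ (cyclic (index x)) (core (inv (index h))))))))

    -- The left cosets of a subgroup K above ⟨x⟩ are the blocks of a system that identifies ε with
    -- k.
    maximal : ∀ {x} → Primitive x → ∀ {K : Fin m → Set} → Submonoid K → K (index x) →
              ∀ {k} → K k → ¬ ⟨ index x ⟩ k → ∀ g → K g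
    maximal {x} (_ , universal) {K} S x∈ {k} k∈ k∉ g =
      ≡.subst K (quotient-ε g) (lower (universal R blocks
        (ε , e k , lift (≡.subst K (≡.sym (quotient-ε k)) k∈) ,
          λ same → k∉ (≡.subst ⟨ index x ⟩ (quotient-ε k) (to-cyclic same))) ε (e g)))
      where
      R : Carrier → Carrier → Set (c ⊔ ℓ)
      R a b = Lift (c ⊔ ℓ) (K (index (a ⁻¹ · b)))
      quotient-ε : ∀ i → index (ε ⁻¹ · e i) ≡ i
      quotient-ε i = index-unique (solveG 1 (λ a → ⊝' one' ⊕' a ⊜' a) refl (e i))
      blocks : BlockSystem x R
      blocks = record
        { isEquivalence = record
          { refl = λ {a} → lift (≡.subst K (index-cong (sym (inverseˡ a))) (ε∈ S))
          ; sym = λ {a} {b} r → lift (≡.subst K (≡.trans (≡.sym (index-⁻¹ _))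
                    (index-cong (solveG 2 (λ a b → ⊝' (⊝' a ⊕' b) ⊜' ⊝' b ⊕' a) refl a b))) (⁻¹∈ S (lower r)))
          ; trans = λ {a} {b} {d} r s → lift (≡.subst K (≡.trans (≡.sym (index-∙ _ _))
                    (index-cong (solveG 3 (λ a b d → (⊝' a ⊕' b) ⊕' (⊝' b ⊕' d) ⊜' ⊝' a ⊕' d) refl a b d)))
                    (∙∈ S (lower r) (lower s))) }
        ; coarser = λ same → lift (⟨⟩-minimal S x∈ (to-cyclic same))
        ; invariant = λ k {a} {b} r → lift (≡.subst K
            (index-cong (solveG 3 (λ k a b → ⊝' a ⊕' b ⊜' ⊝' (k ⊕' a) ⊕' (k ⊕' b)) refl k a b)) (lower r)) }

  module _ {c ℓ} (D : RegularDessin c ℓ) where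
    open RegularDessin D
    open Group group
    open IsFiniteGroup finite
    open GroupDefs group

    primitive-faithful⇒paley : Primitive x × Faithful x → IsoToGenPaley D
    primitive-faithful⇒paley (is-primitive@((g , g∉) , _) , faithful) =
      p , d , n , F , p-prime , 1≤d , order-F , numerical , α , α-order , (λ g → φ (index g)) ,
      (λ g h eq → ≡⇒≈A (≡.cong φ (index-cong eq))) ,
      (λ g h → trans-≈A (≡⇒≈A (≡.cong φ (index-∙ g h))) (φ-∙ (index g) (index h))) ,
      (λ g h eq → trans (sym (e-index g)) (trans (reflexive (≡.cong e (φ-inj _ _ eq))) (e-index h))) ,
      (λ g → φ-power (index g)) ,
      (λ k b → let i , eq = φ-onto k b in e i , trans-≈A (≡⇒≈A (≡.cong φ (index-unique refl))) eq) ,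
      φ-x ,
      -- If y were in ⟨x⟩, then G = ⟨x⟩ and there would be only one black vertex.
      (λ y∈S → g∉H (all (index g) (φ-kernel (index y) y∈S)))
      where
      enumerated : Enumeration setoid
      enumerated = enumeration setoid _≟_ enum enum-surj
      open Enumeration enumerated using (e)
      open FiniteModel group enumerated
      open GroupSolver group using (_⊜_; _⊕_; ⊝_; one)
      open FiniteGroup isGroup' using (⟨_⟩; cyclic; generator∈; ε∈; ∙∈; ⁻¹∈)
      g∉H : ¬ ⟨ index x ⟩ (index g)
      g∉H h = g∉ (let k , eq = from-cyclic h in k , trans eq
        (GroupSolver.solve group 1 (λ a → a ⊜ ⊝ one ⊕ a) refl g))
      x-maximal : FiniteGroup.CoreFreeMaximal isGroup' (index x)
      x-maximal = record { maximal = maximal is-primitive ; core-free = core-free faithful }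
      open PaleyModel (paley-model isGroup' x-maximal g∉H)
      module F = Field F
      ≡⇒≈A : ∀ {a b} → a ≡ b → a ≈A b
      ≡⇒≈A ≡.refl = F.refl , F.refl
      trans-≈A : ∀ {a b c} → a ≈A b → b ≈A c → a ≈A c
      trans-≈A (p , q) (r , s) = F.trans p r , F.trans q s
      all : ∀ i → ⟨ index x ⟩ (index y) → ⟨ index x ⟩ i
      all i y∈ = ≡.subst ⟨ index x ⟩ (index-unique (proj₂ (generates (e i)))) (words (proj₁ (generates (e i))))
        where
        words : ∀ w → ⟨ index x ⟩ (index (evalW x y w))
        words wx = generator∈ (index x)
        words wy = y∈
        words we = ε∈ (cyclic (index x))
        words (wmul u w) = ≡.subst ⟨ index x ⟩ (≡.sym (index-∙ _ _)) (∙∈ (cyclic (index x)) (words u) (words w))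
        words (winv u) = ≡.subst ⟨ index x ⟩ (≡.sym (index-⁻¹ _)) (⁻¹∈ (cyclic (index x)) (words u))

-- Generalised Paley dessins are primitive and faithful.

module PaleyDessins where
  open Solvers
  open FiniteFields
  import Algebra.Properties.Group as GroupProperties
  open import Data.Integer using (+_; -[1+_])
  open import Relation.Binary using (module IsEquivalence)
  import Relation.Binary.Reasoning.Setoid as SetoidReasoning

  module _ {c ℓ} (D : RegularDessin c ℓ) where
    open RegularDessin D
    open Group group
    open GroupProperties group using (∙-cancelˡ)
    open GroupDefs group

    paley⇒primitive-faithful : IsoToGenPaley D → Primitive x × Faithful x
    paley⇒primitive-faithful (p , d , n , F , p-prime , 1≤d , order-F , numerical , α , α-order , φ ,
      φ-cong , φ-∙ , φ-inj , φ-power , φ-onto , φ-x , y∉S) = is-primitive , faithful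
      where
      open Field F using (_+_; _*_; 0#; 1#; +-cong; +-congˡ; +-congʳ; *-cong; *-congˡ; *-congʳ; zeroʳ; zeroˡ; *-assoc;
        *-identityˡ; *-identityʳ; +-identityˡ; +-identityʳ; distribʳ; +-comm)
        renaming (Carrier to FC; _≈_ to _≈F_; refl to reflF; sym to symF; trans to transF)
      open FieldDefs F
      open FieldTheory F
      open Characteristic p-prime (p·1≈0 d order-F) using (Generated; Generated-elim)
      open GroupSolver group
      module FR = SetoidReasoning (Field.setoid F)
      open FR

      -- `tr g` is the image of 0 under the affine map of g. It serves as the coordinate in 𝔽_q of
      -- the black vertex of g, as ⟨x⟩ is the stabiliser of 0.
      dil tr : Carrier → FC
      dil g = proj₁ (φ g)
      tr g  = proj₂ (φ g)

      -- φ is given as respecting products; the preimage of the identity map is idempotent, hence ε.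
      φ-ε : φ ε ≈A (1# , 0#)
      φ-ε =
        let g , da , tb = φ-onto 0 0#
            idempotent : g ∙ g ≈ g
            idempotent = φ-inj (g ∙ g) g
              ( transF (proj₁ (φ-∙ g g)) (transF (*-cong da reflF) (*-identityˡ _))
              , transF (proj₂ (φ-∙ g g)) (transF (+-congʳ (transF (*-congˡ tb) (zeroʳ _))) (+-identityˡ _)) )
            g≈ε = ∙-cancelˡ g g ε (trans idempotent (sym (identityʳ g)))
            dε , tε = φ-cong ε g (sym g≈ε)
        in transF dε da , transF tε tb

      tr-∙ : ∀ g h → tr (g ∙ h) ≈F dil g * tr h + tr g
      tr-∙ g h = proj₂ (φ-∙ g h)

      φ-pow : ∀ k → φ (pow x k) ≈A (fpow α k , 0#)
      φ-pow zero    = φ-ε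
      φ-pow (suc k) =
        let dk , tk = φ-pow k ; dx , tx = φ-x
        in transF (proj₁ (φ-∙ x (pow x k))) (*-cong dx dk) ,
           transF (tr-∙ x (pow x k)) (transF (+-cong (transF (*-congˡ tk) (zeroʳ _)) tx) (+-identityˡ 0#))

      dil≉0 : ∀ g → ¬ (dil g ≈F 0#)
      dil≉0 g dg≈0 = Field.0≉1 F (begin
        0#                      ≈⟨ zeroˡ _ ⟨
        0# * dil (g ⁻¹)         ≈⟨ *-congʳ dg≈0 ⟨
        dil g * dil (g ⁻¹)      ≈⟨ proj₁ (φ-∙ g (g ⁻¹)) ⟨
        dil (g ∙ g ⁻¹)          ≈⟨ proj₁ (φ-cong _ _ (inverseʳ g)) ⟩
        dil ε                   ≈⟨ proj₁ φ-ε ⟩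
        1#                      ∎)

      ∈⟨x⟩⇒tr≈0 : ∀ {g} → g ∈⟨ x ⟩ → tr g ≈F 0#
      ∈⟨x⟩⇒tr≈0 {g} (+ k , eq) = transF (proj₂ (φ-cong _ _ (sym eq))) (proj₂ (φ-pow k))
      ∈⟨x⟩⇒tr≈0 {g} (-[1+ k ] , eq) = begin
        tr g                                ≈⟨ +-identityˡ _ ⟨
        0# + tr g                           ≈⟨ +-congʳ (transF (*-congˡ (proj₂ (φ-pow (suc k)))) (zeroʳ _)) ⟨
        dil g * tr (pow x (suc k)) + tr g   ≈⟨ tr-∙ g (pow x (suc k)) ⟨
        tr (g ∙ pow x (suc k))              ≈⟨ proj₂ (φ-cong _ _ (trans (∙-congʳ (sym eq)) (inverseˡ _))) ⟩
        tr ε                                ≈⟨ proj₂ φ-ε ⟩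
        0#                                  ∎

      tr≈0⇒∈⟨x⟩ : ∀ {g} → tr g ≈F 0# → g ∈⟨ x ⟩
      tr≈0⇒∈⟨x⟩ {g} tg≈0 =
        let k , eq = φ-power g ; dk , tk = φ-pow k
        in + k , φ-inj (pow x k) g (transF dk eq , transF tk (symF tg≈0))

      tr-quotient : ∀ g h → tr h ≈F dil g * tr (g ⁻¹ ∙ h) + tr g
      tr-quotient g h = transF
        (proj₂ (φ-cong _ _ (solve 2 (λ g h → h ⊜ g ⊕ (⊝ g ⊕ h)) refl g h))) (tr-∙ g (g ⁻¹ ∙ h))

      SameCoset⇒tr : ∀ {g h} → SameCoset x g h → tr g ≈F tr h
      SameCoset⇒tr {g} {h} same = begin
        tr g                              ≈⟨ +-identityˡ _ ⟨
        0# + tr g                         ≈⟨ +-congʳ (transF (*-congˡ (∈⟨x⟩⇒tr≈0 same)) (zeroʳ _)) ⟨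
        dil g * tr (g ⁻¹ ∙ h) + tr g      ≈⟨ tr-quotient g h ⟨
        tr h                              ∎

      tr⇒SameCoset : ∀ {g h} → tr g ≈F tr h → SameCoset x g h
      tr⇒SameCoset {g} {h} eq = tr≈0⇒∈⟨x⟩ (*-nonzero (dil≉0 g)
        (GroupProperties.∙-cancelʳ (Field.+-group F) (tr g) _ 0#
          (transF (symF (tr-quotient g h)) (transF (symF eq) (symF (+-identityˡ _))))))

      -- An affine map fixing 0 and 1 is the identity.
      faithful : Faithful x
      faithful g fixes =
        let h₀ , d₀ , t₀ = φ-onto 0 0#
            h₁ , d₁ , t₁ = φ-onto 0 1#
            acts : ∀ h → dil g * tr h + tr g ≈F tr h
            acts h = transF (symF (tr-∙ g h)) (SameCoset⇒tr (fixes h))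
            tg≈0 = begin
              tr g                    ≈⟨ +-identityˡ _ ⟨
              0# + tr g               ≈⟨ +-congʳ (transF (*-congˡ t₀) (zeroʳ _)) ⟨
              dil g * tr h₀ + tr g    ≈⟨ acts h₀ ⟩
              tr h₀                   ≈⟨ t₀ ⟩
              0#                      ∎
            dg≈1 = begin
              dil g                   ≈⟨ *-identityʳ _ ⟨
              dil g * 1#              ≈⟨ *-congˡ t₁ ⟨
              dil g * tr h₁           ≈⟨ +-identityʳ _ ⟨
              dil g * tr h₁ + 0#      ≈⟨ +-congˡ tg≈0 ⟨
              dil g * tr h₁ + tr g    ≈⟨ acts h₁ ⟩
              tr h₁                   ≈⟨ t₁ ⟩
              1#                      ∎
        in φ-inj g ε (transF dg≈1 (symF (proj₁ φ-ε)) , transF tg≈0 (symF (proj₂ φ-ε)))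

      is-primitive : Primitive x
      is-primitive = (y , λ same → y∉S (transF (symF (SameCoset⇒tr same)) (proj₂ φ-ε))) , universal
        where
        universal : ∀ (R : Rel Carrier (c ⊔ ℓ)) → BlockSystem x R →
                    (∃₂ λ g h → R g h × ¬ SameCoset x g h) → ∀ g h → R g h
        universal R blocks (g₀ , h₀ , r₀ , distinct) g h =
          -- By invariance it is enough to relate ε to g⁻¹h, whose translation part lies in U.
          R-trans (coarser (tr⇒SameCoset (proj₂ (φ-cong _ _ (sym (identityʳ g))))))
            (R-trans (invariant g (R-tr (U-all (tr (g ⁻¹ ∙ h)))))
              (R-≈ (solve 2 (λ g h → g ⊕ (⊝ g ⊕ h) ⊜ h) refl g h)))
          where
          open BlockSystem blocks using (coarser; invariant)
          open IsEquivalence (BlockSystem.isEquivalence blocks) using () renaming (trans to R-trans)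
          -- The block of the base coset, as a set of translations.
          U : FC → Set (c ⊔ ℓ)
          U b = ∃ λ t → tr t ≈F b × R ε t
          R-≈ : ∀ {a b} → a ≈ b → R a b
          R-≈ eq = coarser (tr⇒SameCoset (proj₂ (φ-cong _ _ eq)))
          R-tr : ∀ {t} → U (tr t) → R ε t
          R-tr (t' , eq , r) = R-trans r (coarser (tr⇒SameCoset eq))
          U-≈ : ∀ {a b} → a ≈F b → U a → U b
          U-≈ eq (t , eq' , r) = t , transF eq' eq , r
          U-0 : U 0#
          U-0 = ε , proj₂ φ-ε , R-≈ refl
          -- Translation s by a carries the relation between ε and t' to one between s and st',
          -- while s is related to ε because a is in U.
          U-+ : ∀ {a b} → U a → U b → U (a + b)
          U-+ {a} {b} (t , ta , r) (t' , tb , r') =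
            let s , ds , ts = φ-onto 0 a
            in s ∙ t' ,
               transF (tr-∙ s t') (transF (+-cong (transF (*-cong ds tb) (*-identityˡ b)) ts) (+-comm b a)) ,
               R-trans (R-tr (t , transF ta (symF ts) , r)) (R-trans (R-≈ (sym (identityʳ s))) (invariant s r'))
          -- x belongs to the base coset, so multiplying a relation between ε and t by x keeps it at
          -- the base point.
          U-α : ∀ {a} → U a → U (α * a)
          U-α (t , ta , r) = x ∙ t ,
            transF (tr-∙ x t) (transF (+-cong (*-cong (proj₁ φ-x) ta) (proj₂ φ-x)) (+-identityʳ _)) ,
            R-trans (coarser (tr⇒SameCoset (transF (proj₂ φ-ε) (transF (symF (proj₂ φ-x))
                      (proj₂ (φ-cong _ _ (sym (identityʳ x)))))))) (invariant x r)
          -- The two distinct cosets, moved back to the base point, give a nonzero translation in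
          -- the block. Its multiples by 𝔽ₚ[α] = 𝔽_q fill the field.
          u = tr (g₀ ⁻¹ ∙ h₀)
          u≉0 : ¬ (u ≈F 0#)
          u≉0 eq = distinct (tr≈0⇒∈⟨x⟩ eq)
          U-u : U u
          U-u = g₀ ⁻¹ ∙ h₀ , reflF , R-trans (R-≈ (sym (inverseˡ g₀))) (invariant (g₀ ⁻¹) r₀)
          U-multiple : ∀ {a} → Generated α a → U (a * u)
          U-multiple = Generated-elim (λ a → U (a * u)) (λ eq → U-≈ (*-congʳ eq))
            (U-≈ (symF (zeroˡ u)) U-0) (U-≈ (symF (*-identityˡ u)) U-u)
            (λ {a} {b} h k → U-≈ (symF (distribʳ u a b)) (U-+ h k))
            (λ {a} h → U-≈ (symF (*-assoc α a u)) (U-α h))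
          U-all : ∀ b → U b
          U-all b =
            let u⁻¹ , uu⁻¹≈1 = Field.inverse F u u≉0
            in U-≈ (begin
                 (b * u⁻¹) * u   ≈⟨ *-assoc b u⁻¹ u ⟩
                 b * (u⁻¹ * u)   ≈⟨ *-congˡ (transF (Field.*-comm F u⁻¹ u) uu⁻¹≈1) ⟩
                 b * 1#          ≈⟨ *-identityʳ b ⟩
                 b               ∎)
               (U-multiple (FieldTheory.generates F p-prime order-F numerical α-order (b * u⁻¹)))

theorem1p1 : ∀ {c ℓ} (D : RegularDessin c ℓ) →
    (GroupDefs.Primitive (RegularDessin.group D) (RegularDessin.x D) ×
    GroupDefs.Faithful (RegularDessin.group D) (RegularDessin.x D))
    ⇔ IsoToGenPaley D
theorem1p1 D = mk⇔ (PrimitiveDessins.primitive-faithful⇒paley D) (PaleyDessins.paley⇒primitive-faithful D)
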